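{- Let $k\ge 2$, let $\mathbb{S}$ be a marked surface, and let $\mathcal{M}$ be either $\mathcal{A}_{{\rm SL}_k,\mathbb{S}}$ or $\mathcal{A}'_{{\rm SL}_k,\mathbb{S}}$. Then any pseudotagged diagram invariant $[(T,\varphi)]$ (a rational function on $\mathcal{M}$, where $T$ is an $\mathcal{M}$-tensor diagram and $\varphi$ is a pseudotagging of $T$) is a linear combination of tagged diagram invariants.
   Context: **Marked surfaces.** $\mathbb{S}=(\mathbf{S},\mathbb{M})$ is an oriented marked surface (in the sense of Fomin–Shapiro–Thurston): $\mathbf S$ is a compact oriented surface, possibly with boundary, and $\mathbb{M}$ is a finite nonempty set of marked points with at least one on each boundary component. $\mathbb{M}_\circ$ denotes the marked points in the interior (the punctures) and $\mathbb{M}_\partial$ those on the boundary. Excluded throughout: spheres with at most $2$ punctures, the unpunctured monogon and digon, and the once-punctured monogon. **Moduli spaces.** $V$ is a $k$-dimensional complex vector space with volume form $\xi$, identifying $\bigwedge^k V\cong\mathbb{C}$; $G={\rm SL}(V)={\rm SL}_k$. An affine flag $F$ is a choice of tensors $F_{(i)}\in\bigwedge^i V$ with $F_{(k)}=\xi$ and such that for each $i\in[k-1]$ there is $v\in V$ with $F_{(i)}\wedge v=F_{(i+1)}$. A $G$-local system on $\mathbb{S}$ is a copy $V_x$ of $(V,\xi)$ at each point $x$ and, for each path $x\to y$, a $\xi$-preserving transport isomorphism $V_x\to V_y$ depending only on the isotopy class of the path (for $k$ even one uses twisted local systems, i.e. local systems on the punctured tangent bundle with fiber monodromy $-{\rm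 Id}$; this only affects signs). A point of $\mathcal{A}_{{\rm SL}_k,\mathbb{S}}$ is such a local system with an affine flag $F_p$ in $V_p$ at every marked point $p$, such that at each puncture $p$ the monodromy $u_p$ of a simple loop contractible to $p$ stabilizes $F_p$; such data are considered up to simultaneous $G$-action. $\mathcal{A}'_{{\rm SL}_k,\mathbb{S}}$ is defined in the same way, except that each boundary point $p$ is decorated by a vector $v_p\in V_p$ instead of an affine flag. **Weyl group action on affine flags.** Let $u$ be unipotent and stabilize $F$. For $i\in[k-1]$ choose $v$ with $F_{(i+1)}=F_{(i)}\wedge v$; then $s_i\cdot F$ is the affine flag whose $i$th step is $F_{(i-1)}\wedge(u(v)-v)$ and whose other steps agree with those of $F$ (defined when $u(v)-v\notin{\rm span}\,F_{(i-1)}$). These satisfy the relations of the simple transpositions and define a rational action of the symmetric group $W=S_k$. Convention: if the one-line notation of $w$ is obtained from that of the identity by successively swapping the entries in adjacent positions $(i_1,i_1+1),\dots,(i_\ell,i_\ell+1)$, then $w\cdot F=s_{i_\ell}\cdot(\cdots(s_{i_1}\cdot F))$. The tensor $(w\cdot F)_{(a)}$ depends only on the set $w([a])$. **Tensor diagrams.** An $\mathcal{M}$-tensor diagram is an immersed, edge-labeled, acyclic directed graph $T\subset\mathbf{S}$ (up to isotopy fixing marked points) such that: every marked point is a source vertex of $T$ and the other vertices lie in ${\rm int}\,\mathbf S\setminus\mathbb{M}_\circ$; edges have endpoints at vertices and otherwise avoid $\mathbb{M}$ and $\partial\mathbf S$; there are finitely many self-crossings, each a transverse crossing of two edges; each edge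 $e$ has a label ${\rm wt}(e)\in[k]$, with ${\rm wt}(e)=1$ for edges incident to boundary points when $\mathcal{M}=\mathcal{A}'_{{\rm SL}_k,\mathbb{S}}$; each vertex which is not a marked point is one of: a white vertex (incoming labels $a_1,\dots,a_m$, one outgoing edge labeled $a_1+\cdots+a_m$), a black vertex (one incoming edge labeled $a_1+\cdots+a_m$, outgoing labels $a_1,\dots,a_m$), a coevaluation leaf (a single outgoing edge labeled $k$), or an evaluation leaf (a single incoming edge labeled $k$). A leg is an edge incident to a puncture; ${\rm Legs}_p(T)$ is the set of legs at $p$ and ${\rm Legs}(T)$ the set of all legs. **Evaluation.** White vertices encode the exterior product $\bigotimes_j\bigwedge^{a_j}V\to\bigwedge^{\sum a_j}V$; black vertices encode the dual map $\bigwedge^{\sum a_j}V\to\bigotimes_j\bigwedge^{a_j}V$ (the signed sum over all ways of shuffling the vectors of a decomposable tensor into the factors); evaluation (coevaluation) leaves encode $\bigwedge^kV\cong\mathbb{C}$ (its inverse). Given $z\in\mathcal{M}$, assign a tensor in $\bigwedge^{{\rm wt}(e)}V_{s(e)}$ to every edge $e$ whose source $s(e)$ is a marked point or coevaluation leaf: the decoration at the marked point (its vector, or the ${\rm wt}(e)$th step of its affine flag), respectively $\xi$. Transporting along edges and composing the maps at vertices gives a number $[T](z)$; $[T]$ is the (plain) invariant of $T$. **Tagging.** A pseudotagged tensor diagram is a pair $(T,\varphi)$ with $\varphi$ assigning to each leg $e$ a subset $\varphi(e)\subseteq[k]$ with $|\varphi(e)|={\rm wt}(e)$. It is a tagged tensor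 diagram (and $\varphi$ is a tagging) if in addition, for any two legs $e,e'$ at the same puncture, $\varphi(e)\subseteq\varphi(e')$ or $\varphi(e')\subseteq\varphi(e)$. The invariant $[(T,\varphi)]$ is the rational function on $\mathcal{M}$ defined like $[T]$, except that the tensor assigned to a leg $e$ at a puncture $p$ is $(w_e\cdot F_p)_{({\rm wt}(e))}$ (action computed with $u=u_p$), where $w_e\in W$ is any permutation with $w_e([{\rm wt}(e)])=\varphi(e)$. A pseudotagged (resp. tagged) diagram invariant is a function of the form $[(T,\varphi)]$ with $(T,\varphi)$ pseudotagged (resp. tagged). -}

module Defs where

open import Algebra.Apartness.Bundles using (HeytingField; HeytingCommutativeRing)
open import Algebra.Bundles using (CommutativeRing)
open import Data.Bool.Base using (Bool; true; false; if_then_else_)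
import Data.Bool.Properties as Bool
open import Data.Fin.Base using (Fin; zero; suc; toℕ)
import Data.Fin.Properties as Fin
open import Data.Fin.Subset using (Subset; inside; outside; ⊥; ⊤; ⁅_⁆; _⊆_; _∪_; _─_; ⋃; ∣_∣)
open import Data.Fin.Subset.Properties using (_∈?_; _⊆?_; ∪-identityˡ; ∣p∣≤n)
open import Data.List.Base
  using (List; []; _∷_; _++_; map; foldr; foldl; filter; take; drop; length; allFin; tabulate;
         cartesianProductWith)
open import Data.List.Properties using (length-map; map-tabulate; length-tabulate; foldl-++; take-map)
open import Data.List.Membership.Propositional using (_∈_)
open import Data.List.Relation.Unary.Unique.Propositional using (Unique)
open import Data.Nat.ListAction using (sum)
open import Data.Nat.Base as ℕ using (ℕ; zero; suc; pred; _≤_; _<_; z≤n; s≤s)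
import Data.Nat.Properties as ℕ
open import Data.Product.Base using (Σ; Σ-syntax; ∃; ∃-syntax; _×_; _,_; proj₁; proj₂; swap)
open import Data.Sum.Base using (_⊎_; inj₁; inj₂)
open import Data.Vec.Base as Vec using ([]; _∷_)
open import Data.Vec.Functional as Vector using (Vector)
import Data.Vec.Properties as Vec
open import Function.Base using (_∘_; id)
open import Function.Bundles using (_⇔_)
open import Level using (Level; _⊔_)
open import Relation.Binary.Construct.Closure.Transitive using (TransClosure)
open import Relation.Binary.PropositionalEquality
  using (_≡_; _≢_; refl; sym; trans; cong; cong₂; subst; module ≡-Reasoning)
open import Relation.Nullary using (¬_; Dec; does)

------------------------------------------------------------------------
-- Marked surfaces and paths on them

-- A connected compact oriented surface with marked points is determined up
-- to orientation-preserving homeomorphism by its genus, the number of its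
-- punctures and the numbers of marked points on its boundary components.

record MarkedSurface : Set where
  field
    genus punctures boundaries : ℕ
    marked        : Fin boundaries → ℕ
    marked≥1      : ∀ i → 1 ≤ marked i
    nonempty      : 1 ≤ punctures ℕ.+ boundaries
    notSphere≤2   : genus ≡ 0 → boundaries ≡ 0 → 3 ≤ punctures
    notMonoDigon  : genus ≡ 0 → boundaries ≡ 1 → punctures ≡ 0 → ∀ i → 3 ≤ marked i
    notPMonogon   : genus ≡ 0 → boundaries ≡ 1 → punctures ≡ 1 → ∀ i → 2 ≤ marked i

module Surface (𝕊 : MarkedSurface) where
  open MarkedSurface 𝕊 public

  Puncture : Set
  Puncture = Fin punctures

  BoundaryPoint : Set
  BoundaryPoint = Σ[ i ∈ Fin boundaries ] Fin (marked i)

  MarkedPoint : Set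
  MarkedPoint = Puncture ⊎ BoundaryPoint

  data Site : Set where
    base : Site
    at   : MarkedPoint → Site

  site : ∀ {A : Set} → MarkedPoint ⊎ A → Site
  site (inj₁ m) = at m
  site (inj₂ _) = base

  -- Generators of the fundamental groupoid of the unit tangent bundle of
  -- 𝐒 ∖ 𝕄∘, on the objects `Site` (each with a chosen tangent direction; a
  -- puncture stands for a point close to it).  `handleᵃ`, `handleᵇ` are the
  -- standard curves of a handle, `boundary i` runs to the i-th boundary
  -- component, around it and back, `tail m` joins a marked point to the
  -- interior base point, and `loop p` is the simple loop contractible to p.
  -- The closed curves are lifted by their tangent directions.

  data Generator : Site → Site → Set where
    handleᵃ  : Fin genus → Generator base base
    handleᵇ  : Fin genus → Generator base base
    boundary : Fin boundaries → Generator base base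
    tail     : (m : MarkedPoint) → Generator (at m) base
    loop     : (p : Puncture) → Generator (at (inj₁ p)) (at (inj₁ p))

  infixr 5 _▷_
  infix  6 _⁻¹

  -- `fibre` is a full turn of the tangent direction; p ▷ q is p followed by q.

  data Path : Site → Site → Set where
    gen   : ∀ {x y} → Generator x y → Path x y
    ε     : ∀ {x} → Path x x
    fibre : ∀ {x} → Path x x
    _⁻¹   : ∀ {x y} → Path x y → Path y x
    _▷_   : ∀ {x y z} → Path x y → Path y z → Path x z

  concatenate : List (Path base base) → Path base base
  concatenate = foldr _▷_ ε

  -- The defining relation is ∏[aᵢ,bᵢ] · ∏ tₚ⁻¹ cₚ tₚ · ∏ dᵢ = fibre^χ for
  -- tangential lifts, where χ = 2 - 2·genus - (punctures + boundaries).  As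
  -- fibre² acts trivially below, only the parity of the exponent matters.

  relator : Path base base
  relator = concatenate
    (  map (λ i → let a = gen (handleᵃ i); b = gen (handleᵇ i) in a ▷ b ▷ a ⁻¹ ▷ b ⁻¹) (allFin genus)
    ++ map (λ p → let t = gen (tail (inj₁ p)) in t ⁻¹ ▷ gen (loop p) ▷ t) (allFin punctures)
    ++ map (λ i → gen (boundary i)) (allFin boundaries))

  turns : Path base base
  turns = concatenate (map (λ _ → fibre) (allFin (punctures ℕ.+ boundaries)))

-- The two moduli spaces differ in the decoration of boundary marked points.

data Space : Set where
  𝒜 𝒜′ : Space

------------------------------------------------------------------------
-- Tensor diagrams

-- A vertex that is not a marked point.  The lists give the order in which
-- the edges are met when going around the vertex.

data Vertex (k : ℕ) {E : Set} (wt : E → ℕ) : Set where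
  white        : (ins : List E) (out : E) → wt out ≡ sum (map wt ins) → Vertex k wt
  black        : (inn : E) (outs : List E) → wt inn ≡ sum (map wt outs) → Vertex k wt
  coevaluation : (out : E) → wt out ≡ k → Vertex k wt
  evaluation   : (inn : E) → wt inn ≡ k → Vertex k wt

incoming outgoing : ∀ {k E} {wt : E → ℕ} → Vertex k wt → List E
incoming (white ins _ _)      = ins
incoming (black inn _ _)      = inn ∷ []
incoming (coevaluation _ _)   = []
incoming (evaluation inn _)   = inn ∷ []
outgoing (white _ out _)      = out ∷ []
outgoing (black _ outs _)     = outs
outgoing (coevaluation out _) = out ∷ []
outgoing (evaluation _ _)     = []

module Diagrams (k : ℕ) (𝕊 : MarkedSurface) (ℳ : Space) where
  open Surface 𝕊

  -- An immersed diagram enters only through the abstract graph, the order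
  -- of the edges at each vertex, and the homotopy classes of its (tangent
  -- lifts of) edges, after dragging the inner vertices to the base point.
  -- Conversely all such data come from an immersion.

  record TensorDiagram : Set where
    field
      #vertices #edges : ℕ

    Node : Set
    Node = Fin #vertices

    Edge : Set
    Edge = Fin #edges

    field
      source   : Edge → MarkedPoint ⊎ Node
      target   : Edge → Node
      wt       : Edge → ℕ
      1≤wt     : ∀ e → 1 ≤ wt e
      wt≤k     : ∀ e → wt e ≤ k
      wt-bdry  : ℳ ≡ 𝒜′ → ∀ e b → source e ≡ inj₁ (inj₂ b) → wt e ≡ 1
      vertex   : Node → Vertex k wt
      target⇔  : ∀ e v → target e ≡ v ⇔ e ∈ incoming (vertex v)
      source⇔  : ∀ e v → source e ≡ inj₂ v ⇔ e ∈ outgoing (vertex v)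
      unique-in  : ∀ v → Unique (incoming (vertex v))
      unique-out : ∀ v → Unique (outgoing (vertex v))

    _⟶_ : Node → Node → Set
    v ⟶ w = ∃[ e ] source e ≡ inj₂ v × target e ≡ w

    field
      acyclic : ∀ v → ¬ TransClosure _⟶_ v v
      path    : ∀ e → Path (site (source e)) base

    IsLegAt : Puncture → Edge → Set
    IsLegAt p e = source e ≡ inj₁ (inj₁ p)

  -- Only the values of φ on legs are meaningful.

  record PseudotaggedDiagram : Set where
    field
      diagram : TensorDiagram
    open TensorDiagram diagram public
    field
      φ    : Edge → Subset k
      ∣φ∣  : ∀ p e → IsLegAt p e → ∣ φ e ∣ ≡ wt e

  IsTagged : PseudotaggedDiagram → Set
  IsTagged D = ∀ p e e′ → IsLegAt p e → IsLegAt p e′ → φ e ⊆ φ e′ ⊎ φ e′ ⊆ φ e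
    where open PseudotaggedDiagram D

  TaggedDiagram : Set
  TaggedDiagram = Σ PseudotaggedDiagram IsTagged

------------------------------------------------------------------------
-- Permutations as words in the simple transpositions

-- The letter i : Fin (pred k) stands for s_{toℕ i + 1}.

Word : ℕ → Set
Word k = List (Fin (pred k))

swapAt : ∀ {A : Set} → ℕ → List A → List A
swapAt zero    (x ∷ y ∷ xs) = y ∷ x ∷ xs
swapAt zero    xs           = xs
swapAt (suc i) (x ∷ xs)     = x ∷ swapAt i xs
swapAt (suc i) []           = []

swaps : ∀ {n} {A : Set} → List A → List (Fin n) → List A
swaps = foldl (λ xs i → swapAt (toℕ i) xs)

oneLine : ∀ k → Word k → List (Fin k)
oneLine k = swaps (allFin k)

fromList : ∀ {k} → List (Fin k) → Subset k
fromList = ⋃ ∘ map ⁅_⁆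

-- w([a])
image : ∀ k → Word k → ℕ → Subset k
image k w a = fromList (take a (oneLine k w))

private
  fsuc : ∀ {n} → Fin n → Fin (suc n)
  fsuc = suc

  up : ∀ {n} → Fin (pred n) → Fin n
  up {suc n} i = suc i

  toℕ-up : ∀ {n} (i : Fin (pred n)) → toℕ (up {n} i) ≡ suc (toℕ i)
  toℕ-up {suc n} i = refl

  wordOf : ∀ {n} → Subset n → Word n
  wordOf {zero} []                  = []
  wordOf {suc n} (true ∷ S)  = map (up {n}) (wordOf S)
  wordOf {suc n} (false ∷ S) = map (up {n}) (wordOf S) ++ take ∣ S ∣ (allFin n)

  swapAt-map : ∀ {A B : Set} (f : A → B) i xs → swapAt i (map f xs) ≡ map f (swapAt i xs)
  swapAt-map f zero    []           = refl
  swapAt-map f zero    (x ∷ [])     = refl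
  swapAt-map f zero    (x ∷ y ∷ xs) = refl
  swapAt-map f (suc i) []           = refl
  swapAt-map f (suc i) (x ∷ xs)     = cong (f x ∷_) (swapAt-map f i xs)

  swaps-map : ∀ {n} {A B : Set} (f : A → B) xs (is : List (Fin n)) →
              swaps (map f xs) is ≡ map f (swaps xs is)
  swaps-map f xs []       = refl
  swaps-map f xs (i ∷ is) = trans (cong (λ ys → swaps ys is) (swapAt-map f (toℕ i) xs))
                                  (swaps-map f (swapAt (toℕ i) xs) is)

  swaps-up : ∀ {n} {A : Set} (x : A) xs (is : List (Fin (pred n))) →
             swaps (x ∷ xs) (map (up {n}) is) ≡ x ∷ swaps xs is
  swaps-up {n} x xs []       = refl
  swaps-up {n} x xs (i ∷ is) =
    trans (cong (λ j → swaps (swapAt j (x ∷ xs)) (map (up {n}) is)) (toℕ-up {n} i))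
          (swaps-up {n} x (swapAt (toℕ i) xs) is)

  swaps-suc : ∀ {n} {A : Set} (x : A) xs (is : List (Fin n)) →
              swaps (x ∷ xs) (map fsuc is) ≡ x ∷ swaps xs is
  swaps-suc x xs []       = refl
  swaps-suc x xs (i ∷ is) = swaps-suc x (swapAt (toℕ i) xs) is

  allFin-suc : ∀ n → tabulate {n = n} fsuc ≡ map fsuc (allFin n)
  allFin-suc n = sym (map-tabulate id fsuc)

  length-swapAt : ∀ {A : Set} i (xs : List A) → length (swapAt i xs) ≡ length xs
  length-swapAt zero    []           = refl
  length-swapAt zero    (x ∷ [])     = refl
  length-swapAt zero    (x ∷ y ∷ xs) = refl
  length-swapAt (suc i) []           = refl
  length-swapAt (suc i) (x ∷ xs)     = cong suc (length-swapAt i xs)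

  length-swaps : ∀ {n} {A : Set} (xs : List A) (is : List (Fin n)) → length (swaps xs is) ≡ length xs
  length-swaps xs []       = refl
  length-swaps xs (i ∷ is) = trans (length-swaps (swapAt (toℕ i) xs) is) (length-swapAt (toℕ i) xs)

  bubble : ∀ {A : Set} (x : A) xs n a → length xs ≡ n →
           swaps (x ∷ xs) (take a (allFin n)) ≡ take a xs ++ x ∷ drop a xs
  bubble x xs       n       zero    eq = refl
  bubble x []       zero    (suc a) eq = refl
  bubble x (y ∷ xs) (suc n) (suc a) eq = begin
    swaps (y ∷ x ∷ xs) (take a (tabulate fsuc))
      ≡⟨ cong (λ l → swaps (y ∷ x ∷ xs) (take a l)) (allFin-suc n) ⟩
    swaps (y ∷ x ∷ xs) (take a (map fsuc (allFin n)))
      ≡⟨ cong (swaps (y ∷ x ∷ xs)) (take-map a (allFin n)) ⟩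
    swaps (y ∷ x ∷ xs) (map fsuc (take a (allFin n)))
      ≡⟨ swaps-suc y (x ∷ xs) (take a (allFin n)) ⟩
    y ∷ swaps (x ∷ xs) (take a (allFin n))
      ≡⟨ cong (y ∷_) (bubble x xs n a (ℕ.suc-injective eq)) ⟩
    y ∷ (take a xs ++ x ∷ drop a xs) ∎
    where open ≡-Reasoning

  take-take-++ : ∀ {A : Set} a (xs ys : List A) → a ≤ length xs → take a (take a xs ++ ys) ≡ take a xs
  take-take-++ zero    xs       ys _         = refl
  take-take-++ (suc a) (x ∷ xs) ys (s≤s a≤) = cong (x ∷_) (take-take-++ a xs ys a≤)

  fromList-suc : ∀ {n} (xs : List (Fin n)) → fromList (map fsuc xs) ≡ outside ∷ fromList xs
  fromList-suc []       = refl
  fromList-suc (x ∷ xs) = cong (⁅ suc x ⁆ ∪_) (fromList-suc xs)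

  oneLine-up : ∀ n (is : Word n) →
               swaps (allFin (suc n)) (map (up {n}) is) ≡ zero ∷ map fsuc (oneLine n is)
  oneLine-up n is = begin
    swaps (zero ∷ tabulate fsuc) (map (up {n}) is)   ≡⟨ swaps-up {n} zero (tabulate fsuc) is ⟩
    zero ∷ swaps (tabulate fsuc) is                  ≡⟨ cong (λ l → zero ∷ swaps l is) (allFin-suc n) ⟩
    zero ∷ swaps (map fsuc (allFin n)) is            ≡⟨ cong (zero ∷_) (swaps-map fsuc (allFin n) is) ⟩
    zero ∷ map fsuc (oneLine n is)                     ∎
    where open ≡-Reasoning

  image-wordOf : ∀ {n} (S : Subset n) → image n (wordOf S) ∣ S ∣ ≡ S
  image-wordOf [] = refl
  image-wordOf {suc n} (true ∷ S) = begin
    fromList (take (suc ∣ S ∣) (oneLine (suc n) (wordOf (true ∷ S))))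
      ≡⟨ cong (fromList ∘ take (suc ∣ S ∣)) (oneLine-up n (wordOf S)) ⟩
    ⁅ zero ⁆ ∪ fromList (take ∣ S ∣ (map fsuc (oneLine n (wordOf S))))
      ≡⟨ cong (λ l → ⁅ zero ⁆ ∪ fromList l) (take-map ∣ S ∣ (oneLine n (wordOf S))) ⟩
    ⁅ zero ⁆ ∪ fromList (map fsuc (take ∣ S ∣ (oneLine n (wordOf S))))
      ≡⟨ cong (⁅ zero ⁆ ∪_) (fromList-suc (take ∣ S ∣ (oneLine n (wordOf S)))) ⟩
    inside ∷ (⊥ ∪ image n (wordOf S) ∣ S ∣)
      ≡⟨ cong (inside ∷_) (trans (∪-identityˡ (image n (wordOf S) ∣ S ∣)) (image-wordOf S)) ⟩
    true ∷ S ∎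
    where open ≡-Reasoning
  image-wordOf {suc n} (false ∷ S) = begin
    fromList (take a (swaps (allFin (suc n)) (map (up {n}) w ++ take a (allFin n))))
      ≡⟨ cong (fromList ∘ take a)
           (foldl-++ (λ xs i → swapAt (toℕ i) xs) (allFin (suc n)) (map (up {n}) w) (take a (allFin n))) ⟩
    fromList (take a (swaps (swaps (allFin (suc n)) (map (up {n}) w)) (take a (allFin n))))
      ≡⟨ cong (λ l → fromList (take a (swaps l (take a (allFin n))))) (oneLine-up n w) ⟩
    fromList (take a (swaps (zero ∷ L) (take a (allFin n))))
      ≡⟨ cong (fromList ∘ take a) (bubble zero L n a length-L) ⟩
    fromList (take a (take a L ++ zero ∷ drop a L))
      ≡⟨ cong fromList (take-take-++ a L (zero ∷ drop a L) (subst (a ≤_) (sym length-L) (∣p∣≤n S))) ⟩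
    fromList (take a L)
      ≡⟨ cong fromList (take-map a (oneLine n w)) ⟩
    fromList (map fsuc (take a (oneLine n w)))
      ≡⟨ fromList-suc (take a (oneLine n w)) ⟩
    outside ∷ image n w a
      ≡⟨ cong (outside ∷_) (image-wordOf S) ⟩
    false ∷ S ∎
    where
    open ≡-Reasoning
    a : ℕ
    a = ∣ S ∣
    w : Word n
    w = wordOf S
    L : List (Fin (suc n))
    L = map fsuc (oneLine n w)
    length-L : length L ≡ n
    length-L = trans (length-map fsuc (oneLine n w))
                     (trans (length-swaps (allFin n) w) (length-tabulate id))

representative : ∀ {k} (S : Subset k) → Σ[ w ∈ Word k ] image k w ∣ S ∣ ≡ S
representative S = wordOf S , image-wordOf S

------------------------------------------------------------------------
-- Finite enumerations

allSubsets : ∀ k → List (Subset k)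
allSubsets zero    = [] ∷ []
allSubsets (suc k) = map (inside ∷_) (allSubsets k) ++ map (outside ∷_) (allSubsets k)

subsetsOfSize : ∀ k → ℕ → List (Subset k)
subsetsOfSize k a = filter (λ S → ∣ S ∣ ℕ.≟ a) (allSubsets k)

-- All functions selecting an element of each list.
selections : ∀ {n} {A : Set} → (Fin n → List A) → List (Fin n → A)
selections {zero}  Ls = (λ ()) ∷ []
selections {suc n} Ls = cartesianProductWith Vector._∷_ (Ls zero) (selections (Ls ∘ suc))

------------------------------------------------------------------------
-- Exterior algebra of V = 𝕂ᵏ in coordinates

module Exterior {c ℓ₁ ℓ₂ : Level} (𝕂 : HeytingField c ℓ₁ ℓ₂) (k : ℕ) where
  open CommutativeRing
    (HeytingCommutativeRing.commutativeRing (HeytingField.heytingCommutativeRing 𝕂)) public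
    using (Carrier; _≈_; _+_; _*_; -_; 0#; 1#)

  ∑ ∏ : ∀ {a} {A : Set a} → List A → (A → Carrier) → Carrier
  ∑ xs f = foldr (λ x s → f x + s) 0# xs
  ∏ xs f = foldr (λ x s → f x * s) 1# xs

  -- (-1)ⁿ
  sign : ℕ → Carrier
  sign zero    = 1#
  sign (suc n) = - sign n

  V : Set c
  V = Vector Carrier k

  -- ⋀V: a tensor is given by its coordinates in the basis
  -- e_S = e_{s₁} ∧ … ∧ e_{sₐ} for S = {s₁ < … < sₐ}.

  Λ : Set c
  Λ = Subset k → Carrier

  infix 4 _≋_
  _≋_ : Λ → Λ → Set ℓ₁
  x ≋ y = ∀ S → x S ≈ y S

  𝟎 : Λ
  𝟎 _ = 0#

  HasDegree : ℕ → Λ → Set ℓ₁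
  HasDegree a x = ∀ S → ∣ S ∣ ≢ a → x S ≈ 0#

  basis : Subset k → Λ
  basis R S = if does (Vec.≡-dec Bool._≟_ R S) then 1# else 0#

  𝟏 ξ : Λ
  𝟏 = basis ⊥
  ξ = basis ⊤

  ι : V → Λ
  ι v S = ∑ (allFin k) λ i → v i * basis ⁅ i ⁆ S

  -- e_A ∧ e_B = shuffleSign A B · e_{A ∪ B}
  shuffleSign : ∀ {n} → Subset n → Subset n → Carrier
  shuffleSign []          []          = 1#
  shuffleSign (true ∷ A)  (true ∷ B)  = 0#
  shuffleSign (true ∷ A)  (false ∷ B) = shuffleSign A B
  shuffleSign (false ∷ A) (true ∷ B)  = sign ∣ A ∣ * shuffleSign A B
  shuffleSign (false ∷ A) (false ∷ B) = shuffleSign A B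

  infixr 7 _∧_
  _∧_ : Λ → Λ → Λ
  (x ∧ y) S = ∑ (filter (_⊆? S) (allSubsets k)) λ A →
                shuffleSign A (S ─ A) * (x A * y (S ─ A))

  ⋀ : List Λ → Λ
  ⋀ = foldr _∧_ 𝟏

  -- g i j is the i-th coordinate of g(eⱼ).
  Matrix : Set c
  Matrix = Fin k → Fin k → Carrier

  scalar : Carrier → Matrix
  scalar a i j = if does (i Fin.≟ j) then a else 0#

  infixl 8 _·_
  _·_ : Matrix → Matrix → Matrix
  (g · h) i j = ∑ (allFin k) λ m → g i m * h m j

  _$ᵥ_ : Matrix → V → V
  (g $ᵥ v) i = ∑ (allFin k) λ j → g i j * v j

  -- The image of e_R under the map of ⋀V induced by g.
  columns : Matrix → Subset k → Λ
  columns g R = ⋀ (map (λ j → ι (λ i → g i j)) (filter (_∈? R) (allFin k)))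

  _$_ : Matrix → Λ → Λ
  (g $ x) S = ∑ (allSubsets k) λ R → x R * columns g R S

  infix 4 _≋ₘ_
  _≋ₘ_ : Matrix → Matrix → Set ℓ₁
  g ≋ₘ h = ∀ i j → g i j ≈ h i j

  -- Isomorphisms (V,ξ) → (V,ξ).
  record SL : Set (c ⊔ ℓ₁) where
    field
      to from : Matrix
      to·from : to · from ≋ₘ scalar 1#
      from·to : from · to ≋ₘ scalar 1#
      volume  : to $ ξ ≋ ξ

  -- Only the steps 0, …, k are meaningful.
  record AffineFlag : Set (c ⊔ ℓ₁) where
    field
      step   : ℕ → Λ
      degree : ∀ i → i ≤ k → HasDegree i (step i)
      step-0 : step 0 ≋ 𝟏
      step-k : step k ≋ ξ
      extend : ∀ i → i < k → ∃[ v ] step i ∧ ι v ≋ step (suc i)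

  open AffineFlag public

  Stabilizes : Matrix → AffineFlag → Set ℓ₁
  Stabilizes u F = ∀ i → i ≤ k → u $ step F i ≋ step F i

  -- The span of a decomposable tensor v₁ ∧ … ∧ vₐ ≠ 0.
  _∈span_ : V → Λ → Set ℓ₁
  w ∈span x = x ∧ ι w ≋ 𝟎

  -- G = s_{i+1} · F, including that the right-hand side is defined.
  record Reflects (u : Matrix) (i : Fin (pred k)) (F G : AffineFlag) : Set (c ⊔ ℓ₁) where
    j : ℕ
    j = toℕ i
    field
      v         : V
      completes : step F (suc j) ∧ ι v ≋ step F (suc (suc j))
    difference : V
    difference m = (u $ᵥ v) m + - v m
    field
      defined : ¬ (difference ∈span step F j)
      changed : step G (suc j) ≋ step F j ∧ ι difference
      others  : ∀ a → a ≤ k → a ≢ suc j → step G a ≋ step F a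

  -- G = s_{i_ℓ} · (⋯ (s_{i_1} · F)) for the word i_1 ⋯ i_ℓ.
  data Acts (u : Matrix) : Word k → AffineFlag → AffineFlag → Set (c ⊔ ℓ₁) where
    done : ∀ {F G} → (∀ a → a ≤ k → step G a ≋ step F a) → Acts u [] F G
    next : ∀ {i w F G H} → Reflects u i F G → Acts u w G H → Acts u (i ∷ w) F H

------------------------------------------------------------------------
-- Moduli spaces and diagram invariants

module Moduli {c ℓ₁ ℓ₂ : Level} (𝕂 : HeytingField c ℓ₁ ℓ₂)
              (k : ℕ) (𝕊 : MarkedSurface) (ℳ : Space) where
  open Exterior 𝕂 k public
  open Surface 𝕊
  open Diagrams k 𝕊 ℳ public

  -- Transport along paths and along reversed paths.  Twisted local systems,
  -- for even k, are local systems on the unit tangent bundle with fibre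
  -- monodromy -Id; for odd k the fibre monodromy (-1)ᵏ⁻¹ is trivial.
  transports : (∀ {x y} → Generator x y → SL) → ∀ {x y} → Path x y → Matrix × Matrix
  transports hol (gen g) = SL.to (hol g) , SL.from (hol g)
  transports hol ε       = scalar 1# , scalar 1#
  transports hol fibre   = scalar (sign (pred k)) , scalar (sign (pred k))
  transports hol (p ⁻¹)  = swap (transports hol p)
  transports hol (p ▷ q) = proj₁ (transports hol q) · proj₁ (transports hol p)
                         , proj₂ (transports hol p) · proj₂ (transports hol q)

  BoundaryDecoration : Space → Set (c ⊔ ℓ₁)
  BoundaryDecoration 𝒜  = AffineFlag
  BoundaryDecoration 𝒜′ = Level.Lift ℓ₁ V

  -- A representative of a point of ℳ, with each fibre identified with
  -- (𝕂ᵏ, ξ).  Invariants do not depend on the representative.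
  record Point : Set (c ⊔ ℓ₁) where
    field
      holonomy : ∀ {x y} → Generator x y → SL

    transport : ∀ {x y} → Path x y → Matrix
    transport = proj₁ ∘ transports holonomy

    field
      relation : transport relator ≋ₘ transport turns

    monodromy : Puncture → Matrix
    monodromy p = transport (gen (loop p))

    field
      flag     : Puncture → AffineFlag
      stable   : ∀ p → Stabilizes (monodromy p) (flag p)
      boundary-decoration : BoundaryPoint → BoundaryDecoration ℳ

  -- A point in the locus where the rational action of the Weyl group at all
  -- punctures is defined.  All diagram invariants are functions there.
  record RegularPoint : Set (c ⊔ ℓ₁) where
    field
      point : Point
    open Point point public
    field
      act      : Puncture → Word k → AffineFlag
      act-acts : ∀ p w → Acts (monodromy p) w (flag p) (act p w)

  boundaryTensor : (M : Space) → BoundaryDecoration M → ℕ → Λ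
  boundaryTensor 𝒜  F              a = step F a
  boundaryTensor 𝒜′ (Level.lift v) a = ι v

  module _ (D : PseudotaggedDiagram) (z : RegularPoint) where
    open PseudotaggedDiagram D
    open RegularPoint z

    legTensor : Puncture → Edge → Λ
    legTensor p e = step (act p (proj₁ (representative (φ e)))) (wt e)

    -- A labelling assigns to e the set σ e indexing a basis tensor at its
    -- source and the set τ e indexing one at its target.
    Labelling : Set
    Labelling = Edge → Subset k

    labellings : List Labelling
    labellings = selections (λ e → subsetsOfSize k (wt e))

    -- Matrix entries of the maps at the vertices.  That of the shuffle
    -- coproduct is the sign with which e_{σ(out₁)} ⊗ e_{σ(out₂)} ⊗ ⋯ occurs
    -- in the image of e_{τ(inn)}, i.e. that of e_{τ(inn)} in ⋀ᵢ e_{σ(outᵢ)}.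
    vertexEntry : Labelling → Labelling → Vertex k wt → Carrier
    vertexEntry σ τ (white ins out _)      = ⋀ (map (basis ∘ τ) ins) (σ out)
    vertexEntry σ τ (black inn outs _)     = ⋀ (map (basis ∘ σ) outs) (τ inn)
    vertexEntry σ τ (coevaluation out _)   = ξ (σ out)
    vertexEntry σ τ (evaluation inn _)     = ξ (τ inn)

    edgeEntry : Labelling → Labelling → Edge → Carrier
    edgeEntry σ τ e = columns (transport (path e)) (σ e) (τ e)

    sourceEntry : Labelling → Edge → Carrier
    sourceEntry σ e with source e
    ... | inj₁ (inj₁ p) = legTensor p e (σ e)
    ... | inj₁ (inj₂ b) = boundaryTensor ℳ (boundary-decoration b) (wt e) (σ e)
    ... | inj₂ _        = 1#

    -- The composition of all these maps, as a tensor network contraction.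
    ⟦_⟧at_ : Carrier
    ⟦_⟧at_ =
      ∑ labellings λ σ → ∑ labellings λ τ →
          ∏ (allFin #vertices) (λ v → vertexEntry σ τ (vertex v))
        * ∏ (allFin #edges) (λ e → edgeEntry σ τ e * sourceEntry σ e)

  IsLinearCombinationOfTagged : PseudotaggedDiagram → Set (c ⊔ ℓ₁)
  IsLinearCombinationOfTagged D =
    ∃[ terms ] ∀ (z : RegularPoint) →
      (⟦ D ⟧at z) ≈ ∑ {A = Carrier × TaggedDiagram} terms (λ (a , T , _) → a * (⟦ T ⟧at z))

-- The ground field, ℂ in the classical setting, may be any field with this property.
CharacteristicZero : ∀ {c ℓ₁ ℓ₂} → HeytingField c ℓ₁ ℓ₂ → Set ℓ₂
CharacteristicZero 𝕂 = ∀ n → multiple (suc n) # 0#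
  where
  open HeytingField 𝕂
  multiple : ℕ → Carrier
  multiple zero    = 0#
  multiple (suc n) = 1# + multiple n

{-# OPTIONS --safe #-}
module Submission where

-- Let u be the monodromy at a puncture with flag F, and N = u - 1.  As u
-- stabilizes F, N moves each step of the flag into the previous one, and all
-- flags w · F have the lines of F as steps: (w · F)₍ₐ₎ = λ F₍ₐ₎, where
-- λ = ∏_{i ∈ w([a])} yᵢ / ∏_{i ≤ a} yᵢ and yᵢ₊₁ / yᵢ is the coefficient by which N
-- maps the (i+1)-st vector of the flag to the i-th one.  Suppose two legs at
-- the puncture carry incomparable sets A and B with |A| ≤ |B|, and let x ∈ A ∖ B.
-- Writing F_S for the tensor with tag S and h = |B| + 1 - |A|,
--
--   F_A ⊗ F_B = ∑ⱼ (F_{A ∖ x} ∧ Nʰ eⱼ) ⊗ (contraction of F_{B ∪ x} with eⱼ*):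
--
-- of the vectors that can be split off F_{B ∪ x}, all but the last one are
-- moved by Nʰ into the span of F_{A ∖ x}, and the scalars λ match.  Expanding Nʰ
-- in powers of u, the right-hand side is a combination of diagrams in which
-- the leg B ∪ x forks and its part of weight 1 runs around the puncture before
-- it joins the leg A ∖ x (if A ∖ x = ∅, it replaces the leg A).  Since the weights
-- |A| ≤ |B| are spread apart, the sum of k² - wt² over all legs decreases, and
-- iteration ends with tagged diagrams.

open import Defs
open import Algebra.Apartness.Bundles using (HeytingField; HeytingCommutativeRing)
open import Algebra.Bundles using (CommutativeRing)
open import Data.Bool.Base using (true; false; if_then_else_)
import Data.Bool.Properties as Bool
open import Data.Empty using (⊥-elim)
open import Data.Fin.Base using (Fin; zero; suc; toℕ; fromℕ<; _↑ˡ_; _↑ʳ_; splitAt; join)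
import Data.Fin.Properties as Fin
open import Data.Fin.Subset using (Subset; inside; outside; ∣_∣; _∪_; _─_; ⁅_⁆; ⊥; ⊤; _⊆_)
import Data.Fin.Subset as Subset
import Data.Fin.Subset.Properties as Subset
open import Data.List.Base
  using (List; []; _∷_; _++_; map; foldr; filter; take; length; allFin; tabulate; concatMap;
         cartesianProduct; cartesianProductWith)
open import Data.List.Properties
  using (map-tabulate; map-∘; map-cong; map-cong-local; take-map; length-tabulate)
open import Data.List.Membership.Propositional using (_∈_; _∉_)
open import Data.List.Membership.Propositional.Properties
  using (∈-map⁺; ∈-map⁻; ∈-allFin; ∈-cartesianProductWith⁻; ∈-filter⁻)
import Data.List.Membership.DecPropositional as DecMembership
open import Data.List.Relation.Unary.All as All using (All; []; _∷_)
import Data.List.Relation.Unary.AllPairs as AllPairs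
open import Data.List.Relation.Unary.Any using (here; there)
open import Data.List.Relation.Unary.Unique.Propositional using (Unique)
import Data.List.Relation.Unary.Unique.Propositional.Properties as Unique
open import Data.List.Relation.Binary.Permutation.Propositional as ↭ using (_↭_; ↭⇒↭ₛ)
open import Data.List.Relation.Binary.Permutation.Propositional.Properties using (↭-length)
import Data.List.Relation.Binary.Permutation.Setoid.Properties as ↭ₛ
open import Data.Nat.Base as ℕ using (ℕ; zero; suc; pred; _≤_; _<_; z≤n; s≤s)
open import Data.Nat.Induction using (<-wellFounded)
open import Data.Nat.ListAction using (sum)
import Data.Nat.Properties as ℕ
open import Data.Nat.Solver using (module +-*-Solver)
open import Algebra.Properties.CommutativeSemigroup ℕ.+-commutativeSemigroup using (x∙yz≈y∙xz)
open import Data.Product.Base as Product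
  using (Σ-syntax; ∃-syntax; _×_; _,_; proj₁; proj₂; swap)
open import Data.Sum.Base as Sum using (_⊎_; inj₁; inj₂; [_,_]′)
open import Data.Vec.Base as Vec using ([]; _∷_; here; there; _[_]≔_)
import Data.Vec.Properties as Vec
open import Data.Vec.Functional as Vector using (updateAt)
open import Data.Vec.Functional.Properties using (updateAt-updates; updateAt-minimal; lookup-++ʳ)
open import Function.Base using (_∘_; id; const)
open import Function.Bundles using (_⇔_; mk⇔; Equivalence)
open import Induction.WellFounded using (Acc; acc)
open import Level using (Level; _⊔_; lift)
open import Relation.Binary.Construct.Closure.Transitive using (TransClosure; [_]; _∷_)
open import Relation.Binary.PropositionalEquality as ≡ using (_≡_; _≢_)
open import Relation.Nullary using (Dec; does; yes; no; ¬_)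
open import Relation.Nullary.Decidable using (map′; _×-dec_; _→-dec_; ¬?)
open import Relation.Unary using (Pred; Decidable)

-- The exchange identity concerns the tensors of two legs only. Evaluations are therefore treated as
-- networks with arbitrary matrices on the edges, so that tensors belonging to no tag can stand on
-- these legs while the original diagram is compared with the grafted ones. The scalars match for
-- two separate reasons: A and B together contain the same elements as the two new tags, which
-- settles the products of the yᵢ in the numerators, and the coefficient by which Nʰ moves one
-- vector of the flag to an earlier one is the quotient of the two yᵢ by which the denominators
-- change. Equality in the ground field is not assumed decidable, so no argument may choose pivots.
-- Instead, a step of a flag is known to be nonzero because its remaining vectors complete it to the
-- volume form; a vector killed by a step is put into its span by a contraction; and the
-- coefficients of N are inverted by completing the reflected flags to the volume form.

-- Finite sums and products in a commutative ring.

module Sums {c ℓ} (R : CommutativeRing c ℓ) where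
  open CommutativeRing R public hiding (zero)
  open import Algebra.Properties.Ring ring public using (-‿distribˡ-*; -‿distribʳ-*; -‿+-comm; -‿involutive; -0#≈0#; -1*x≈-x)
  open import Algebra.Properties.CommutativeSemigroup +-commutativeSemigroup public
    using () renaming (interchange to +-interchange; x∙yz≈y∙xz to x+yz≈y+xz)
  open import Algebra.Properties.CommutativeSemigroup *-commutativeSemigroup public
    using () renaming (interchange to *-interchange; x∙yz≈y∙xz to x*yz≈y*xz)
  open import Relation.Binary.Reasoning.Setoid setoid public

  private variable
    a b p : Level
    A : Set a
    B : Set b

  ∑ ∏ : List A → (A → Carrier) → Carrier
  ∑ xs f = foldr (λ x s → f x + s) 0# xs
  ∏ xs f = foldr (λ x s → f x * s) 1# xs

  ∑-cong-∈ : (xs : List A) {f g : A → Carrier} → (∀ x → x ∈ xs → f x ≈ g x) → ∑ xs f ≈ ∑ xs g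
  ∑-cong-∈ []       eq = refl
  ∑-cong-∈ (x ∷ xs) eq = +-cong (eq x (here ≡.refl)) (∑-cong-∈ xs (λ y y∈ → eq y (there y∈)))

  ∑-cong : (xs : List A) {f g : A → Carrier} → (∀ x → f x ≈ g x) → ∑ xs f ≈ ∑ xs g
  ∑-cong xs eq = ∑-cong-∈ xs (λ x _ → eq x)

  ∏-cong : (xs : List A) {f g : A → Carrier} → (∀ x → f x ≈ g x) → ∏ xs f ≈ ∏ xs g
  ∏-cong []       eq = refl
  ∏-cong (x ∷ xs) eq = *-cong (eq x) (∏-cong xs eq)

  ∑-zero : (xs : List A) → ∑ xs (λ _ → 0#) ≈ 0#
  ∑-zero []       = refl
  ∑-zero (x ∷ xs) = trans (+-identityˡ _) (∑-zero xs)

  ∑-0 : (xs : List A) {f : A → Carrier} → (∀ x → f x ≈ 0#) → ∑ xs f ≈ 0#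
  ∑-0 xs eq = trans (∑-cong xs eq) (∑-zero xs)

  ∑-+ : (xs : List A) (f g : A → Carrier) → ∑ xs (λ x → f x + g x) ≈ ∑ xs f + ∑ xs g
  ∑-+ []       f g = sym (+-identityˡ 0#)
  ∑-+ (x ∷ xs) f g = trans (+-congˡ (∑-+ xs f g)) (+-interchange _ _ _ _)

  ∑-*ˡ : (xs : List A) (s : Carrier) (f : A → Carrier) → s * ∑ xs f ≈ ∑ xs (λ x → s * f x)
  ∑-*ˡ []       s f = zeroʳ s
  ∑-*ˡ (x ∷ xs) s f = trans (distribˡ s _ _) (+-congˡ (∑-*ˡ xs s f))

  ∑-*ʳ : (xs : List A) (s : Carrier) (f : A → Carrier) → ∑ xs f * s ≈ ∑ xs (λ x → f x * s)
  ∑-*ʳ []       s f = zeroˡ s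
  ∑-*ʳ (x ∷ xs) s f = trans (distribʳ s _ _) (+-congˡ (∑-*ʳ xs s f))

  ∑-swap : (xs : List A) (ys : List B) (f : A → B → Carrier) →
           ∑ xs (λ x → ∑ ys (f x)) ≈ ∑ ys (λ y → ∑ xs (λ x → f x y))
  ∑-swap []       ys f = sym (∑-zero ys)
  ∑-swap (x ∷ xs) ys f = trans (+-congˡ (∑-swap xs ys f)) (sym (∑-+ ys _ _))

  ∑-++ : (xs ys : List A) (f : A → Carrier) → ∑ (xs ++ ys) f ≈ ∑ xs f + ∑ ys f
  ∑-++ []       ys f = sym (+-identityˡ _)
  ∑-++ (x ∷ xs) ys f = trans (+-congˡ (∑-++ xs ys f)) (sym (+-assoc _ _ _))

  ∑-map : (g : A → B) (xs : List A) (f : B → Carrier) → ∑ (map g xs) f ≈ ∑ xs (f ∘ g)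
  ∑-map g []       f = refl
  ∑-map g (x ∷ xs) f = +-congˡ (∑-map g xs f)

  ∏-map : (g : A → B) (xs : List A) (f : B → Carrier) → ∏ (map g xs) f ≈ ∏ xs (f ∘ g)
  ∏-map g []       f = refl
  ∏-map g (x ∷ xs) f = *-congˡ (∏-map g xs f)

  ∑-product : ∀ {c} {C : Set c} (_∙_ : A → B → C) (xs : List A) (ys : List B) (f : C → Carrier) →
              ∑ (cartesianProductWith _∙_ xs ys) f ≈ ∑ xs (λ x → ∑ ys (λ y → f (x ∙ y)))
  ∑-product _∙_ []       ys f = refl
  ∑-product _∙_ (x ∷ xs) ys f =
    trans (∑-++ (map (x ∙_) ys) _ f) (+-cong (∑-map (x ∙_) ys f) (∑-product _∙_ xs ys f))

  ∑-filter : {P : Pred A p} (P? : Decidable P) (xs : List A) (f : A → Carrier) →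
             ∑ (filter P? xs) f ≈ ∑ xs (λ x → if does (P? x) then f x else 0#)
  ∑-filter P? []       f = refl
  ∑-filter P? (x ∷ xs) f with does (P? x)
  ... | true  = +-congˡ (∑-filter P? xs f)
  ... | false = trans (∑-filter P? xs f) (sym (+-identityˡ _))

  ∑-support : {P : Pred A p} (P? : Decidable P) (xs : List A) {f : A → Carrier} →
              (∀ x → ¬ P x → f x ≈ 0#) → ∑ (filter P? xs) f ≈ ∑ xs f
  ∑-support P? xs {f} supp = trans (∑-filter P? xs f) (∑-cong xs at)
    where
    at : ∀ x → (if does (P? x) then f x else 0#) ≈ f x
    at x with P? x
    ... | yes _ = refl
    ... | no ¬p = sym (supp x ¬p)

  ∑-suc : ∀ n (f : Fin (suc n) → Carrier) → ∑ (allFin (suc n)) f ≈ f zero + ∑ (allFin n) (f ∘ suc)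
  ∑-suc n f = +-congˡ (trans (reflexive (≡.cong (λ l → ∑ l f) (≡.sym (map-tabulate {n = n} id suc))))
                             (∑-map suc (allFin n) f))

  ∏-suc : ∀ n (f : Fin (suc n) → Carrier) → ∏ (allFin (suc n)) f ≈ f zero * ∏ (allFin n) (f ∘ suc)
  ∏-suc n f = *-congˡ (trans (reflexive (≡.cong (λ l → ∏ l f) (≡.sym (map-tabulate {n = n} id suc))))
                             (∏-map suc (allFin n) f))

  ∑-allSubsets : ∀ n (f : Subset (suc n) → Carrier) →
                 ∑ (allSubsets (suc n)) f ≈
                 ∑ (allSubsets n) (f ∘ (inside ∷_)) + ∑ (allSubsets n) (f ∘ (outside ∷_))
  ∑-allSubsets n f = trans (∑-++ (map (inside ∷_) (allSubsets n)) _ f)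
    (+-cong (∑-map (inside ∷_) (allSubsets n) f) (∑-map (outside ∷_) (allSubsets n) f))

-- Exterior algebra: product, contraction and induced homomorphisms.

-- The exterior algebra of R ⁿ, split along the first coordinate: an element
-- x is e₀ ∧ inn x + out x, with inn x and out x in the exterior algebra of R ⁿ⁻¹.

module SubsetAlgebra {c ℓ} (R : CommutativeRing c ℓ) where
  open Sums R

  Λ : ℕ → Set c
  Λ n = Subset n → Carrier

  private variable
    m n : ℕ

  infix 4 _≋_
  _≋_ : Λ n → Λ n → Set ℓ
  x ≋ y = ∀ S → x S ≈ y S

  ≡⇒≋ : {x y : Λ n} → x ≡ y → x ≋ y
  ≡⇒≋ eq S = reflexive (≡.cong (λ x → x S) eq)

  inn out : Λ (suc n) → Λ n
  inn x S = x (inside ∷ S)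
  out x S = x (outside ∷ S)

  infixl 6 _⊕_
  infixr 8 _⊙_
  _⊕_ : Λ n → Λ n → Λ n
  (x ⊕ y) S = x S + y S

  ⊖_ : Λ n → Λ n
  (⊖ x) S = - x S

  _⊙_ : Carrier → Λ n → Λ n
  (s ⊙ x) S = s * x S

  𝟎 unit : Λ n
  𝟎 _ = 0#
  unit []             = 1#
  unit (inside ∷ S)  = 0#
  unit (outside ∷ S) = unit S

  -- The grading automorphism, (-1)ᵃ in degree a: the sign that arises when a vector passes a
  -- tensor.
  γ : Λ n → Λ n
  γ x []            = x []
  γ x (inside ∷ S)  = - γ (inn x) S
  γ x (outside ∷ S) = γ (out x) S

  infixr 7 _∙_
  -- The exterior product. In the coefficient of e₀ this vector comes from x, or from y after
  -- passing out x, which costs a `γ`; the product of the two inner parts is missing as e₀ ∧ e₀ = 0.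
  _∙_ : Λ n → Λ n → Λ n
  (x ∙ y) []            = x [] * y []
  (x ∙ y) (inside ∷ S)  = (inn x ∙ out y) S + (γ (out x) ∙ inn y) S
  (x ∙ y) (outside ∷ S) = (out x ∙ out y) S

  vec : (Fin n → Carrier) → Λ n
  vec v []            = 0#
  vec v (inside ∷ S)  = v zero * unit S
  vec v (outside ∷ S) = vec (v ∘ suc) S

  γ-cong : {x y : Λ n} → x ≋ y → γ x ≋ γ y
  γ-cong eq []            = eq []
  γ-cong eq (inside ∷ S)  = -‿cong (γ-cong (λ A → eq (inside ∷ A)) S)
  γ-cong eq (outside ∷ S) = γ-cong (λ A → eq (outside ∷ A)) S

  γ-⊕ : (x y : Λ n) → γ (x ⊕ y) ≋ γ x ⊕ γ y
  γ-⊕ x y []            = refl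
  γ-⊕ x y (inside ∷ S)  = trans (-‿cong (γ-⊕ (inn x) (inn y) S)) (sym (-‿+-comm _ _))
  γ-⊕ x y (outside ∷ S) = γ-⊕ (out x) (out y) S

  γ-⊙ : (s : Carrier) (x : Λ n) → γ (s ⊙ x) ≋ s ⊙ γ x
  γ-⊙ s x []            = refl
  γ-⊙ s x (inside ∷ S)  = trans (-‿cong (γ-⊙ s (inn x) S)) (-‿distribʳ-* _ _)
  γ-⊙ s x (outside ∷ S) = γ-⊙ s (out x) S

  γ-⊖ : (x : Λ n) → γ (⊖ x) ≋ ⊖ γ x
  γ-⊖ x []            = refl
  γ-⊖ x (inside ∷ S)  = -‿cong (γ-⊖ (inn x) S)
  γ-⊖ x (outside ∷ S) = γ-⊖ (out x) S

  γ-𝟎 : γ (𝟎 {n}) ≋ 𝟎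
  γ-𝟎 []            = refl
  γ-𝟎 (inside ∷ S)  = trans (-‿cong (γ-𝟎 S)) -0#≈0#
  γ-𝟎 (outside ∷ S) = γ-𝟎 S

  γ-involutive : (x : Λ n) → γ (γ x) ≋ x
  γ-involutive x []            = refl
  γ-involutive x (inside ∷ S)  =
    trans (-‿cong (γ-⊖ (γ (inn x)) S)) (trans (-‿involutive _) (γ-involutive (inn x) S))
  γ-involutive x (outside ∷ S) = γ-involutive (out x) S

  γ-unit : γ (unit {n}) ≋ unit
  γ-unit []            = refl
  γ-unit (inside ∷ S)  = trans (-‿cong (γ-𝟎 S)) -0#≈0#
  γ-unit (outside ∷ S) = γ-unit S

  γ-vec : (v : Fin n → Carrier) → γ (vec v) ≋ ⊖ vec v
  γ-vec v []            = sym -0#≈0#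
  γ-vec v (inside ∷ S)  = -‿cong (trans (γ-⊙ (v zero) unit S) (*-congˡ (γ-unit S)))
  γ-vec v (outside ∷ S) = γ-vec (v ∘ suc) S

  ∙-cong : {x x′ y y′ : Λ n} → x ≋ x′ → y ≋ y′ → x ∙ y ≋ x′ ∙ y′
  ∙-cong p q []            = *-cong (p []) (q [])
  ∙-cong p q (inside ∷ S)  =
    +-cong (∙-cong (λ A → p (inside ∷ A)) (λ A → q (outside ∷ A)) S)
           (∙-cong (γ-cong (λ A → p (outside ∷ A))) (λ A → q (inside ∷ A)) S)
  ∙-cong p q (outside ∷ S) = ∙-cong (λ A → p (outside ∷ A)) (λ A → q (outside ∷ A)) S

  ∙-congˡ : {x y y′ : Λ n} → y ≋ y′ → x ∙ y ≋ x ∙ y′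
  ∙-congˡ = ∙-cong (λ _ → refl)

  ∙-congʳ : {x x′ y : Λ n} → x ≋ x′ → x ∙ y ≋ x′ ∙ y
  ∙-congʳ p = ∙-cong p (λ _ → refl)

  ∙-⊕ˡ : (x x′ y : Λ n) → (x ⊕ x′) ∙ y ≋ x ∙ y ⊕ x′ ∙ y
  ∙-⊕ˡ x x′ y []            = distribʳ _ _ _
  ∙-⊕ˡ x x′ y (inside ∷ S)  = trans
    (+-cong (∙-⊕ˡ (inn x) (inn x′) (out y) S)
            (trans (∙-congʳ (γ-⊕ (out x) (out x′)) S) (∙-⊕ˡ (γ (out x)) (γ (out x′)) (inn y) S)))
    (+-interchange _ _ _ _)
  ∙-⊕ˡ x x′ y (outside ∷ S) = ∙-⊕ˡ (out x) (out x′) (out y) S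

  ∙-⊕ʳ : (x y y′ : Λ n) → x ∙ (y ⊕ y′) ≋ x ∙ y ⊕ x ∙ y′
  ∙-⊕ʳ x y y′ []            = distribˡ _ _ _
  ∙-⊕ʳ x y y′ (inside ∷ S)  = trans
    (+-cong (∙-⊕ʳ (inn x) (out y) (out y′) S) (∙-⊕ʳ (γ (out x)) (inn y) (inn y′) S))
    (+-interchange _ _ _ _)
  ∙-⊕ʳ x y y′ (outside ∷ S) = ∙-⊕ʳ (out x) (out y) (out y′) S

  ∙-⊙ˡ : (s : Carrier) (x y : Λ n) → (s ⊙ x) ∙ y ≋ s ⊙ (x ∙ y)
  ∙-⊙ˡ s x y []            = *-assoc _ _ _
  ∙-⊙ˡ s x y (inside ∷ S)  = trans
    (+-cong (∙-⊙ˡ s (inn x) (out y) S)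
            (trans (∙-congʳ (γ-⊙ s (out x)) S) (∙-⊙ˡ s (γ (out x)) (inn y) S)))
    (sym (distribˡ _ _ _))
  ∙-⊙ˡ s x y (outside ∷ S) = ∙-⊙ˡ s (out x) (out y) S

  ∙-⊙ʳ : (s : Carrier) (x y : Λ n) → x ∙ (s ⊙ y) ≋ s ⊙ (x ∙ y)
  ∙-⊙ʳ s x y []            = x*yz≈y*xz _ _ _
  ∙-⊙ʳ s x y (inside ∷ S)  = trans
    (+-cong (∙-⊙ʳ s (inn x) (out y) S) (∙-⊙ʳ s (γ (out x)) (inn y) S))
    (sym (distribˡ _ _ _))
  ∙-⊙ʳ s x y (outside ∷ S) = ∙-⊙ʳ s (out x) (out y) S

  -1⊙ : (x : Λ n) → ⊖ x ≋ (- 1#) ⊙ x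
  -1⊙ x S = sym (-1*x≈-x _)

  ∙-⊖ˡ : (x y : Λ n) → (⊖ x) ∙ y ≋ ⊖ (x ∙ y)
  ∙-⊖ˡ x y S = trans (∙-congʳ (-1⊙ x) S) (trans (∙-⊙ˡ (- 1#) x y S) (sym (-1⊙ (x ∙ y) S)))

  ∙-⊖ʳ : (x y : Λ n) → x ∙ (⊖ y) ≋ ⊖ (x ∙ y)
  ∙-⊖ʳ x y S = trans (∙-congˡ (-1⊙ y) S) (trans (∙-⊙ʳ (- 1#) x y S) (sym (-1⊙ (x ∙ y) S)))

  ∙-𝟎ˡ : (y : Λ n) → 𝟎 ∙ y ≋ 𝟎
  ∙-𝟎ˡ y S = trans (∙-congʳ (λ A → sym (zeroˡ (y A))) S) (trans (∙-⊙ˡ 0# y y S) (zeroˡ _))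

  ∙-𝟎ʳ : (x : Λ n) → x ∙ 𝟎 ≋ 𝟎
  ∙-𝟎ʳ x S = trans (∙-congˡ (λ A → sym (zeroˡ (x A))) S) (trans (∙-⊙ʳ 0# x x S) (zeroˡ _))

  ∙-∑ˡ : ∀ {a} {A : Set a} (xs : List A) (f : A → Λ n) (y : Λ n) →
         (λ S → ∑ xs (λ i → f i S)) ∙ y ≋ (λ S → ∑ xs (λ i → (f i ∙ y) S))
  ∙-∑ˡ []       f y = ∙-𝟎ˡ y
  ∙-∑ˡ (x ∷ xs) f y S = trans (∙-⊕ˡ (f x) _ y S) (+-congˡ (∙-∑ˡ xs f y S))

  ∙-∑ʳ : ∀ {a} {A : Set a} (xs : List A) (x : Λ n) (f : A → Λ n) →
         x ∙ (λ S → ∑ xs (λ i → f i S)) ≋ (λ S → ∑ xs (λ i → (x ∙ f i) S))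
  ∙-∑ʳ []       y f = ∙-𝟎ʳ y
  ∙-∑ʳ (x ∷ xs) y f S = trans (∙-⊕ʳ y (f x) _ S) (+-congˡ (∙-∑ʳ xs y f S))

  γ-∙ : (x y : Λ n) → γ (x ∙ y) ≋ γ x ∙ γ y
  γ-∙ x y []            = refl
  γ-∙ x y (inside ∷ S)  = begin
    - γ (inn x ∙ out y ⊕ γ (out x) ∙ inn y) S                   ≈⟨ -‿cong (γ-⊕ _ _ S) ⟩
    - (γ (inn x ∙ out y) S + γ (γ (out x) ∙ inn y) S)           ≈⟨ -‿+-comm _ _ ⟨
    - γ (inn x ∙ out y) S + - γ (γ (out x) ∙ inn y) S
      ≈⟨ +-cong (trans (-‿cong (γ-∙ (inn x) (out y) S)) (sym (∙-⊖ˡ _ _ S)))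
                (trans (-‿cong (γ-∙ (γ (out x)) (inn y) S)) (sym (∙-⊖ʳ _ _ S))) ⟩
    (γ x ∙ γ y) (inside ∷ S)                                    ∎
  γ-∙ x y (outside ∷ S) = γ-∙ (out x) (out y) S

  ∙-assoc : (x y z : Λ n) → (x ∙ y) ∙ z ≋ x ∙ (y ∙ z)
  ∙-assoc x y z []            = *-assoc _ _ _
  ∙-assoc x y z (inside ∷ S)  = begin
    ((inn x ∙ out y ⊕ γ (out x) ∙ inn y) ∙ out z) S + (γ (out x ∙ out y) ∙ inn z) S
      ≈⟨ +-cong (∙-⊕ˡ _ _ (out z) S) (∙-congʳ (γ-∙ (out x) (out y)) S) ⟩
    (((inn x ∙ out y) ∙ out z) S + ((γ (out x) ∙ inn y) ∙ out z) S) + ((γ (out x) ∙ γ (out y)) ∙ inn z) S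
      ≈⟨ +-cong (+-cong (∙-assoc _ _ _ S) (∙-assoc _ _ _ S)) (∙-assoc _ _ _ S) ⟩
    ((inn x ∙ (out y ∙ out z)) S + (γ (out x) ∙ (inn y ∙ out z)) S) + (γ (out x) ∙ (γ (out y) ∙ inn z)) S
      ≈⟨ +-assoc _ _ _ ⟩
    (inn x ∙ (out y ∙ out z)) S + ((γ (out x) ∙ (inn y ∙ out z)) S + (γ (out x) ∙ (γ (out y) ∙ inn z)) S)
      ≈⟨ +-congˡ (∙-⊕ʳ (γ (out x)) _ _ S) ⟨
    (x ∙ (y ∙ z)) (inside ∷ S) ∎
  ∙-assoc x y z (outside ∷ S) = ∙-assoc (out x) (out y) (out z) S

  ∙-unitˡ : (y : Λ n) → unit ∙ y ≋ y
  ∙-unitˡ y []            = *-identityˡ _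
  ∙-unitˡ y (inside ∷ S)  = trans
    (+-cong (∙-𝟎ˡ (out y) S) (trans (∙-congʳ γ-unit S) (∙-unitˡ (inn y) S))) (+-identityˡ _)
  ∙-unitˡ y (outside ∷ S) = ∙-unitˡ (out y) S

  ∙-unitʳ : (x : Λ n) → x ∙ unit ≋ x
  ∙-unitʳ x []            = *-identityʳ _
  ∙-unitʳ x (inside ∷ S)  =
    trans (+-cong (∙-unitʳ (inn x) S) (∙-𝟎ʳ (γ (out x)) S)) (+-identityʳ _)
  ∙-unitʳ x (outside ∷ S) = ∙-unitʳ (out x) S

  ∙-scalarˡ : (s : Carrier) (y : Λ n) → (s ⊙ unit) ∙ y ≋ s ⊙ y
  ∙-scalarˡ s y S = trans (∙-⊙ˡ s unit y S) (*-congˡ (∙-unitˡ y S))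

  ∙-scalarʳ : (s : Carrier) (x : Λ n) → x ∙ (s ⊙ unit) ≋ s ⊙ x
  ∙-scalarʳ s x S = trans (∙-⊙ʳ s x unit S) (*-congˡ (∙-unitʳ x S))

  -- Graded commutativity with a vector. Writing the sign as `γ` spares a hypothesis on the degree
  -- of x.
  vec-comm : (x : Λ n) (w : Fin n → Carrier) → x ∙ vec w ≋ vec w ∙ γ x
  vec-comm x w []            = trans (zeroʳ _) (sym (zeroˡ _))
  vec-comm x w (inside ∷ S)  = begin
    (inn x ∙ vec w′) S + (γ (out x) ∙ (w zero ⊙ unit)) S
      ≈⟨ +-cong (vec-comm (inn x) w′ S) (∙-scalarʳ (w zero) (γ (out x)) S) ⟩
    (vec w′ ∙ γ (inn x)) S + w zero * γ (out x) S
      ≈⟨ +-comm _ _ ⟩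
    w zero * γ (out x) S + (vec w′ ∙ γ (inn x)) S
      ≈⟨ +-cong (sym (∙-scalarˡ (w zero) (γ (out x)) S)) (trans (sym (-‿involutive _)) (-‿cong (sym (∙-⊖ʳ _ _ S)))) ⟩
    ((w zero ⊙ unit) ∙ γ (out x)) S + - (vec w′ ∙ (⊖ γ (inn x))) S
      ≈⟨ +-congˡ (trans (sym (∙-⊖ˡ _ _ S)) (∙-congʳ (λ A → sym (γ-vec w′ A)) S)) ⟩
    (vec w ∙ γ x) (inside ∷ S) ∎
    where w′ = w ∘ suc
  vec-comm x w (outside ∷ S) = vec-comm (out x) (w ∘ suc) S

  vec-square : (v : Fin n → Carrier) → vec v ∙ vec v ≋ 𝟎
  vec-square v []            = zeroˡ _
  vec-square v (inside ∷ S)  = begin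
    ((v zero ⊙ unit) ∙ vec v′) S + (γ (vec v′) ∙ (v zero ⊙ unit)) S
      ≈⟨ +-cong (∙-scalarˡ _ _ S) (trans (∙-scalarʳ _ _ S) (*-congˡ (γ-vec v′ S))) ⟩
    v zero * vec v′ S + v zero * - vec v′ S     ≈⟨ distribˡ _ _ _ ⟨
    v zero * (vec v′ S + - vec v′ S)            ≈⟨ trans (*-congˡ (-‿inverseʳ _)) (zeroʳ _) ⟩
    0#                                          ∎
    where v′ = v ∘ suc
  vec-square v (outside ∷ S) = vec-square (v ∘ suc) S

  vec-cong : {v w : Fin n → Carrier} → (∀ i → v i ≈ w i) → vec v ≋ vec w
  vec-cong eq []            = refl
  vec-cong eq (inside ∷ S)  = *-congʳ (eq zero)
  vec-cong eq (outside ∷ S) = vec-cong (eq ∘ suc) S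

  vec-+ : (v w : Fin n → Carrier) → vec (λ i → v i + w i) ≋ vec v ⊕ vec w
  vec-+ v w []            = sym (+-identityˡ _)
  vec-+ v w (inside ∷ S)  = distribʳ _ _ _
  vec-+ v w (outside ∷ S) = vec-+ (v ∘ suc) (w ∘ suc) S

  vec-* : (s : Carrier) (v : Fin n → Carrier) → vec (λ i → s * v i) ≋ s ⊙ vec v
  vec-* s v []            = sym (zeroʳ _)
  vec-* s v (inside ∷ S)  = *-assoc _ _ _
  vec-* s v (outside ∷ S) = vec-* s (v ∘ suc) S

  vec-0 : vec {n} (λ _ → 0#) ≋ 𝟎
  vec-0 []            = refl
  vec-0 (inside ∷ S)  = zeroˡ _
  vec-0 (outside ∷ S) = vec-0 S

  vec-∑ : ∀ {a} {A : Set a} (xs : List A) (f : A → Fin n → Carrier) →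
          vec (λ j → ∑ xs (λ i → f i j)) ≋ (λ S → ∑ xs (λ i → vec (f i) S))
  vec-∑ []       f   = vec-0
  vec-∑ (x ∷ xs) f S = trans (vec-+ (f x) _ S) (+-congˡ (vec-∑ xs f S))

  -- Contraction with a covector from the right, an antiderivation.

  D : (Fin n → Carrier) → Λ n → Λ n
  D α x []            = 0#
  D α x (inside ∷ S)  = D (α ∘ suc) (inn x) S
  D α x (outside ∷ S) = α zero * γ (inn x) S + D (α ∘ suc) (out x) S

  D-cong : {α β : Fin n → Carrier} {x y : Λ n} → (∀ i → α i ≈ β i) → x ≋ y → D α x ≋ D β y
  D-cong p q []            = refl
  D-cong p q (inside ∷ S)  = D-cong (p ∘ suc) (λ A → q (inside ∷ A)) S
  D-cong p q (outside ∷ S) =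
    +-cong (*-cong (p zero) (γ-cong (λ A → q (inside ∷ A)) S)) (D-cong (p ∘ suc) (λ A → q (outside ∷ A)) S)

  D-⊕ : (α : Fin n → Carrier) (x y : Λ n) → D α (x ⊕ y) ≋ D α x ⊕ D α y
  D-⊕ α x y []            = sym (+-identityˡ _)
  D-⊕ α x y (inside ∷ S)  = D-⊕ (α ∘ suc) (inn x) (inn y) S
  D-⊕ α x y (outside ∷ S) = trans
    (+-cong (trans (*-congˡ (γ-⊕ (inn x) (inn y) S)) (distribˡ _ _ _)) (D-⊕ (α ∘ suc) (out x) (out y) S))
    (+-interchange _ _ _ _)

  D-⊙ : (α : Fin n → Carrier) (s : Carrier) (x : Λ n) → D α (s ⊙ x) ≋ s ⊙ D α x
  D-⊙ α s x []            = sym (zeroʳ _)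
  D-⊙ α s x (inside ∷ S)  = D-⊙ (α ∘ suc) s (inn x) S
  D-⊙ α s x (outside ∷ S) = trans
    (+-cong (trans (*-congˡ (γ-⊙ s (inn x) S)) (x*yz≈y*xz _ _ _)) (D-⊙ (α ∘ suc) s (out x) S))
    (sym (distribˡ _ _ _))

  D-⊖ : (α : Fin n → Carrier) (x : Λ n) → D α (⊖ x) ≋ ⊖ D α x
  D-⊖ α x S = trans (D-cong (λ _ → refl) (-1⊙ x) S) (trans (D-⊙ α (- 1#) x S) (sym (-1⊙ (D α x) S)))

  D-𝟎 : (α : Fin n → Carrier) → D α 𝟎 ≋ 𝟎
  D-𝟎 α S = trans (D-cong (λ _ → refl) (λ A → sym (zeroˡ 0#)) S) (trans (D-⊙ α 0# 𝟎 S) (zeroˡ _))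

  D-unit : (α : Fin n → Carrier) → D α unit ≋ 𝟎
  D-unit α []            = refl
  D-unit α (inside ∷ S)  = D-𝟎 (α ∘ suc) S
  D-unit α (outside ∷ S) = trans
    (+-cong (trans (*-congˡ (γ-𝟎 S)) (zeroʳ _)) (D-unit (α ∘ suc) S)) (+-identityˡ _)

  D-γ : (α : Fin n → Carrier) (x : Λ n) → D α (γ x) ≋ ⊖ γ (D α x)
  D-γ α x []            = sym -0#≈0#
  D-γ α x (inside ∷ S)  = trans (D-⊖ (α ∘ suc) (γ (inn x)) S) (-‿cong (D-γ (α ∘ suc) (inn x) S))
  D-γ α x (outside ∷ S) = begin
    α zero * γ (⊖ γ (inn x)) S + D (α ∘ suc) (γ (out x)) S
      ≈⟨ +-cong (trans (*-congˡ (γ-⊖ (γ (inn x)) S)) (sym (-‿distribʳ-* _ _))) (D-γ (α ∘ suc) (out x) S) ⟩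
    - (α zero * γ (γ (inn x)) S) + - γ (D (α ∘ suc) (out x)) S
      ≈⟨ -‿+-comm _ _ ⟩
    - (α zero * γ (γ (inn x)) S + γ (D (α ∘ suc) (out x)) S)
      ≈⟨ -‿cong (trans (γ-⊕ _ _ S) (+-congʳ (γ-⊙ _ _ S))) ⟨
    - γ (out (D α x)) S ∎

  D-∙ : (α : Fin n → Carrier) (x y : Λ n) → D α (x ∙ y) ≋ x ∙ D α y ⊕ D α x ∙ γ y
  D-∙ α x y []            = sym (trans (+-cong (zeroʳ _) (zeroˡ _)) (+-identityˡ _))
  D-∙ α x y (inside ∷ S)  = begin
    D α′ (x₁ ∙ y₀ ⊕ γ x₀ ∙ y₁) S
      ≈⟨ trans (D-⊕ α′ _ _ S) (+-cong (D-∙ α′ x₁ y₀ S) (D-∙ α′ (γ x₀) y₁ S)) ⟩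
    (a + b) + (c′ + (D α′ (γ x₀) ∙ γ y₁) S)
      ≈⟨ +-congˡ (+-congˡ (trans (∙-congʳ (D-γ α′ x₀) S) (trans (∙-⊖ˡ _ _ S) (sym (∙-⊖ʳ _ _ S))))) ⟩
    (a + b) + (c′ + d)                                     ≈⟨ +-congˡ (+-identityˡ _) ⟨
    (a + b) + (0# + (c′ + d))                              ≈⟨ +-congˡ (+-congʳ cancel) ⟨
    (a + b) + ((e + f) + (c′ + d))                         ≈⟨ rearrange a b c′ d e f ⟩
    ((e + a) + c′) + (b + (f + d))
      ≈⟨ +-cong (+-congʳ (∙-⊕ʳ x₁ _ _ S)) (+-congˡ (trans (∙-congʳ (γ-⊕ _ _) S) (∙-⊕ˡ _ _ _ S))) ⟨
    (x ∙ D α y ⊕ D α x ∙ γ y) (inside ∷ S)                 ∎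
    where
    α′ = α ∘ suc
    x₁ = inn x
    x₀ = out x
    y₁ = inn y
    y₀ = out y
    a = (x₁ ∙ D α′ y₀) S
    b = (D α′ x₁ ∙ γ y₀) S
    c′ = (γ x₀ ∙ D α′ y₁) S
    d = (γ (D α′ x₀) ∙ (⊖ γ y₁)) S
    e = (x₁ ∙ (α zero ⊙ γ y₁)) S
    f = (γ (α zero ⊙ γ x₁) ∙ (⊖ γ y₁)) S
    -- These terms contract e₀ when both factors contain it. They have to cancel, since there x ∙ y
    -- has no part with e₀ ∧ e₀.
    cancel : e + f ≈ 0#
    cancel = trans (+-cong (∙-⊙ʳ _ _ _ S) (trans (∙-⊖ʳ _ _ S) (-‿cong
      (trans (∙-congʳ (λ A → trans (γ-⊙ _ _ A) (*-congˡ (γ-involutive x₁ A))) S) (∙-⊙ˡ _ _ _ S)))))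
      (-‿inverseʳ _)
    open import Algebra.Solver.CommutativeMonoid +-commutativeMonoid using (solve; _⊜_) renaming (_⊕_ to _⊞_)
    rearrange : ∀ a b c d e f → (a + b) + ((e + f) + (c + d)) ≈ ((e + a) + c) + (b + (f + d))
    rearrange = solve 6 (λ a b c d e f →
      (a ⊞ b) ⊞ ((e ⊞ f) ⊞ (c ⊞ d)) ⊜ ((e ⊞ a) ⊞ c) ⊞ (b ⊞ (f ⊞ d))) refl
  D-∙ α x y (outside ∷ S) = begin
    α zero * γ (x₁ ∙ y₀ ⊕ γ x₀ ∙ y₁) S + D α′ (x₀ ∙ y₀) S
      ≈⟨ +-cong (trans (*-congˡ (trans (γ-⊕ _ _ S) (+-cong (γ-∙ _ _ S)
           (trans (γ-∙ _ _ S) (∙-congʳ (γ-involutive x₀) S))))) (distribˡ _ _ _)) (D-∙ α′ x₀ y₀ S) ⟩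
    (α zero * (γ x₁ ∙ γ y₀) S + α zero * (x₀ ∙ γ y₁) S) + (a + b)
      ≈⟨ rearrange _ _ a b ⟩
    (α zero * (x₀ ∙ γ y₁) S + a) + (α zero * (γ x₁ ∙ γ y₀) S + b)
      ≈⟨ +-cong (trans (∙-⊕ʳ x₀ _ _ S) (+-congʳ (∙-⊙ʳ _ _ _ S)))
                (trans (∙-⊕ˡ _ _ _ S) (+-congʳ (∙-⊙ˡ _ _ _ S))) ⟨
    (x ∙ D α y ⊕ D α x ∙ γ y) (outside ∷ S) ∎
    where
    α′ = α ∘ suc
    x₁ = inn x
    x₀ = out x
    y₁ = inn y
    y₀ = out y
    a = (x₀ ∙ D α′ y₀) S
    b = (D α′ x₀ ∙ γ y₀) S
    open import Algebra.Solver.CommutativeMonoid +-commutativeMonoid using (solve; _⊜_) renaming (_⊕_ to _⊞_)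
    rearrange : ∀ p q a b → (p + q) + (a + b) ≈ (q + a) + (p + b)
    rearrange = solve 4 (λ p q a b → (p ⊞ q) ⊞ (a ⊞ b) ⊜ (q ⊞ a) ⊞ (p ⊞ b)) refl

  ⟨_,_⟩ : (Fin n → Carrier) → (Fin n → Carrier) → Carrier
  ⟨ α , v ⟩ = ∑ (allFin _) (λ i → α i * v i)

  D-vec : (α v : Fin n → Carrier) → D α (vec v) ≋ ⟨ α , v ⟩ ⊙ unit
  D-vec α v []            = sym (zeroˡ _)
  D-vec {suc n} α v (inside ∷ S)  = trans (D-⊙ (α ∘ suc) (v zero) unit S)
    (trans (*-congˡ (D-unit (α ∘ suc) S)) (trans (zeroʳ _) (sym (zeroʳ _))))
  D-vec {suc n} α v (outside ∷ S) = begin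
    α zero * γ (v zero ⊙ unit) S + D (α ∘ suc) (vec (v ∘ suc)) S
      ≈⟨ +-cong (trans (*-congˡ (trans (γ-⊙ _ _ S) (*-congˡ (γ-unit S)))) (sym (*-assoc _ _ _)))
                (D-vec (α ∘ suc) (v ∘ suc) S) ⟩
    α zero * v zero * unit S + ⟨ α ∘ suc , v ∘ suc ⟩ * unit S
      ≈⟨ distribʳ _ _ _ ⟨
    (α zero * v zero + ⟨ α ∘ suc , v ∘ suc ⟩) * unit S
      ≈⟨ *-congʳ (∑-suc n (λ i → α i * v i)) ⟨
    ⟨ α , v ⟩ * unit S ∎

  -- The recursion for contractions along a flag: α meets the last vector or goes on to the earlier
  -- ones, with a sign.
  D-∙-vec : (α v : Fin n → Carrier) (x : Λ n) →
            D α (x ∙ vec v) ≋ ⟨ α , v ⟩ ⊙ x ⊕ (⊖ (D α x ∙ vec v))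
  D-∙-vec α v x S = trans (D-∙ α x (vec v) S) (+-cong
    (trans (∙-congˡ (D-vec α v) S) (∙-scalarʳ _ _ S))
    (trans (∙-congˡ (γ-vec v) S) (∙-⊖ʳ _ _ S)))

  -- The homomorphism of exterior algebras sending eⱼ to h j.

  Φ : (Fin m → Fin n → Carrier) → Λ m → Λ n
  Φ {zero}  h x = x [] ⊙ unit
  Φ {suc m} h x = vec (h zero) ∙ Φ (h ∘ suc) (inn x) ⊕ Φ (h ∘ suc) (out x)

  Φ-cong : {h h′ : Fin m → Fin n → Carrier} {x y : Λ m} →
           (∀ i j → h i j ≈ h′ i j) → x ≋ y → Φ h x ≋ Φ h′ y
  Φ-cong {zero}  p q S = *-congʳ (q [])
  Φ-cong {suc m} p q S = +-cong
    (∙-cong (vec-cong (p zero)) (Φ-cong (p ∘ suc) (λ A → q (inside ∷ A))) S)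
    (Φ-cong (p ∘ suc) (λ A → q (outside ∷ A)) S)

  Φ-⊕ : (h : Fin m → Fin n → Carrier) (x y : Λ m) → Φ h (x ⊕ y) ≋ Φ h x ⊕ Φ h y
  Φ-⊕ {zero}  h x y S = distribʳ _ _ _
  Φ-⊕ {suc m} h x y S = trans
    (+-cong (trans (∙-congˡ (Φ-⊕ (h ∘ suc) (inn x) (inn y)) S) (∙-⊕ʳ _ _ _ S))
            (Φ-⊕ (h ∘ suc) (out x) (out y) S))
    (+-interchange _ _ _ _)

  Φ-⊙ : (h : Fin m → Fin n → Carrier) (s : Carrier) (x : Λ m) → Φ h (s ⊙ x) ≋ s ⊙ Φ h x
  Φ-⊙ {zero}  h s x S = *-assoc _ _ _
  Φ-⊙ {suc m} h s x S = trans
    (+-cong (trans (∙-congˡ (Φ-⊙ (h ∘ suc) s (inn x)) S) (∙-⊙ʳ _ _ _ S)) (Φ-⊙ (h ∘ suc) s (out x) S))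
    (sym (distribˡ _ _ _))

  Φ-⊖ : (h : Fin m → Fin n → Carrier) (x : Λ m) → Φ h (⊖ x) ≋ ⊖ Φ h x
  Φ-⊖ h x S = trans (Φ-cong {h = h} (λ _ _ → refl) (-1⊙ x) S) (trans (Φ-⊙ h (- 1#) x S) (sym (-1⊙ (Φ h x) S)))

  Φ-𝟎 : (h : Fin m → Fin n → Carrier) → Φ h 𝟎 ≋ 𝟎
  Φ-𝟎 h S = trans (Φ-cong {h = h} (λ _ _ → refl) (λ A → sym (zeroˡ 0#)) S) (trans (Φ-⊙ h 0# 𝟎 S) (zeroˡ _))

  Φ-unit : (h : Fin m → Fin n → Carrier) → Φ h unit ≋ unit
  Φ-unit {zero}  h S = *-identityˡ _
  Φ-unit {suc m} h S = trans
    (+-cong (trans (∙-congˡ (Φ-𝟎 (h ∘ suc)) S) (∙-𝟎ʳ _ S)) (Φ-unit (h ∘ suc) S)) (+-identityˡ _)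

  Φ-γ : (h : Fin m → Fin n → Carrier) (x : Λ m) → Φ h (γ x) ≋ γ (Φ h x)
  Φ-γ {zero}  h x S = sym (trans (γ-⊙ _ _ S) (*-congˡ (γ-unit S)))
  Φ-γ {suc m} h x S = begin
    (vec (h zero) ∙ Φ h′ (⊖ γ (inn x))) S + Φ h′ (γ (out x)) S
      ≈⟨ +-cong (∙-congˡ (λ A → trans (Φ-⊖ h′ _ A) (-‿cong (Φ-γ h′ (inn x) A))) S) (Φ-γ h′ (out x) S) ⟩
    (vec (h zero) ∙ (⊖ γ (Φ h′ (inn x)))) S + γ (Φ h′ (out x)) S
      ≈⟨ +-congʳ (trans (∙-⊖ʳ _ _ S) (sym (∙-⊖ˡ _ _ S))) ⟩
    ((⊖ vec (h zero)) ∙ γ (Φ h′ (inn x))) S + γ (Φ h′ (out x)) S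
      ≈⟨ +-congʳ (trans (γ-∙ _ _ S) (∙-congʳ (γ-vec _) S)) ⟨
    γ (vec (h zero) ∙ Φ h′ (inn x)) S + γ (Φ h′ (out x)) S
      ≈⟨ γ-⊕ _ _ S ⟨
    γ (Φ h x) S ∎
    where h′ = h ∘ suc

  Φ-vec : (h : Fin m → Fin n → Carrier) (v : Fin m → Carrier) →
          Φ h (vec v) ≋ vec (λ i → ∑ (allFin m) (λ j → v j * h j i))
  Φ-vec {zero}  h v S = trans (zeroˡ _) (sym (vec-0 S))
  Φ-vec {suc m} h v S = begin
    (vec (h zero) ∙ Φ h′ (v zero ⊙ unit)) S + Φ h′ (vec (v ∘ suc)) S
      ≈⟨ +-cong (∙-congˡ (λ A → trans (Φ-⊙ h′ _ _ A) (*-congˡ (Φ-unit h′ A))) S) (Φ-vec h′ (v ∘ suc) S) ⟩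
    (vec (h zero) ∙ (v zero ⊙ unit)) S + vec w S
      ≈⟨ +-congʳ (trans (∙-scalarʳ _ _ S) (sym (vec-* _ _ S))) ⟩
    vec (λ i → v zero * h zero i) S + vec w S
      ≈⟨ vec-+ _ _ S ⟨
    vec (λ i → v zero * h zero i + w i) S
      ≈⟨ vec-cong (λ i → ∑-suc m (λ j → v j * h j i)) S ⟨
    vec (λ i → ∑ (allFin (suc m)) (λ j → v j * h j i)) S ∎
    where
    h′ = h ∘ suc
    w : Fin _ → Carrier
    w i = ∑ (allFin m) (λ j → v (suc j) * h′ j i)

  -- The image w of e₀ can be moved past a tensor at the cost of a `γ`, just as e₀ itself, and the
  -- only additional term on the right contains w twice and vanishes.
  Φ-∙ : (h : Fin m → Fin n → Carrier) (x y : Λ m) → Φ h (x ∙ y) ≋ Φ h x ∙ Φ h y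
  Φ-∙ {zero}  h x y S = sym (trans (∙-scalarˡ _ _ S) (sym (*-assoc _ _ _)))
  Φ-∙ {suc m} h x y S = begin
    (w ∙ Φ h′ (x₁ ∙ y₀ ⊕ γ x₀ ∙ y₁)) S + Φ h′ (x₀ ∙ y₀) S
      ≈⟨ +-cong (trans (∙-congˡ (λ A → trans (Φ-⊕ h′ _ _ A) (+-cong (Φ-∙ h′ x₁ y₀ A) (Φ-∙ h′ (γ x₀) y₁ A))) S)
                       (∙-⊕ʳ w _ _ S)) (Φ-∙ h′ x₀ y₀ S) ⟩
    ((w ∙ (X₁ ∙ Y₀)) S + (w ∙ (Φ h′ (γ x₀) ∙ Y₁)) S) + (X₀ ∙ Y₀) S
      ≈⟨ +-congʳ (+-cong (sym (∙-assoc _ _ _ S)) (trans (sym (∙-assoc _ _ _ S)) (trans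
           (∙-congʳ (λ A → trans (∙-congˡ (Φ-γ h′ x₀) A) (sym (vec-comm X₀ (h zero) A))) S) (∙-assoc _ _ _ S)))) ⟩
    (((w ∙ X₁) ∙ Y₀) S + (X₀ ∙ (w ∙ Y₁)) S) + (X₀ ∙ Y₀) S
      ≈⟨ trans (+-congʳ (trans (+-congʳ square) (+-identityˡ _))) (sym (+-assoc _ _ _)) ⟨
    (((w ∙ X₁) ∙ (w ∙ Y₁)) S + ((w ∙ X₁) ∙ Y₀) S) + ((X₀ ∙ (w ∙ Y₁)) S + (X₀ ∙ Y₀) S)
      ≈⟨ +-cong (∙-⊕ʳ (w ∙ X₁) _ _ S) (∙-⊕ʳ X₀ _ _ S) ⟨
    ((w ∙ X₁) ∙ (w ∙ Y₁ ⊕ Y₀)) S + (X₀ ∙ (w ∙ Y₁ ⊕ Y₀)) S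
      ≈⟨ ∙-⊕ˡ _ _ _ S ⟨
    (Φ h x ∙ Φ h y) S ∎
    where
    h′ = h ∘ suc
    w = vec (h zero)
    x₁ = inn x
    x₀ = out x
    y₁ = inn y
    y₀ = out y
    X₁ = Φ h′ x₁
    X₀ = Φ h′ x₀
    Y₁ = Φ h′ y₁
    Y₀ = Φ h′ y₀
    square : ((w ∙ X₁) ∙ (w ∙ Y₁)) S ≈ 0#
    square = begin
      ((w ∙ X₁) ∙ (w ∙ Y₁)) S       ≈⟨ ∙-assoc _ _ _ S ⟨
      (((w ∙ X₁) ∙ w) ∙ Y₁) S       ≈⟨ ∙-congʳ (λ A → trans (∙-assoc _ _ _ A) (∙-congˡ (vec-comm X₁ (h zero)) A)) S ⟩
      ((w ∙ (w ∙ γ X₁)) ∙ Y₁) S     ≈⟨ ∙-congʳ (λ A → trans (sym (∙-assoc _ _ _ A))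
                                        (trans (∙-congʳ (vec-square (h zero)) A) (∙-𝟎ˡ _ A))) S ⟩
      (𝟎 ∙ Y₁) S                    ≈⟨ ∙-𝟎ˡ _ S ⟩
      0#                            ∎

  -- Naturality of the contraction: the covector is pulled back along h. This is what allows a leg
  -- to fork before or after being transported.
  D-Φ : (h : Fin m → Fin n → Carrier) (α : Fin n → Carrier) (x : Λ m) →
        D α (Φ h x) ≋ Φ h (D (λ j → ⟨ α , h j ⟩) x)
  D-Φ {zero}  h α x S = trans (D-⊙ α _ unit S) (trans (*-congˡ (D-unit α S)) (trans (zeroʳ _) (sym (zeroˡ _))))
  D-Φ {suc m} h α x S = begin
    D α (w ∙ X₁ ⊕ X₀) S
      ≈⟨ trans (D-⊕ α _ _ S) (+-congʳ (D-∙ α w X₁ S)) ⟩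
    ((w ∙ D α X₁) S + (D α w ∙ γ X₁) S) + D α X₀ S
      ≈⟨ +-cong (+-cong (∙-congˡ (D-Φ h′ α (inn x)) S) (trans (∙-congʳ (D-vec α (h zero)) S)
           (trans (∙-scalarˡ _ _ S) (*-congˡ (sym (Φ-γ h′ (inn x) S)))))) (D-Φ h′ α (out x) S) ⟩
    ((w ∙ Φ h′ (D β (inn x))) S + s * Φ h′ (γ (inn x)) S) + Φ h′ (D β (out x)) S
      ≈⟨ +-assoc _ _ _ ⟩
    (w ∙ Φ h′ (D β (inn x))) S + (s * Φ h′ (γ (inn x)) S + Φ h′ (D β (out x)) S)
      ≈⟨ +-congˡ (trans (Φ-⊕ h′ _ _ S) (+-congʳ (Φ-⊙ h′ _ _ S))) ⟨
    Φ h (D (λ j → ⟨ α , h j ⟩) x) S ∎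
    where
    h′ = h ∘ suc
    w = vec (h zero)
    X₁ = Φ h′ (inn x)
    X₀ = Φ h′ (out x)
    s = ⟨ α , h zero ⟩
    β : Fin m → Carrier
    β j = ⟨ α , h′ j ⟩

  -- A predicate on degrees instead of a number, because removing the first coordinate turns P into
  -- `P ∘ suc`, also where no degree is left.
  SupportedOn : (ℕ → Set) → Λ n → Set ℓ
  SupportedOn P x = ∀ S → ¬ P ∣ S ∣ → x S ≈ 0#

  γ-support : {P : ℕ → Set} {x : Λ n} → SupportedOn P x → SupportedOn P (γ x)
  γ-support {x = x} p []            ¬P = p [] ¬P
  γ-support {P = P} {x} p (inside ∷ S)  ¬P =
    trans (-‿cong (γ-support {P = P ∘ suc} {inn x} (λ A → p (inside ∷ A)) S ¬P)) -0#≈0#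
  γ-support {P = P} {x} p (outside ∷ S) ¬P = γ-support {P = P} {out x} (λ A → p (outside ∷ A)) S ¬P

  ∙-support : {P Q R : ℕ → Set} {x y : Λ n} → (∀ i → Dec (P i)) → (∀ i j → P i → Q j → R (i ℕ.+ j)) →
              SupportedOn P x → SupportedOn Q y → SupportedOn R (x ∙ y)
  ∙-support {zero} P? PQR p q [] ¬R with P? 0
  ... | yes P0 = trans (*-congˡ (q [] (λ Q0 → ¬R (PQR 0 0 P0 Q0)))) (zeroʳ _)
  ... | no ¬P0 = trans (*-congʳ (p [] ¬P0)) (zeroˡ _)
  ∙-support {suc n} {P} {Q} {R} {x} {y} P? PQR p q (inside ∷ S)  ¬R = trans (+-cong
    (∙-support {P = P ∘ suc} {Q} {R ∘ suc} {inn x} {out y} (P? ∘ suc) (λ i j → PQR (suc i) j)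
      (λ A → p (inside ∷ A)) (λ A → q (outside ∷ A)) S ¬R)
    (∙-support {P = P} {Q ∘ suc} {R ∘ suc} {γ (out x)} {inn y} P?
      (λ i j a b → ≡.subst R (ℕ.+-suc i j) (PQR i (suc j) a b))
      (γ-support {P = P} (λ A → p (outside ∷ A))) (λ A → q (inside ∷ A)) S ¬R)) (+-identityˡ _)
  ∙-support {suc n} {P} {Q} {R} {x} {y} P? PQR p q (outside ∷ S) ¬R =
    ∙-support {P = P} {Q} {R} {out x} {out y} P? PQR (λ A → p (outside ∷ A)) (λ A → q (outside ∷ A)) S ¬R

  unit-support : SupportedOn (_≡ 0) (unit {n})
  unit-support []            ¬0 = ⊥-elim (¬0 ≡.refl)
  unit-support (inside ∷ S)  ¬0 = refl
  unit-support (outside ∷ S) ¬0 = unit-support S ¬0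

  vec-support : (v : Fin n → Carrier) → SupportedOn (_≡ 1) (vec v)
  vec-support v []            ¬1 = refl
  vec-support v (inside ∷ S)  ¬1 = trans (*-congˡ (unit-support S (λ eq → ¬1 (≡.cong suc eq)))) (zeroʳ _)
  vec-support v (outside ∷ S) ¬1 = vec-support (v ∘ suc) S ¬1

  Φ-support : {P : ℕ → Set} (h : Fin m → Fin n → Carrier) {x : Λ m} →
              SupportedOn P x → SupportedOn P (Φ h x)
  Φ-support {zero}  {P = P} h {x} p S ¬P with ∣ S ∣ ℕ.≟ 0
  ... | yes eq = trans (*-congʳ (p [] (λ P0 → ¬P (≡.subst P (≡.sym eq) P0)))) (zeroˡ _)
  ... | no neq = trans (*-congˡ (unit-support S neq)) (zeroʳ _)
  Φ-support {suc m} {P = P} h {x} p S ¬P = trans (+-cong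
    (∙-support {P = _≡ 1} {P ∘ suc} {P} {vec (h zero)} {Φ (h ∘ suc) (inn x)} (ℕ._≟ 1) (λ { .1 j ≡.refl Pj → Pj })
      (vec-support (h zero)) (Φ-support {P = P ∘ suc} (h ∘ suc) (λ A → p (inside ∷ A))) S ¬P)
    (Φ-support {P = P} (h ∘ suc) (λ A → p (outside ∷ A)) S ¬P)) (+-identityˡ _)

  D-support : {P Q : ℕ → Set} (α : Fin n → Carrier) {x : Λ n} → (∀ j → P (suc j) → Q j) →
              SupportedOn P x → SupportedOn Q (D α x)
  D-support α PQ p []            ¬Q = refl
  D-support {P = P} {Q} α {x} PQ p (inside ∷ S)  ¬Q =
    D-support {P = P ∘ suc} {Q ∘ suc} (α ∘ suc) {inn x} (λ j → PQ (suc j)) (λ A → p (inside ∷ A)) S ¬Q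
  D-support {P = P} {Q} α {x} PQ p (outside ∷ S) ¬Q = trans (+-cong
    (trans (*-congˡ (γ-support {P = P ∘ suc} {inn x} (λ A → p (inside ∷ A)) S (λ Ps → ¬Q (PQ _ Ps)))) (zeroʳ _))
    (D-support {P = P} {Q} (α ∘ suc) {out x} PQ (λ A → p (outside ∷ A)) S ¬Q)) (+-identityˡ _)

-- The coordinate formulas of the definitions as operations of the exterior algebra.

module Coordinates {c ℓ₁ ℓ₂} (𝕂 : HeytingField c ℓ₁ ℓ₂) (k : ℕ) where
  module E = Exterior 𝕂 k
  ring : CommutativeRing c ℓ₁
  ring = HeytingCommutativeRing.commutativeRing (HeytingField.heytingCommutativeRing 𝕂)
  open Sums ring hiding (ring)
  open SubsetAlgebra ring

  private variable
    m n : ℕ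

  γ-sign : (x : Λ n) (S : Subset n) → γ x S ≈ E.sign ∣ S ∣ * x S
  γ-sign x []            = sym (*-identityˡ _)
  γ-sign x (inside ∷ S)  = trans (-‿cong (γ-sign (inn x) S)) (-‿distribˡ-* _ _)
  γ-sign x (outside ∷ S) = γ-sign (out x) S

  -- Induction on the first coordinate. If it belongs to the second factor, it has to pass e_A; the
  -- sign of `shuffleSign` for this is the `γ` in the product.
  shuffle-∙ : (x y : Λ n) (S : Subset n) →
              ∑ (filter (Subset._⊆? S) (allSubsets n)) (λ A → E.shuffleSign A (S ─ A) * (x A * y (S ─ A)))
              ≈ (x ∙ y) S
  shuffle-∙ x y S = trans (∑-filter (Subset._⊆? S) (allSubsets _) _) (go x y S)
    where
    term : (x y : Λ n) (S A : Subset n) → Carrier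
    term x y S A = if does (A Subset.⊆? S) then E.shuffleSign A (S ─ A) * (x A * y (S ─ A)) else 0#
    pull : (x y : Λ n) (S A : Subset n) →
           (if does (A Subset.⊆? S) then E.sign ∣ A ∣ * E.shuffleSign A (S ─ A) * (x A * y (S ─ A)) else 0#)
           ≈ term (γ x) y S A
    pull x y S A with does (A Subset.⊆? S)
    ... | false = refl
    ... | true  = begin
      s * t * (p * q)    ≈⟨ trans (*-congʳ (*-comm s t)) (*-assoc t s _) ⟩
      t * (s * (p * q))  ≈⟨ *-congˡ (sym (*-assoc s p q)) ⟩
      t * ((s * p) * q)  ≈⟨ *-congˡ (*-congʳ (γ-sign x A)) ⟨
      t * (γ x A * q)    ∎
      where
      s = E.sign ∣ A ∣
      t = E.shuffleSign A (S ─ A)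
      p = x A
      q = y (S ─ A)
    go : ∀ {n} (x y : Λ n) (S : Subset n) → ∑ (allSubsets n) (term x y S) ≈ (x ∙ y) S
    go x y [] = trans (+-identityʳ _) (*-identityˡ _)
    go {suc n} x y (inside ∷ S) = trans (∑-allSubsets n (term x y (inside ∷ S)))
      (+-cong (go (inn x) (out y) S)
              (trans (∑-cong (allSubsets n) (pull (out x) (inn y) S)) (go (γ (out x)) (inn y) S)))
    go {suc n} x y (outside ∷ S) = trans (∑-allSubsets n (term x y (outside ∷ S)))
      (trans (+-cong (∑-zero (allSubsets n)) (go (out x) (out y) S)) (+-identityˡ _))

  ∧-∙ : (x y : Λ k) → x E.∧ y ≋ x ∙ y
  ∧-∙ x y S = shuffle-∙ x y S

  indicator : Subset n → Λ n
  indicator R S = if does (Vec.≡-dec Bool._≟_ R S) then 1# else 0#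

  indicator-⊥ : indicator (⊥ {n}) ≋ unit
  indicator-⊥ []            = refl
  indicator-⊥ (inside ∷ S)  = refl
  indicator-⊥ (outside ∷ S) = indicator-⊥ S

  indicator-⊥⊥ : ∀ n → indicator (⊥ {n}) ⊥ ≈ 1#
  indicator-⊥⊥ zero    = refl
  indicator-⊥⊥ (suc n) = indicator-⊥⊥ n

  ∑-indicator : (R : Subset n) (f : Λ n) → ∑ (allSubsets n) (λ T → indicator R T * f T) ≈ f R
  ∑-indicator []            f = trans (+-identityʳ _) (*-identityˡ _)
  ∑-indicator {suc n} (inside ∷ R)  f = trans (∑-allSubsets n _)
    (trans (+-cong (∑-indicator R (inn f)) (∑-0 (allSubsets n) (λ T → zeroˡ _))) (+-identityʳ _))
  ∑-indicator {suc n} (outside ∷ R) f = trans (∑-allSubsets n _)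
    (trans (+-cong (∑-0 (allSubsets n) (λ T → zeroˡ _)) (∑-indicator R (out f))) (+-identityˡ _))

  indicator-sym : (R S : Subset n) → indicator R S ≈ indicator S R
  indicator-sym []            []            = refl
  indicator-sym (inside ∷ R)  (inside ∷ S)  = indicator-sym R S
  indicator-sym (inside ∷ R)  (outside ∷ S) = refl
  indicator-sym (outside ∷ R) (inside ∷ S)  = refl
  indicator-sym (outside ∷ R) (outside ∷ S) = indicator-sym R S

  ι-vec : (v : Fin k → Carrier) → E.ι v ≋ vec v
  ι-vec v = go v
    where
    go : ∀ {n} (v : Fin n → Carrier) S → ∑ (allFin n) (λ i → v i * indicator ⁅ i ⁆ S) ≈ vec v S
    go {zero}  v []            = refl
    go {suc n} v (inside ∷ S)  = trans (∑-suc n (λ i → v i * indicator ⁅ i ⁆ (inside ∷ S)))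
      (trans (+-cong (*-congˡ (indicator-⊥ S)) (∑-0 (allFin n) (λ i → zeroʳ _))) (+-identityʳ _))
    go {suc n} v (outside ∷ S) = trans (∑-suc n (λ i → v i * indicator ⁅ i ⁆ (outside ∷ S)))
      (trans (+-cong (zeroʳ _) (go (v ∘ suc) S)) (+-identityˡ _))

  -- Kronecker's delta, written with `indicator` so that it unfolds along the coordinates. `δ j`
  -- serves both as a basis vector and as the dual covector.
  δ : Fin n → Fin n → Carrier
  δ i j = indicator ⁅ i ⁆ ⁅ j ⁆

  ∑-δ : (i : Fin n) (f : Fin n → Carrier) → ∑ (allFin n) (λ j → δ i j * f j) ≈ f i
  ∑-δ {suc n} zero    f = trans (∑-suc n (λ j → δ zero j * f j))
    (trans (+-cong (trans (*-congʳ (indicator-⊥⊥ n)) (*-identityˡ _))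
                   (∑-0 (allFin n) (λ j → zeroˡ _))) (+-identityʳ _))
  ∑-δ {suc n} (suc i) f = trans (∑-suc n (λ j → δ (suc i) j * f j))
    (trans (+-cong (zeroˡ _) (∑-δ i (f ∘ suc))) (+-identityˡ _))

  singleton : (J : Subset n) → ∣ J ∣ ≡ 1 → ∃[ i ] J ≡ ⁅ i ⁆
  singleton (inside ∷ J)  eq = zero , ≡.cong (inside ∷_) (empty J (ℕ.suc-injective eq))
    where
    empty : ∀ {n} (J : Subset n) → ∣ J ∣ ≡ 0 → J ≡ ⊥
    empty []            eq = ≡.refl
    empty (outside ∷ J) eq = ≡.cong (outside ∷_) (empty J eq)
  singleton (outside ∷ J) eq with i , J≡ ← singleton J eq = suc i , ≡.cong (outside ∷_) J≡

  indicator-vec : (J : Subset n) → ∣ J ∣ ≡ 1 → indicator J ≋ vec (λ i → indicator ⁅ i ⁆ J)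
  indicator-vec J eq with i , ≡.refl ← singleton J eq = λ S → trans (go i S) (vec-cong (λ j → indicator-sym ⁅ i ⁆ ⁅ j ⁆) S)
    where
    go : ∀ {n} (i : Fin n) → indicator ⁅ i ⁆ ≋ vec (δ i)
    go {suc n} zero (inside ∷ S) = trans (indicator-⊥ S) (sym (trans (*-congʳ (indicator-⊥⊥ n)) (*-identityˡ _)))
    go zero    (outside ∷ S) = sym (trans (vec-cong {w = λ _ → 0#} (λ _ → refl) S) (vec-0 S))
    go (suc i) (inside ∷ S)  = sym (zeroˡ _)
    go (suc i) (outside ∷ S) = go i S

  γ-adjoint : (z : Λ n) (R : Subset n) → ∑ (allSubsets n) (λ T → z T * γ (indicator R) T) ≈ γ z R
  γ-adjoint {n} z R = begin
    ∑ (allSubsets n) (λ T → z T * γ (indicator R) T)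
      ≈⟨ ∑-cong (allSubsets n) (λ T → trans (*-congˡ (γ-sign (indicator R) T))
           (trans (sym (*-assoc _ _ _)) (trans (*-comm _ _) (*-congˡ (trans (*-comm _ _) (sym (γ-sign z T))))))) ⟩
    ∑ (allSubsets n) (λ T → indicator R T * γ z T)
      ≈⟨ ∑-indicator R (γ z) ⟩
    γ z R ∎

  -- Under the pairing of coordinates, contraction is adjoint to multiplication by `vec α` from the
  -- right. The entry of a black vertex is a product of basis tensors, so this turns forking into
  -- contraction.
  D-adjoint : (α : Fin n → Carrier) (z : Λ n) (R : Subset n) →
              ∑ (allSubsets n) (λ T → z T * (indicator R ∙ vec α) T) ≈ D α z R
  D-adjoint α z [] = trans (+-identityʳ _) (trans (*-congˡ (zeroʳ _)) (zeroʳ _))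
  D-adjoint {suc n} α z (inside ∷ R) = trans (∑-allSubsets n _) (trans (+-cong
    (trans (∑-cong (allSubsets n) (λ T → *-congˡ (trans (+-congˡ
      (trans (∙-congʳ γ-𝟎 T) (∙-𝟎ˡ _ T))) (+-identityʳ _)))) (D-adjoint (α ∘ suc) (inn z) R))
    (∑-0 (allSubsets n) (λ T → trans (*-congˡ (∙-𝟎ˡ _ T)) (zeroʳ _)))) (+-identityʳ _))
  D-adjoint {suc n} α z (outside ∷ R) = trans (∑-allSubsets n _) (+-cong
    (begin
      ∑ (allSubsets n) (λ T → inn z T * ((𝟎 ∙ vec (α ∘ suc)) T + (γ (indicator R) ∙ (α zero ⊙ unit)) T))
        ≈⟨ ∑-cong (allSubsets n) (λ T → trans (*-congˡ (trans (+-cong (∙-𝟎ˡ _ T) (∙-scalarʳ _ _ T))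
             (+-identityˡ _))) (x*yz≈y*xz _ _ _)) ⟩
      ∑ (allSubsets n) (λ T → α zero * (inn z T * γ (indicator R) T))
        ≈⟨ ∑-*ˡ (allSubsets n) _ _ ⟨
      α zero * ∑ (allSubsets n) (λ T → inn z T * γ (indicator R) T)
        ≈⟨ *-congˡ (γ-adjoint (inn z) R) ⟩
      α zero * γ (inn z) R ∎)
    (D-adjoint (α ∘ suc) (out z) R))

  -- Linearity in α is seen on the other side of the adjunction, where α is a factor of a product.
  D-expand : (α : Fin n → Carrier) (z : Λ n) (R : Subset n) →
             D α z R ≈ ∑ (allFin n) (λ i → α i * D (δ i) z R)
  D-expand {n} α z R = begin
    D α z R                     ≈⟨ D-adjoint α z R ⟨
    ∑ (allSubsets n) (λ T → z T * (indicator R ∙ vec α) T)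
      ≈⟨ ∑-cong (allSubsets n) (λ T → trans (*-congˡ (α-expand T)) (trans (∑-*ˡ (allFin n) _ _)
           (∑-cong (allFin n) (λ i → x*yz≈y*xz _ _ _)))) ⟩
    ∑ (allSubsets n) (λ T → ∑ (allFin n) (λ i → α i * (z T * (indicator R ∙ vec (δ i)) T)))
      ≈⟨ ∑-swap (allSubsets n) (allFin n) _ ⟩
    ∑ (allFin n) (λ i → ∑ (allSubsets n) (λ T → α i * (z T * (indicator R ∙ vec (δ i)) T)))
      ≈⟨ ∑-cong (allFin n) (λ i → trans (sym (∑-*ˡ (allSubsets n) _ _)) (*-congˡ (D-adjoint (δ i) z R))) ⟩
    ∑ (allFin n) (λ i → α i * D (δ i) z R) ∎
    where
    α-expand : ∀ T → (indicator R ∙ vec α) T ≈ ∑ (allFin n) (λ i → α i * (indicator R ∙ vec (δ i)) T)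
    α-expand T = begin
      (indicator R ∙ vec α) T
        ≈⟨ ∙-congˡ (vec-cong (λ j → trans (sym (∑-δ j α)) (∑-cong (allFin n)
             (λ i → trans (*-comm _ _) (*-congˡ (indicator-sym ⁅ j ⁆ ⁅ i ⁆)))))) T ⟩
      (indicator R ∙ vec (λ j → ∑ (allFin n) (λ i → α i * δ i j))) T
        ≈⟨ ∙-congˡ (λ A → trans (vec-∑ (allFin n) (λ i j → α i * δ i j) A)
             (∑-cong (allFin n) (λ i → vec-* (α i) (δ i) A))) T ⟩
      (indicator R ∙ (λ A → ∑ (allFin n) (λ i → (α i ⊙ vec (δ i)) A))) T
        ≈⟨ ∙-∑ʳ (allFin n) _ _ T ⟩
      ∑ (allFin n) (λ i → (indicator R ∙ (α i ⊙ vec (δ i))) T)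
        ≈⟨ ∑-cong (allFin n) (λ i → ∙-⊙ʳ _ _ _ T) ⟩
      ∑ (allFin n) (λ i → α i * (indicator R ∙ vec (δ i)) T) ∎

  -- `columns` with n generators in place of k: the induction removes generators while the target
  -- space stays fixed.
  minors : (Fin n → Fin k → Carrier) → Subset n → Λ k
  minors {n} h R = E.⋀ (map (E.ι ∘ h) (filter (Subset._∈? R) (allFin n)))

  minors-suc : ∀ s (h : Fin (suc n) → Fin k → Carrier) (R : Subset n) →
               map (E.ι ∘ h) (filter (Subset._∈? (s ∷ R)) (tabulate suc)) ≡
               map (E.ι ∘ h ∘ suc) (filter (Subset._∈? R) (allFin n))
  minors-suc {n} s h R = ≡.trans
    (≡.cong (λ l → map (E.ι ∘ h) (filter (Subset._∈? (s ∷ R)) l)) (≡.sym (map-tabulate {n = n} id suc)))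
    (go (allFin n))
    where
    go : ∀ xs → map (E.ι ∘ h) (filter (Subset._∈? (s ∷ R)) (map suc xs)) ≡ map (E.ι ∘ h ∘ suc) (filter (Subset._∈? R) xs)
    go []       = ≡.refl
    go (x ∷ xs) with does (x Subset.∈? R)
    ... | true  = ≡.cong (_ ∷_) (go xs)
    ... | false = go xs

  ∑-minors : (h : Fin n → Fin k → Carrier) (x : Λ n) (S : Subset k) →
             ∑ (allSubsets n) (λ R → x R * minors h R S) ≈ Φ h x S
  ∑-minors {zero}  h x S = trans (+-identityʳ _) (*-congˡ (indicator-⊥ S))
  ∑-minors {suc n} h x S = trans (∑-allSubsets n _) (+-cong
    (begin
      ∑ (allSubsets n) (λ R → inn x R * minors h (inside ∷ R) S)
        ≈⟨ ∑-cong (allSubsets n) (λ R → *-congˡ (trans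
             (reflexive (≡.cong (λ l → (E.ι (h zero) E.∧ E.⋀ l) S) (minors-suc inside h R)))
             (trans (∧-∙ _ _ S) (∙-congʳ (ι-vec (h zero)) S)))) ⟩
      ∑ (allSubsets n) (λ R → inn x R * (vec (h zero) ∙ minors (h ∘ suc) R) S)
        ≈⟨ trans (∙-∑ʳ (allSubsets n) _ _ S) (∑-cong (allSubsets n) (λ R → ∙-⊙ʳ _ _ _ S)) ⟨
      (vec (h zero) ∙ (λ A → ∑ (allSubsets n) (λ R → inn x R * minors (h ∘ suc) R A))) S
        ≈⟨ ∙-congˡ (∑-minors (h ∘ suc) (inn x)) S ⟩
      (vec (h zero) ∙ Φ (h ∘ suc) (inn x)) S ∎)
    (trans (∑-cong (allSubsets n) (λ R → *-congˡ
        (reflexive (≡.cong (λ l → E.⋀ l S) (minors-suc outside h R)))))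
      (∑-minors (h ∘ suc) (out x) S)))

  _ᵀ : E.Matrix → E.Matrix
  (g ᵀ) i j = g j i

  $-Φ : (g : E.Matrix) (x : Λ k) → g E.$ x ≋ Φ (g ᵀ) x
  $-Φ g x S = ∑-minors (g ᵀ) x S

  columns-Φ : (g : E.Matrix) (R : Subset k) → E.columns g R ≋ Φ (g ᵀ) (indicator R)
  columns-Φ g R S = trans (sym (∑-indicator R (λ T → E.columns g T S))) ($-Φ g (indicator R) S)

-- Affine flags and the spans of their steps.

module Flags {c ℓ₁ ℓ₂} (𝕂 : HeytingField c ℓ₁ ℓ₂) (k : ℕ) where
  open Coordinates 𝕂 k public
  open Sums ring hiding (ring)
  open SubsetAlgebra ring
  open E using (V; Matrix; AffineFlag; step; _$ᵥ_)

  2+toℕ≤ : ∀ {n} (i : Fin (pred n)) → suc (suc (toℕ i)) ≤ n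
  2+toℕ≤ {suc n} i = s≤s (Fin.toℕ<n i)

  ξ-⊤ : E.ξ ⊤ ≈ 1#
  ξ-⊤ = go k
    where
    go : ∀ n → indicator (⊤ {n}) ⊤ ≈ 1#
    go zero    = refl
    go (suc n) = go n

  $ᵥ-cong : (g : Matrix) {v w : V} → (∀ j → v j ≈ w j) → ∀ i → (g $ᵥ v) i ≈ (g $ᵥ w) i
  $ᵥ-cong g eq i = ∑-cong (allFin k) (λ j → *-congˡ (eq j))

  $ᵥ-axpy : (g : Matrix) (s : Carrier) (v w : V) →
            ∀ i → (g $ᵥ (λ j → v j + s * w j)) i ≈ (g $ᵥ v) i + s * (g $ᵥ w) i
  $ᵥ-axpy g s v w i = trans
    (∑-cong (allFin k) (λ j → trans (distribˡ _ _ _) (+-congˡ (x*yz≈y*xz _ _ _))))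
    (trans (∑-+ (allFin k) _ _) (+-congˡ (sym (∑-*ˡ (allFin k) s _))))

  vec-axpy : (s : Carrier) (v w : V) → vec (λ j → v j + s * w j) ≋ vec v ⊕ s ⊙ vec w
  vec-axpy s v w S = trans (vec-+ v (λ j → s * w j) S) (+-congˡ (vec-* s w S))

  Φ-vec-$ᵥ : (g : Matrix) (v : V) → Φ (g ᵀ) (vec v) ≋ vec (g $ᵥ v)
  Φ-vec-$ᵥ g v S = trans (Φ-vec (g ᵀ) v S) (vec-cong (λ i → ∑-cong (allFin k) (λ j → *-comm _ _)) S)

  module Basis (F : AffineFlag) where
    -- Vectors that successively extend the flag, continued by 0 from index k on so that later
    -- formulas can use arbitrary indices.
    f : ℕ → V
    f i with i ℕ.<? k
    ... | yes i<k = proj₁ (E.extend F i i<k)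
    ... | no  _   = λ _ → 0#

    extends : ∀ i → i < k → step F i ∙ vec (f i) ≋ step F (suc i)
    extends i i<k with i ℕ.<? k
    ... | yes p = λ S → trans (sym (trans (∧-∙ _ _ S) (∙-congˡ (ι-vec _) S))) (proj₂ (E.extend F i p) S)
    ... | no ¬p with () ← ¬p i<k

    step-0 : step F 0 ≋ unit
    step-0 S = trans (E.step-0 F S) (indicator-⊥ S)

    tail : ℕ → ℕ → Λ k
    tail i zero    = unit
    tail i (suc d) = vec (f i) ∙ tail (suc i) d

    -- The remaining vectors complete a step to ξ. This is the form in which steps are known to be
    -- nonzero; it stands in for linear independence of the vectors `f i`.
    step-tail : ∀ i d → i ℕ.+ d ≡ k → (step F i ∙ tail i d) ⊤ ≈ 1#
    step-tail i zero    eq = trans (∙-unitʳ (step F i) ⊤)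
      (trans (reflexive (≡.cong (λ j → step F j ⊤) (≡.trans (≡.sym (ℕ.+-identityʳ i)) eq)))
             (trans (E.step-k F ⊤) ξ-⊤))
    step-tail i (suc d) eq = trans (sym (∙-assoc (step F i) _ _ ⊤))
      (trans (∙-congʳ (extends i (ℕ.≤-trans (ℕ.m≤m+n (suc i) d) (ℕ.≤-reflexive eq′))) ⊤)
             (step-tail (suc i) d eq′))
      where
      eq′ : suc i ℕ.+ d ≡ k
      eq′ = ≡.trans (≡.sym (ℕ.+-suc i d)) eq

    -- The span of the first l vectors, with coefficients as data. Peeling off the last vector first
    -- makes the leading coefficient accessible, which is the only one that survives a product with
    -- `step F l`.
    Span : ℕ → V → Set (c ⊔ ℓ₁)
    Span zero    v = Level.Lift c (∀ j → v j ≈ 0#)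
    Span (suc l) v = ∃[ w ] ∃[ s ] Span l w × (∀ j → v j ≈ w j + s * f l j)

    Span-cong : ∀ l {v w} → (∀ j → v j ≈ w j) → Span l v → Span l w
    Span-cong zero    eq (lift p)        = lift λ j → trans (sym (eq j)) (p j)
    Span-cong (suc l) eq (u , s , p , q) = u , s , p , λ j → trans (sym (eq j)) (q j)

    Span-axpy : ∀ l s {v w} → Span l v → Span l w → Span l (λ j → v j + s * w j)
    Span-axpy zero    s (lift p) (lift q) = lift λ j → trans (+-cong (p j) (trans (*-congˡ (q j)) (zeroʳ _))) (+-identityˡ _)
    Span-axpy (suc l) s {v} {w} (v′ , a , p , v≈) (w′ , b , q , w≈) =
      (λ j → v′ j + s * w′ j) , a + s * b , Span-axpy l s p q , λ j → begin
        v j + s * w j                                       ≈⟨ +-cong (v≈ j) (*-congˡ (w≈ j)) ⟩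
        (v′ j + a * f l j) + s * (w′ j + b * f l j)         ≈⟨ +-congˡ (trans (distribˡ _ _ _) (+-congˡ (sym (*-assoc _ _ _)))) ⟩
        (v′ j + a * f l j) + (s * w′ j + s * b * f l j)     ≈⟨ +-interchange _ _ _ _ ⟩
        (v′ j + s * w′ j) + (a * f l j + s * b * f l j)     ≈⟨ +-congˡ (distribʳ _ _ _) ⟨
        (v′ j + s * w′ j) + (a + s * b) * f l j             ∎

    Span-0 : ∀ l → Span l (λ _ → 0#)
    Span-0 zero    = lift λ _ → refl
    Span-0 (suc l) = (λ _ → 0#) , 0# , Span-0 l , λ j → sym (trans (+-identityˡ _) (zeroˡ _))

    Span-suc : ∀ l {v} → Span l v → Span (suc l) v
    Span-suc l {v} p = v , 0# , p , λ j → sym (trans (+-congˡ (zeroˡ _)) (+-identityʳ _))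

    Span-≤ : ∀ {l m} → l ℕ.≤′ m → ∀ {v} → Span l v → Span m v
    Span-≤ (ℕ.≤′-reflexive ≡.refl) p = p
    Span-≤ {m = suc m} (ℕ.≤′-step l≤m) p = Span-suc m (Span-≤ l≤m p)

    f∈Span : ∀ l → Span (suc l) (f l)
    f∈Span l = (λ _ → 0#) , 1# , Span-0 l , λ j → sym (trans (+-identityˡ _) (*-identityˡ _))

    step∙Span : ∀ l → l ≤ k → ∀ {v} → Span l v → step F l ∙ vec v ≋ 𝟎
    step∙Span zero    l≤k (lift p) S = trans (∙-congˡ (λ A → trans (vec-cong p A) (vec-0 A)) S) (∙-𝟎ʳ _ S)
    step∙Span (suc l) l<k {v} (w , s , p , v≈) S = begin
      (step F (suc l) ∙ vec v) S
        ≈⟨ ∙-cong (λ A → sym (extends l l<k A)) (λ A → trans (vec-cong v≈ A) (vec-axpy s w (f l) A)) S ⟩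
      ((step F l ∙ vec (f l)) ∙ (vec w ⊕ s ⊙ vec (f l))) S
        ≈⟨ trans (∙-assoc _ _ _ S) (∙-congˡ fw S) ⟩
      (step F l ∙ (⊖ (vec w ∙ vec (f l)))) S
        ≈⟨ trans (∙-⊖ʳ _ _ S) (-‿cong (sym (∙-assoc _ _ _ S))) ⟩
      - ((step F l ∙ vec w) ∙ vec (f l)) S
        ≈⟨ -‿cong (trans (∙-congʳ (step∙Span l (ℕ.<⇒≤ l<k) p) S) (∙-𝟎ˡ _ S)) ⟩
      - 0#  ≈⟨ -0#≈0# ⟩
      0#    ∎
      where
      fw : vec (f l) ∙ (vec w ⊕ s ⊙ vec (f l)) ≋ ⊖ (vec w ∙ vec (f l))
      fw A = trans (∙-⊕ʳ _ _ _ A) (trans (+-cong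
        (trans (vec-comm (vec (f l)) w A) (trans (∙-congˡ (γ-vec (f l)) A) (∙-⊖ʳ _ _ A)))
        (trans (∙-⊙ʳ _ _ _ A) (trans (*-congˡ (vec-square (f l) A)) (zeroʳ _)))) (+-identityʳ _))

    step∙leading : ∀ l → l < k → ∀ {v w s} → Span l w → (∀ j → v j ≈ w j + s * f l j) →
                   step F l ∙ vec v ≋ s ⊙ step F (suc l)
    step∙leading l l<k {v} {w} {s} p v≈ S = begin
      (step F l ∙ vec v) S
        ≈⟨ ∙-congˡ (λ A → trans (vec-cong v≈ A) (vec-axpy s w (f l) A)) S ⟩
      (step F l ∙ (vec w ⊕ s ⊙ vec (f l))) S
        ≈⟨ trans (∙-⊕ʳ _ _ _ S) (+-cong (step∙Span l (ℕ.<⇒≤ l<k) p S) (∙-⊙ʳ _ _ _ S)) ⟩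
      0# + s * (step F l ∙ vec (f l)) S
        ≈⟨ trans (+-identityˡ _) (*-congˡ (extends l l<k S)) ⟩
      s * step F (suc l) S ∎

    -- Contraction with `δ j` removes one vector of the step and leaves its j-th coordinate as a
    -- factor. As j varies, the result is therefore a combination of the vectors of the step.
    contraction∈Span : ∀ l → l ≤ k → (t : Λ k) (S : Subset k) → Span l (λ j → (D (δ j) (step F l) ∙ t) S)
    contraction∈Span zero    l≤k t S = lift λ j → trans (∙-congʳ (λ A → trans
      (D-cong (λ _ → refl) step-0 A) (D-unit (δ j) A)) S) (∙-𝟎ˡ t S)
    contraction∈Span (suc l) l<k t S =
      _ , (step F l ∙ t) S , Span-axpy l (- 1#) (Span-0 l) (contraction∈Span l (ℕ.<⇒≤ l<k) (vec (f l) ∙ t) S) , λ j → begin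
        (D (δ j) (step F (suc l)) ∙ t) S
          ≈⟨ ∙-congʳ (λ A → trans (D-cong (λ _ → refl) (λ B → sym (extends l l<k B)) A)
               (D-∙-vec (δ j) (f l) (step F l) A)) S ⟩
        ((⟨ δ j , f l ⟩ ⊙ step F l ⊕ (⊖ (D (δ j) (step F l) ∙ vec (f l)))) ∙ t) S
          ≈⟨ ∙-⊕ˡ _ _ t S ⟩
        ((⟨ δ j , f l ⟩ ⊙ step F l) ∙ t) S + ((⊖ (D (δ j) (step F l) ∙ vec (f l))) ∙ t) S
          ≈⟨ +-cong (trans (∙-⊙ˡ _ _ t S) (*-congʳ (∑-δ j (f l))))
                    (trans (∙-⊖ˡ _ t S) (-‿cong (∙-assoc _ _ t S))) ⟩
        f l j * (step F l ∙ t) S + - (D (δ j) (step F l) ∙ (vec (f l) ∙ t)) S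
          ≈⟨ trans (+-comm _ _) (+-cong (trans (sym (-1*x≈-x _)) (sym (+-identityˡ _))) (*-comm _ _)) ⟩
        (0# + - 1# * (D (δ j) (step F l) ∙ (vec (f l) ∙ t)) S) + (step F l ∙ t) S * f l j ∎

    -- Contracting the product with `δ j` shows that v j times the step is D (δ j) (step F l) ∙ vec
    -- v. Completing both sides to ξ isolates v j as a coordinate of a vector from
    -- `contraction∈Span`, without any division.
    annihilated⇒Span : ∀ l → l ≤ k → ∀ {v} → step F l ∙ vec v ≋ 𝟎 → Span l v
    annihilated⇒Span l l≤k {v} eq = Span-cong l at (contraction∈Span l l≤k (vec v ∙ t) ⊤)
      where
      d = k ℕ.∸ l
      t = tail l d
      at : ∀ j → (D (δ j) (step F l) ∙ (vec v ∙ t)) ⊤ ≈ v j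
      at j = begin
        (D (δ j) (step F l) ∙ (vec v ∙ t)) ⊤
          ≈⟨ trans (sym (∙-assoc (D (δ j) (step F l)) (vec v) t ⊤)) (∙-congʳ (λ A → sym (commuted A)) ⊤) ⟩
        ((v j ⊙ step F l) ∙ t) ⊤
          ≈⟨ trans (∙-⊙ˡ _ _ t ⊤) (*-congˡ (step-tail l d (ℕ.m+[n∸m]≡n l≤k))) ⟩
        v j * 1#  ≈⟨ *-identityʳ _ ⟩
        v j       ∎
        where
        commuted : v j ⊙ step F l ≋ D (δ j) (step F l) ∙ vec v
        commuted A = begin
          v j * step F l A                              ≈⟨ +-identityʳ _ ⟨
          v j * step F l A + 0#                         ≈⟨ +-congˡ (-‿inverseˡ p) ⟨
          v j * step F l A + (- p + p)                  ≈⟨ +-assoc _ _ _ ⟨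
          (v j * step F l A + - p) + p                  ≈⟨ +-congʳ (+-congʳ (*-congʳ (∑-δ j v))) ⟨
          (⟨ δ j , v ⟩ * step F l A + - p) + p
            ≈⟨ +-congʳ (trans (sym (D-∙-vec (δ j) v (step F l) A))
                 (trans (D-cong (λ _ → refl) eq A) (D-𝟎 (δ j) A))) ⟩
          0# + p                                        ≈⟨ +-identityˡ _ ⟩
          p                                             ∎
          where p = (D (δ j) (step F l) ∙ vec v) A

  -- The operator N = u - 1 on a flag stabilized by u.

  module Nilpotent (u : Matrix) where
    N : V → V
    N v i = (u $ᵥ v) i + - v i

    N-cong : ∀ {v w} → (∀ j → v j ≈ w j) → ∀ i → N v i ≈ N w i
    N-cong eq i = +-cong ($ᵥ-cong u eq i) (-‿cong (eq i))

    N-axpy : ∀ s v w i → N (λ j → v j + s * w j) i ≈ N v i + s * N w i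
    N-axpy s v w i = begin
      (u $ᵥ (λ j → v j + s * w j)) i + - (v i + s * w i)
        ≈⟨ +-cong ($ᵥ-axpy u s v w i) (trans (sym (-‿+-comm _ _)) (+-congˡ (-‿distribʳ-* _ _))) ⟩
      ((u $ᵥ v) i + s * (u $ᵥ w) i) + (- v i + s * - w i)   ≈⟨ +-interchange _ _ _ _ ⟩
      N v i + (s * (u $ᵥ w) i + s * - w i)                  ≈⟨ +-congˡ (distribˡ _ _ _) ⟨
      N v i + s * N w i                                     ∎

    N-* : ∀ s v i → N (λ j → s * v j) i ≈ s * N v i
    N-* s v i = trans (N-cong (λ j → sym (+-identityˡ _)) i) (trans (N-axpy s (λ _ → 0#) v i)
      (trans (+-congʳ (trans (+-cong (∑-0 (allFin k) (λ j → zeroʳ _)) -0#≈0#) (+-identityˡ _))) (+-identityˡ _)))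

    N-0 : ∀ {v} → (∀ j → v j ≈ 0#) → ∀ i → N v i ≈ 0#
    N-0 {v} eq i = trans (+-cong (∑-0 (allFin k) (λ j → trans (*-congˡ (eq j)) (zeroʳ _)))
                             (trans (-‿cong (eq i)) -0#≈0#)) (+-identityˡ _)

    N^ : ℕ → V → V
    N^ zero    v = v
    N^ (suc h) v = N (N^ h v)

    N^-cong : ∀ h {v w} → (∀ j → v j ≈ w j) → ∀ i → N^ h v i ≈ N^ h w i
    N^-cong zero    eq = eq
    N^-cong (suc h) eq = N-cong (N^-cong h eq)

    N^-axpy : ∀ h s v w i → N^ h (λ j → v j + s * w j) i ≈ N^ h v i + s * N^ h w i
    N^-axpy zero    s v w i = refl
    N^-axpy (suc h) s v w i = trans (N-cong (N^-axpy h s v w) i) (N-axpy s (N^ h v) (N^ h w) i)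

    N^-0 : ∀ h {v} → (∀ j → v j ≈ 0#) → ∀ i → N^ h v i ≈ 0#
    N^-0 zero    eq = eq
    N^-0 (suc h) eq = N-0 (N^-0 h eq)

    N^-∑ : ∀ h {a} {A : Set a} (xs : List A) (g : A → Carrier) (w : A → V) i →
           N^ h (λ j → ∑ xs (λ x → g x * w x j)) i ≈ ∑ xs (λ x → g x * N^ h (w x) i)
    N^-∑ h []       g w i = N^-0 h (λ _ → refl) i
    N^-∑ h (x ∷ xs) g w i = trans (N^-cong h (λ j → +-comm _ _) i) (trans (N^-axpy h (g x) _ (w x) i)
      (trans (+-comm _ _) (+-congˡ (N^-∑ h xs g w i))))

    module _ (F : AffineFlag) (stab : E.Stabilizes u F) where
      open Basis F

      -- As u fixes steps i and i + 1, the product of step i with u (f i) is u applied to step i +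
      -- 1, hence equals the product of step i with f i. So step i kills the difference.
      N-f : ∀ i → i < k → Span i (N (f i))
      N-f i i<k = annihilated⇒Span i (ℕ.<⇒≤ i<k) λ S → begin
        (step F i ∙ vec (N (f i))) S
          ≈⟨ ∙-congˡ (λ A → trans (vec-cong (λ j → +-congˡ (sym (-1*x≈-x _))) A) (vec-axpy (- 1#) _ (f i) A)) S ⟩
        (step F i ∙ (vec (u $ᵥ f i) ⊕ (- 1#) ⊙ vec (f i))) S
          ≈⟨ trans (∙-⊕ʳ _ _ _ S) (+-cong (invariant S) (trans (∙-⊙ʳ _ _ _ S) (*-congˡ (extends i i<k S)))) ⟩
        step F (suc i) S + - 1# * step F (suc i) S
          ≈⟨ trans (+-congˡ (-1*x≈-x _)) (-‿inverseʳ _) ⟩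
        0# ∎
        where
        stab-Φ : ∀ l → l ≤ k → Φ (u ᵀ) (step F l) ≋ step F l
        stab-Φ l l≤k S = trans (sym ($-Φ u _ S)) (stab l l≤k S)
        invariant : step F i ∙ vec (u $ᵥ f i) ≋ step F (suc i)
        invariant S = begin
          (step F i ∙ vec (u $ᵥ f i)) S
            ≈⟨ ∙-cong (λ A → sym (stab-Φ i (ℕ.<⇒≤ i<k) A)) (λ A → sym (Φ-vec-$ᵥ u (f i) A)) S ⟩
          (Φ (u ᵀ) (step F i) ∙ Φ (u ᵀ) (vec (f i))) S
            ≈⟨ Φ-∙ (u ᵀ) _ _ S ⟨
          Φ (u ᵀ) (step F i ∙ vec (f i)) S
            ≈⟨ Φ-cong (λ _ _ → refl) (extends i i<k) S ⟩
          Φ (u ᵀ) (step F (suc i)) S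
            ≈⟨ stab-Φ (suc i) i<k S ⟩
          step F (suc i) S ∎

      N-Span : ∀ l → l < k → ∀ {v} → Span (suc l) v → Span l (N v)
      N-Span zero    l<k {v} (w , s , p , v≈) = Span-cong 0 (λ j → sym (trans (N-cong v≈ j) (N-axpy s w (f 0) j)))
        (Span-axpy 0 s (lift (N-0 (Level.lower p))) (N-f 0 l<k))
      N-Span (suc l) l<k {v} (w , s , p , v≈) = Span-cong (suc l) (λ j → sym (trans (N-cong v≈ j) (N-axpy s w (f (suc l)) j)))
        (Span-axpy (suc l) s (Span-suc l (N-Span l (ℕ.<⇒≤ l<k) p)) (N-f (suc l) l<k))

      N^-Span : ∀ h m → m ℕ.+ h ≤ k → ∀ {v} → Span (m ℕ.+ h) v → Span m (N^ h v)
      N^-Span zero    m m≤k {v} p = ≡.subst (λ l → Span l v) (ℕ.+-identityʳ m) p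
      N^-Span (suc h) m m≤k {v} p = N-Span m (ℕ.≤-trans (ℕ.m≤m+n (suc m) h) le)
        (N^-Span h (suc m) le (≡.subst (λ l → Span l v) (ℕ.+-suc m h) p))
        where
        le : suc m ℕ.+ h ≤ k
        le = ≡.subst (_≤ k) (ℕ.+-suc m h) m≤k

      -- The entry of N next to the diagonal in the basis of the flag, read off from the span
      -- containing N (f (i + 1)), and 1 outside the range. The decision is an argument so that
      -- proofs can match on it.
      leadOf : ∀ i → Dec (suc i < k) → Carrier
      leadOf i (yes i<k) = proj₁ (proj₂ (N-f (suc i) i<k))
      leadOf i (no _)    = 1#

      lead : ℕ → Carrier
      lead i = leadOf i (suc i ℕ.<? k)

      N-f-suc : ∀ i → suc i < k → ∃[ w ] Span i w × (∀ j → N (f (suc i)) j ≈ w j + lead i * f i j)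
      N-f-suc i i<k = go (suc i ℕ.<? k)
        where
        go : ∀ d → ∃[ w ] Span i w × (∀ j → N (f (suc i)) j ≈ w j + leadOf i d * f i j)
        go (yes p) = let span = N-f (suc i) p in proj₁ span , proj₂ (proj₂ span)
        go (no ¬p) with () ← ¬p i<k

      -- The product of the entries lead m, ..., lead (m + h - 1), which is the coefficient of f m
      -- in Nʰ (f (m + h)).
      leads : ℕ → ℕ → Carrier
      leads m zero    = 1#
      leads m (suc h) = leads (suc m) h * lead m

      N^-f : ∀ h m → m ℕ.+ h < k →
             ∃[ w ] Span m w × (∀ j → N^ h (f (m ℕ.+ h)) j ≈ w j + leads m h * f m j)
      N^-f zero    m m<k = (λ _ → 0#) , Span-0 m , λ j → trans
        (reflexive (≡.cong (λ i → f i j) (ℕ.+-identityʳ m))) (sym (trans (+-identityˡ _) (*-identityˡ _)))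
      N^-f (suc h) m m<k
        with w , p , eq ← N^-f h (suc m) (≡.subst (_< k) (ℕ.+-suc m h) m<k)
           | w′ , p′ , eq′ ← N-f-suc m (ℕ.≤-<-trans (ℕ.≤-trans (ℕ.m≤m+n (suc m) h) (ℕ.≤-reflexive (≡.sym (ℕ.+-suc m h)))) m<k)
        = _ , Span-axpy m (leads (suc m) h) (N-Span m (ℕ.≤-<-trans (ℕ.m≤m+n m (suc h)) m<k) p) p′ , λ j → begin
          N (N^ h (f (m ℕ.+ suc h))) j
            ≈⟨ N-cong (λ i → trans (reflexive (≡.cong (λ l → N^ h (f l) i) (ℕ.+-suc m h))) (eq i)) j ⟩
          N (λ i → w i + leads (suc m) h * f (suc m) i) j
            ≈⟨ trans (N-axpy _ w _ j) (+-congˡ (*-congˡ (eq′ j))) ⟩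
          N w j + leads (suc m) h * (w′ j + lead m * f m j)
            ≈⟨ +-congˡ (trans (distribˡ _ _ _) (+-congˡ (sym (*-assoc _ _ _)))) ⟩
          N w j + (leads (suc m) h * w′ j + leads m (suc h) * f m j)
            ≈⟨ +-assoc _ _ _ ⟨
          (N w j + leads (suc m) h * w′ j) + leads m (suc h) * f m j ∎

      -- Of the d + 1 vectors of the flag split off step F (d + 1), where
      -- d = m + h, N^ h maps all but the last into the span of step F m.
      contraction : ∀ m h → m ℕ.+ h < k → (S R : Subset k) →
                    ∑ (allFin k) (λ j → (step F m ∙ vec (N^ h (δ j))) S * D (δ j) (step F (suc (m ℕ.+ h))) R)
                    ≈ leads m h * (step F (suc m) S * step F (m ℕ.+ h) R)
      contraction m h d<k S R = begin
        ∑ (allFin k) (λ j → α j * D (δ j) (step F (suc d)) R)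
          ≈⟨ D-expand α (step F (suc d)) R ⟨
        D α (step F (suc d)) R
          ≈⟨ D-step d d<k R ⟩
        ⟨ α , f d ⟩ * step F d R + - (D α (step F d) ∙ vec (f d)) R
          ≈⟨ +-cong (*-congʳ top) (trans (-‿cong (trans (∙-congʳ (vanish d ℕ.≤-refl) R) (∙-𝟎ˡ _ R))) -0#≈0#) ⟩
        leads m h * step F (suc m) S * step F d R + 0#
          ≈⟨ trans (+-identityʳ _) (*-assoc _ _ _) ⟩
        leads m h * (step F (suc m) S * step F d R) ∎
        where
        d = m ℕ.+ h
        m<k : m < k
        m<k = ℕ.≤-<-trans (ℕ.m≤m+n m h) d<k
        -- The factor on the left depends on j as a covector does, so the whole sum is a single
        -- contraction of step d + 1. By `pairing`, α evaluates at v to the S-coordinate of step m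
        -- times Nʰ v.
        α : Fin k → Carrier
        α j = (step F m ∙ vec (N^ h (δ j))) S
        pairing : ∀ v → ⟨ α , v ⟩ ≈ (step F m ∙ vec (N^ h v)) S
        pairing v = begin
          ∑ (allFin k) (λ j → α j * v j)
            ≈⟨ ∑-cong (allFin k) (λ j → trans (*-comm _ _) (sym (trans (∙-congˡ (vec-* (v j) _) S) (∙-⊙ʳ _ _ _ S)))) ⟩
          ∑ (allFin k) (λ j → (step F m ∙ vec (λ i → v j * N^ h (δ j) i)) S)
            ≈⟨ trans (∙-congˡ (vec-∑ (allFin k) _) S) (∙-∑ʳ (allFin k) _ _ S) ⟨
          (step F m ∙ vec (λ i → ∑ (allFin k) (λ j → v j * N^ h (δ j) i))) S
            ≈⟨ ∙-congˡ (vec-cong (λ i → trans (sym (N^-∑ h (allFin k) v δ i)) (N^-cong h expand i))) S ⟩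
          (step F m ∙ vec (N^ h v)) S ∎
          where
          expand : ∀ i → ∑ (allFin k) (λ j → v j * δ j i) ≈ v i
          expand i = trans (∑-cong (allFin k) (λ j → trans (*-comm _ _) (*-congʳ (indicator-sym ⁅ j ⁆ ⁅ i ⁆)))) (∑-δ i v)
        D-step : ∀ i → i < k → D α (step F (suc i)) ≋ ⟨ α , f i ⟩ ⊙ step F i ⊕ (⊖ (D α (step F i) ∙ vec (f i)))
        D-step i i<k A = trans (D-cong (λ _ → refl) (λ B → sym (extends i i<k B)) A) (D-∙-vec α (f i) (step F i) A)
        vanish : ∀ i → i ≤ d → D α (step F i) ≋ 𝟎
        vanish zero    i≤d A = trans (D-cong (λ _ → refl) step-0 A) (D-unit α A)
        vanish (suc i) i<d A = trans (D-step i (ℕ.<-trans i<d d<k) A) (trans (+-cong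
          (trans (*-congʳ (trans (pairing (f i)) (step∙Span m (ℕ.<⇒≤ m<k)
            (N^-Span h m (ℕ.<⇒≤ d<k) (Span-≤ (ℕ.≤⇒≤′ i<d) (f∈Span i))) S))) (zeroˡ _))
          (trans (-‿cong (trans (∙-congʳ (vanish i (ℕ.<⇒≤ i<d)) A) (∙-𝟎ˡ _ A))) -0#≈0#)) (+-identityˡ _))
        top : ⟨ α , f d ⟩ ≈ leads m h * step F (suc m) S
        top with w , p , eq ← N^-f h m d<k = trans (pairing (f d)) (step∙leading m m<k p eq S)

      -- If F′ has the steps of F up to factors s, the vector v completing its step j + 1 satisfies
      -- s (j + 1) v ≡ s (j + 2) f (j + 1) modulo that step. Applying N leaves s (j + 2) lead j
      -- times f j modulo step j. The factor s (j + 1) is kept on the left to avoid dividing by it.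
      reflection : ∀ {F′ G} (i : Fin (pred k)) → E.Reflects u i F′ G → let j = toℕ i in
                   (s : ℕ → Carrier) → (∀ a → a ≤ k → step F′ a ≋ s a ⊙ step F a) →
                   s (suc j) ⊙ step G (suc j) ≋ (s j * s (suc (suc j)) * lead j) ⊙ step F (suc j)
      reflection {F′} {G} i r s F′≋ S
        with w , p , eq ← N-f-suc (toℕ i) (2+toℕ≤ i) = begin
        s₁ * step G (suc j) S
          ≈⟨ *-congˡ (trans (R.changed S) (trans (∧-∙ _ _ S) (∙-cong (F′≋ j j≤k) (ι-vec (N v)) S))) ⟩
        s₁ * ((s j ⊙ step F j) ∙ vec (N v)) S
          ≈⟨ trans (*-congˡ (∙-⊙ˡ _ _ _ S)) (trans (x*yz≈y*xz _ _ _) (*-congˡ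
               (sym (trans (∙-congˡ (vec-* s₁ (N v)) S) (∙-⊙ʳ _ _ _ S))))) ⟩
        s j * (step F j ∙ vec (λ l → s₁ * N v l)) S
          ≈⟨ *-congˡ (step∙leading j (ℕ.<⇒≤ (2+toℕ≤ i))
               (Span-axpy j s₂ (N-Span j (ℕ.<⇒≤ (2+toℕ≤ i)) (annihilated⇒Span (suc j) (ℕ.<⇒≤ (2+toℕ≤ i)) killed)) p)
               leading S) ⟩
        s j * (s₂ * lead j * step F (suc j) S)
          ≈⟨ trans (sym (*-assoc _ _ _)) (*-congʳ (sym (*-assoc _ _ _))) ⟩
        s j * s₂ * lead j * step F (suc j) S ∎
        where
        module R = E.Reflects r
        j = toℕ i
        v = R.v
        s₁ = s (suc j)
        s₂ = s (suc (suc j))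
        j≤k : j ≤ k
        j≤k = ℕ.<⇒≤ (ℕ.<⇒≤ (2+toℕ≤ i))
        -- The difference of the two multiples compared above. It is killed by step j + 1, so N maps
        -- it into the span of step j, where it no longer contributes.
        d : V
        d l = s₁ * v l + (- s₂) * f (suc j) l
        killed : step F (suc j) ∙ vec d ≋ 𝟎
        killed A = begin
          (step F (suc j) ∙ vec d) A
            ≈⟨ ∙-congˡ (λ B → trans (vec-axpy (- s₂) (λ l → s₁ * v l) (f (suc j)) B) (+-congʳ (vec-* s₁ v B))) A ⟩
          (step F (suc j) ∙ (s₁ ⊙ vec v ⊕ (- s₂) ⊙ vec (f (suc j)))) A
            ≈⟨ trans (∙-⊕ʳ _ _ _ A) (+-cong (trans (∙-⊙ʳ _ _ _ A) (sym (∙-⊙ˡ _ _ _ A)))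
                 (trans (∙-⊙ʳ _ _ _ A) (*-congˡ (extends (suc j) (2+toℕ≤ i) A)))) ⟩
          ((s₁ ⊙ step F (suc j)) ∙ vec v) A + - s₂ * step F (suc (suc j)) A
            ≈⟨ +-cong (trans (∙-cong (λ B → sym (F′≋ (suc j) (ℕ.<⇒≤ (2+toℕ≤ i)) B)) (λ B → sym (ι-vec v B)) A)
                 (trans (sym (∧-∙ _ _ A)) (trans (R.completes A) (F′≋ (suc (suc j)) (2+toℕ≤ i) A))))
                 (sym (-‿distribˡ-* _ _)) ⟩
          s₂ * step F (suc (suc j)) A + - (s₂ * step F (suc (suc j)) A)
            ≈⟨ -‿inverseʳ _ ⟩
          0# ∎
        leading : ∀ l → s₁ * N v l ≈ (N d l + s₂ * _) + s₂ * lead j * f j l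
        leading l = sym (begin
          (N d l + s₂ * w l) + s₂ * lead j * f j l
            ≈⟨ trans (+-assoc _ _ _) (+-congˡ (trans (+-congˡ (*-assoc _ _ _)) (sym (distribˡ _ _ _)))) ⟩
          N d l + s₂ * (w l + lead j * f j l)
            ≈⟨ +-cong (trans (N-axpy (- s₂) _ _ l) (+-congʳ (N-* s₁ v l))) (*-congˡ (sym (eq l))) ⟩
          (s₁ * N v l + - s₂ * N (f (suc j)) l) + s₂ * N (f (suc j)) l
            ≈⟨ trans (+-assoc _ _ _) (+-congˡ (trans (+-congʳ (sym (-‿distribˡ-* _ _))) (-‿inverseˡ _))) ⟩
          s₁ * N v l + 0#   ≈⟨ +-identityʳ _ ⟩
          s₁ * N v l        ∎)

-- One-line notation of permutations, and products over subsets.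

swapAt-↭ : ∀ {A : Set} i (xs : List A) → swapAt i xs ↭ xs
swapAt-↭ zero    []           = ↭.refl
swapAt-↭ zero    (x ∷ [])     = ↭.refl
swapAt-↭ zero    (x ∷ y ∷ xs) = ↭.swap y x ↭.refl
swapAt-↭ (suc i) []           = ↭.refl
swapAt-↭ (suc i) (x ∷ xs)     = ↭.prep x (swapAt-↭ i xs)

swaps-↭ : ∀ {n} {A : Set} (xs : List A) (is : List (Fin n)) → swaps xs is ↭ xs
swaps-↭ xs []       = ↭.refl
swaps-↭ xs (i ∷ is) = ↭.trans (swaps-↭ (swapAt (toℕ i) xs) is) (swapAt-↭ (toℕ i) xs)

oneLine-unique : ∀ k (w : Word k) → Unique (oneLine k w)
oneLine-unique k w =
  ↭ₛ.Unique-resp-↭ (≡.setoid (Fin k)) (↭⇒↭ₛ (↭.↭-sym (swaps-↭ (allFin k) w))) (Unique.allFin⁺ k)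

∣insert∣ : ∀ {n} {x : Fin n} (S : Subset n) → x Subset.∉ S → ∣ S [ x ]≔ inside ∣ ≡ suc ∣ S ∣
∣insert∣ {x = zero}  (inside ∷ S)  x∉ = ⊥-elim (x∉ here)
∣insert∣ {x = zero}  (outside ∷ S) x∉ = ≡.refl
∣insert∣ {x = suc x} (inside ∷ S)  x∉ = ≡.cong suc (∣insert∣ S (x∉ ∘ there))
∣insert∣ {x = suc x} (outside ∷ S) x∉ = ∣insert∣ S (x∉ ∘ there)

∣delete∣ : ∀ {n} {x : Fin n} (S : Subset n) → x Subset.∈ S → ∣ S ∣ ≡ suc ∣ S [ x ]≔ outside ∣
∣delete∣ {x = zero}  (inside ∷ S)  x∈         = ≡.refl
∣delete∣ {x = suc x} (inside ∷ S)  (there x∈) = ≡.cong suc (∣delete∣ S x∈)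
∣delete∣ {x = suc x} (outside ∷ S) (there x∈) = ∣delete∣ S x∈

⁅⁆∪ : ∀ {n} (x : Fin n) S → ⁅ x ⁆ ∪ S ≡ S [ x ]≔ inside
⁅⁆∪ zero    (s ∷ S)       = ≡.cong (inside ∷_) (Subset.∪-identityˡ S)
⁅⁆∪ (suc x) (s ∷ S)       = ≡.cong (s ∷_) (⁅⁆∪ x S)

∈-fromList : ∀ {n} {x : Fin n} {xs} → All (x ≢_) xs → x Subset.∉ fromList xs
∈-fromList []         x∈ = Subset.∉⊥ x∈
∈-fromList {xs = y ∷ xs} (x≢y ∷ x≢) x∈ with Subset.x∈p∪q⁻ ⁅ y ⁆ (fromList xs) x∈
... | inj₁ p = x≢y (Subset.x∈⁅y⁆⇒x≡y y p)
... | inj₂ p = ∈-fromList x≢ p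

module Products {c ℓ} (R : CommutativeRing c ℓ) where
  open Sums R

  ∏∈ : ∀ {n} → Subset n → (Fin n → Carrier) → Carrier
  ∏∈ []            g = 1#
  ∏∈ (inside ∷ S)  g = g zero * ∏∈ S (g ∘ suc)
  ∏∈ (outside ∷ S) g = ∏∈ S (g ∘ suc)

  ∏∈-⊥ : ∀ n (g : Fin n → Carrier) → ∏∈ ⊥ g ≈ 1#
  ∏∈-⊥ zero    g = refl
  ∏∈-⊥ (suc n) g = ∏∈-⊥ n (g ∘ suc)

  ∏∈-insert : ∀ {n} {x : Fin n} (S : Subset n) g → x Subset.∉ S → ∏∈ (S [ x ]≔ inside) g ≈ g x * ∏∈ S g
  ∏∈-insert {x = zero}  (inside ∷ S)  g x∉ = ⊥-elim (x∉ here)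
  ∏∈-insert {x = zero}  (outside ∷ S) g x∉ = refl
  ∏∈-insert {x = suc x} (inside ∷ S)  g x∉ = trans (*-congˡ (∏∈-insert S (g ∘ suc) (x∉ ∘ there))) (x*yz≈y*xz _ _ _)
  ∏∈-insert {x = suc x} (outside ∷ S) g x∉ = ∏∈-insert S (g ∘ suc) (x∉ ∘ there)

  ∏∈-delete : ∀ {n} {x : Fin n} (S : Subset n) g → x Subset.∈ S → ∏∈ S g ≈ g x * ∏∈ (S [ x ]≔ outside) g
  ∏∈-delete {x = zero}  (inside ∷ S)  g x∈         = refl
  ∏∈-delete {x = suc x} (inside ∷ S)  g (there x∈) = trans (*-congˡ (∏∈-delete S (g ∘ suc) x∈)) (x*yz≈y*xz _ _ _)
  ∏∈-delete {x = suc x} (outside ∷ S) g (there x∈) = ∏∈-delete S (g ∘ suc) x∈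

  ∏-fromList : ∀ {n} {xs : List (Fin n)} g → Unique xs → ∏ xs g ≈ ∏∈ (fromList xs) g
  ∏-fromList {n} g AllPairs.[] = sym (∏∈-⊥ n g)
  ∏-fromList {xs = x ∷ xs} g (x≢ AllPairs.∷ u) = trans (*-congˡ (∏-fromList g u)) (sym (trans
    (reflexive (≡.cong (λ S → ∏∈ S g) (⁅⁆∪ x (fromList xs))))
    (∏∈-insert (fromList xs) g (∈-fromList x≢))))

  ∏-image : ∀ k (w : Word k) a g → ∏ (take a (oneLine k w)) g ≈ ∏∈ (image k w a) g
  ∏-image k w a g = ∏-fromList g (Unique.take⁺ a (oneLine-unique k w))

  ∏-swapAt-≢ : ∀ {A : Set} i (xs : List A) a g → a ≢ suc i → ∏ (take a (swapAt i xs)) g ≈ ∏ (take a xs) g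
  ∏-swapAt-≢ zero    []           a             g a≢ = refl
  ∏-swapAt-≢ zero    (x ∷ [])     a             g a≢ = refl
  ∏-swapAt-≢ zero    (x ∷ y ∷ xs) zero          g a≢ = refl
  ∏-swapAt-≢ zero    (x ∷ y ∷ xs) (suc zero)    g a≢ = ⊥-elim (a≢ ≡.refl)
  ∏-swapAt-≢ zero    (x ∷ y ∷ xs) (suc (suc a)) g a≢ = x*yz≈y*xz _ _ _
  ∏-swapAt-≢ (suc i) []           a             g a≢ = refl
  ∏-swapAt-≢ (suc i) (x ∷ xs)     zero          g a≢ = refl
  ∏-swapAt-≢ (suc i) (x ∷ xs)     (suc a)       g a≢ = *-congˡ (∏-swapAt-≢ i xs a g (a≢ ∘ ≡.cong suc))

  -- With P the product of the first i entries and x, y the next two, both sides are P · P · x · y.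
  -- The form without quotients fits that of `reflection`.
  ∏-swapAt-≡ : ∀ {A : Set} i (xs : List A) g → suc (suc i) ≤ length xs →
               ∏ (take (suc i) (swapAt i xs)) g * ∏ (take (suc i) xs) g ≈
               ∏ (take i xs) g * ∏ (take (suc (suc i)) xs) g
  ∏-swapAt-≡ zero    (x ∷ y ∷ xs) g le       = begin
    (g y * 1#) * (g x * 1#)   ≈⟨ trans (*-comm _ _) (trans (*-congʳ (*-identityʳ _)) (sym (*-identityˡ _))) ⟩
    1# * (g x * (g y * 1#))   ∎
  ∏-swapAt-≡ zero    (x ∷ [])     g (s≤s ())
  ∏-swapAt-≡ (suc i) (x ∷ xs)     g (s≤s le) = trans (*-interchange _ _ _ _)
    (trans (*-congˡ (∏-swapAt-≡ i xs g le)) (*-interchange _ _ _ _))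

  ∏-allFin-suc : ∀ n a (r : ℕ → Carrier) → a < n →
                 ∏ (take (suc a) (allFin n)) (r ∘ toℕ) ≈ ∏ (take a (allFin n)) (r ∘ toℕ) * r a
  ∏-allFin-suc (suc n) zero    r a<n = *-comm _ _
  ∏-allFin-suc (suc n) (suc a) r (s≤s a<n) = trans (*-congˡ (trans (shift (suc a)) (∏-allFin-suc n a (r ∘ suc) a<n)))
    (trans (*-congˡ (*-congʳ (sym (shift a)))) (sym (*-assoc _ _ _)))
    where
    shift : ∀ b → ∏ (take b (tabulate {n = n} suc)) (r ∘ toℕ) ≈ ∏ (take b (allFin n)) (r ∘ suc ∘ toℕ)
    shift b = trans (reflexive (≡.cong (λ l → ∏ l (r ∘ toℕ)) (≡.trans
      (≡.cong (take b) (≡.sym (map-tabulate {n = n} id suc))) (take-map b (allFin n)))))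
      (∏-map suc (take b (allFin n)) (r ∘ toℕ))

-- The Weyl group rescales the steps of the flag.

module Weyl {c ℓ₁ ℓ₂} (𝕂 : HeytingField c ℓ₁ ℓ₂) (k : ℕ)
  (u : Exterior.Matrix 𝕂 k) (F : Exterior.AffineFlag 𝕂 k) (stable : Exterior.Stabilizes 𝕂 k u F)
  (act : Word k → Exterior.AffineFlag 𝕂 k) (acts : ∀ w → Exterior.Acts 𝕂 k u w F (act w)) where
  open Flags 𝕂 k public
  open Sums ring hiding (ring)
  open SubsetAlgebra ring
  open Products ring
  open E using (V; Matrix; AffineFlag; step; _$ᵥ_)
  open Basis F
  open Nilpotent u public

  -- The reflected flag has `lead` times step i + 1 of F as its step, and its own remaining vectors
  -- complete that to ξ. Completing the step of F by the same vectors gives the inverse.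
  lead-invertible : ∀ i → suc i < k → ∃[ c̄ ] lead F stable i * c̄ ≈ 1#
  lead-invertible i i<k = go j j≡i (acts (j ∷ []))
    where
    i<k-1 : i < pred k
    i<k-1 = ℕ.pred-mono-≤ i<k
    j : Fin (pred k)
    j = fromℕ< i<k-1
    j≡i : toℕ j ≡ i
    j≡i = Fin.toℕ-fromℕ< i<k-1
    go : ∀ j → toℕ j ≡ i → E.Acts u (j ∷ []) F (act (j ∷ [])) → ∃[ c̄ ] lead F stable i * c̄ ≈ 1#
    go j ≡.refl (E.next {G = G} r _) = (step F (suc i) ∙ t) ⊤ , (begin
      lead F stable i * (step F (suc i) ∙ t) ⊤
        ≈⟨ ∙-⊙ˡ (lead F stable i) (step F (suc i)) t ⊤ ⟨
      ((lead F stable i ⊙ step F (suc i)) ∙ t) ⊤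
        ≈⟨ ∙-congʳ {y = t} (λ S → sym (G≋ S)) ⊤ ⟩
      (step G (suc i) ∙ t) ⊤
        ≈⟨ Basis.step-tail G (suc i) (k ℕ.∸ suc i) (ℕ.m+[n∸m]≡n (ℕ.<⇒≤ i<k)) ⟩
      1# ∎)
      where
      t = Basis.tail G (suc i) (k ℕ.∸ suc i)
      G≋ : step G (suc i) ≋ lead F stable i ⊙ step F (suc i)
      G≋ S = trans (sym (*-identityˡ _)) (trans (reflection F stable {F} {G} j r (λ _ → 1#) (λ a _ A → sym (*-identityˡ _)) S)
        (*-congʳ (trans (*-congʳ (*-identityˡ _)) (*-identityˡ _))))

  inverse : ∀ i → Dec (suc i < k) → Carrier
  inverse i (yes i<k) = proj₁ (lead-invertible i i<k)
  inverse i (no _)    = 1#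

  -- The vectors of the flag are y i times vectors that a reflection at i
  -- rescales by exchanging y i and y (i + 1); ȳ i inverts y i.
  y ȳ η : ℕ → Carrier
  y zero    = 1#
  y (suc i) = y i * lead F stable i
  ȳ zero    = 1#
  ȳ (suc i) = ȳ i * inverse i (suc i ℕ.<? k)
  η zero    = 1#
  η (suc i) = η i * ȳ i

  lead-inverse : ∀ i → suc i < k → lead F stable i * inverse i (suc i ℕ.<? k) ≈ 1#
  lead-inverse i i<k = go (suc i ℕ.<? k)
    where
    go : ∀ d → lead F stable i * inverse i d ≈ 1#
    go (yes p) = proj₂ (lead-invertible i p)
    go (no ¬p) = ⊥-elim (¬p i<k)

  y-inverse : ∀ i → i < k → y i * ȳ i ≈ 1#
  y-inverse zero    i<k = *-identityˡ _
  y-inverse (suc i) i<k = trans (*-interchange _ _ _ _)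
    (trans (*-cong (y-inverse i (ℕ.<⇒≤ i<k)) (lead-inverse i i<k)) (*-identityˡ _))

  ȳ-suc : ∀ i → suc i < k → ȳ (suc i) * lead F stable i ≈ ȳ i
  ȳ-suc i i<k = trans (*-assoc _ _ _) (trans (*-congˡ (trans (*-comm _ _) (lead-inverse i i<k))) (*-identityʳ _))

  ȳ-leads : ∀ m h → m ℕ.+ h < k → ȳ (m ℕ.+ h) * leads F stable m h ≈ ȳ m
  ȳ-leads m zero    m<k = trans (*-identityʳ _) (reflexive (≡.cong ȳ (ℕ.+-identityʳ m)))
  ȳ-leads m (suc h) m<k = begin
    ȳ (m ℕ.+ suc h) * (leads F stable (suc m) h * lead F stable m)
      ≈⟨ trans (sym (*-assoc _ _ _)) (*-congʳ (*-congʳ (reflexive (≡.cong ȳ (ℕ.+-suc m h))))) ⟩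
    ȳ (suc m ℕ.+ h) * leads F stable (suc m) h * lead F stable m
      ≈⟨ *-congʳ (ȳ-leads (suc m) h m+h<k) ⟩
    ȳ (suc m) * lead F stable m
      ≈⟨ ȳ-suc m (ℕ.≤-<-trans (ℕ.m≤m+n (suc m) h) m+h<k) ⟩
    ȳ m ∎
    where
    m+h<k : suc m ℕ.+ h < k
    m+h<k = ≡.subst (_< k) (ℕ.+-suc m h) m<k

  Y : ℕ → List (Fin k) → Carrier
  Y a L = ∏ (take a L) (y ∘ toℕ)

  -- The factor λ for the permutation with one-line notation L: `η a` inverts the product of y 0,
  -- ..., y (a - 1), and `Y a L` belongs to the first a entries of L.
  scale : List (Fin k) → ℕ → Carrier
  scale L a = η a * Y a L

  scale-id : ∀ a → a ≤ k → scale (allFin k) a ≈ 1#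
  scale-id zero    a≤k = *-identityˡ _
  scale-id (suc a) a<k = begin
    η a * ȳ a * Y (suc a) (allFin k)        ≈⟨ *-congˡ (∏-allFin-suc k a y a<k) ⟩
    η a * ȳ a * (Y a (allFin k) * y a)      ≈⟨ *-interchange _ _ _ _ ⟩
    η a * Y a (allFin k) * (ȳ a * y a)      ≈⟨ *-cong (scale-id a (ℕ.<⇒≤ a<k)) (trans (*-comm _ _) (y-inverse a a<k)) ⟩
    1# * 1#                                 ≈⟨ *-identityˡ _ ⟩
    1#                                      ∎

  ∏y-inverse : (xs : List (Fin k)) → ∏ xs (y ∘ toℕ) * ∏ xs (ȳ ∘ toℕ) ≈ 1#
  ∏y-inverse []       = *-identityˡ _
  ∏y-inverse (x ∷ xs) = trans (*-interchange _ _ _ _)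
    (trans (*-cong (y-inverse (toℕ x) (Fin.toℕ<n x)) (∏y-inverse xs)) (*-identityˡ _))

  -- The entries of L are inverted one by one through ȳ; `η a` is inverted by the product for the
  -- identity permutation, whose scale is 1.
  scale-inverse : ∀ L a → a ≤ k → ∃[ μ ] μ * scale L a ≈ 1#
  scale-inverse L a a≤k = ∏ (take a L) (ȳ ∘ toℕ) * Y a (allFin k) , (begin
    p * q * (η a * Y a L)      ≈⟨ *-congˡ (*-comm _ _) ⟩
    p * q * (Y a L * η a)      ≈⟨ *-interchange _ _ _ _ ⟩
    (p * Y a L) * (q * η a)
      ≈⟨ *-cong (trans (*-comm _ _) (∏y-inverse (take a L))) (trans (*-comm _ _) (scale-id a a≤k)) ⟩
    1# * 1#                    ≈⟨ *-identityˡ _ ⟩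
    1#                         ∎)
    where
    p = ∏ (take a L) (ȳ ∘ toℕ)
    q = Y a (allFin k)

  -- The denominators' share in the reflection law; `∏-swapAt-≡` provides the numerators' share. It
  -- rests on `lead j` being the quotient of y (j + 1) by y j.
  η-middle : ∀ j → suc j < k → η (suc j) * η (suc j) ≈ η j * η (suc (suc j)) * lead F stable j
  η-middle j j<k = sym (begin
    η j * (η (suc j) * ȳ (suc j)) * lead F stable j  ≈⟨ *-congʳ (sym (*-assoc _ _ _)) ⟩
    η j * η (suc j) * ȳ (suc j) * lead F stable j    ≈⟨ trans (*-assoc _ _ _) (*-congˡ (ȳ-suc j j<k)) ⟩
    η j * η (suc j) * ȳ j                            ≈⟨ trans (*-congʳ (*-comm _ _)) (*-assoc _ _ _) ⟩
    η (suc j) * η (suc j)                            ∎)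

  Rescales : AffineFlag → List (Fin k) → Set ℓ₁
  Rescales G L = ∀ a → a ≤ k → step G a ≋ scale L a ⊙ step F a

  -- Swapping two neighbours of L changes the set of the first a entries only for a = i + 1. There
  -- `reflection` determines the new step up to the old scale, which μ cancels.
  Reflects-rescales : ∀ {G H} i {L} → length L ≡ k → Rescales G L → E.Reflects u i G H → Rescales H (swapAt (toℕ i) L)
  Reflects-rescales {G} {H} i {L} len G≋ r a a≤k S with a ℕ.≟ suc (toℕ i)
  ... | no a≢ = trans (E.Reflects.others r a a≤k a≢ S) (trans (G≋ a a≤k S)
    (*-congʳ (*-congˡ (sym (∏-swapAt-≢ (toℕ i) L a (y ∘ toℕ) a≢)))))
  ... | yes ≡.refl with μ , inv ← scale-inverse L a a≤k = begin
    step H a S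
      ≈⟨ trans (sym (*-identityˡ _)) (trans (*-congʳ (sym inv)) (*-assoc _ _ _)) ⟩
    μ * (scale L a * step H a S)
      ≈⟨ *-congˡ (trans (reflection F stable {G} {H} i r (scale L) G≋ S) (*-congʳ (sym scales))) ⟩
    μ * (scale L a * scale L′ a * step F a S)
      ≈⟨ trans (*-congˡ (*-assoc _ _ _)) (trans (sym (*-assoc _ _ _)) (trans (*-congʳ inv) (*-identityˡ _))) ⟩
    scale L′ a * step F a S ∎
    where
    j = toℕ i
    L′ = swapAt j L
    scales : scale L (suc j) * scale L′ (suc j) ≈ scale L j * scale L (suc (suc j)) * lead F stable j
    scales = begin
      scale L (suc j) * scale L′ (suc j)
        ≈⟨ *-interchange _ _ _ _ ⟩
      (η (suc j) * η (suc j)) * (Y (suc j) L * Y (suc j) L′)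
        ≈⟨ *-cong (η-middle j (2+toℕ≤ i)) (trans (*-comm _ _)
             (∏-swapAt-≡ j L (y ∘ toℕ) (≡.subst (suc (suc j) ≤_) (≡.sym len) (2+toℕ≤ i)))) ⟩
      (η j * η (suc (suc j)) * lead F stable j) * (Y j L * Y (suc (suc j)) L)
        ≈⟨ trans (*-assoc _ _ _) (trans (*-congˡ (*-comm _ _)) (sym (*-assoc _ _ _))) ⟩
      (η j * η (suc (suc j))) * (Y j L * Y (suc (suc j)) L) * lead F stable j
        ≈⟨ *-congʳ (*-interchange _ _ _ _) ⟩
      scale L j * scale L (suc (suc j)) * lead F stable j ∎

  Acts-rescales : ∀ w {G H L} → length L ≡ k → Rescales G L → E.Acts u w G H → Rescales H (swaps L w)
  Acts-rescales []      len G≋ (E.done H≋)  = λ a a≤k S → trans (H≋ a a≤k S) (G≋ a a≤k S)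
  Acts-rescales (i ∷ w) {G} {H} {L} len G≋ (E.next {G = G′} r rs) = Acts-rescales w
    (≡.trans (↭-length (swapAt-↭ (toℕ i) L)) len) (Reflects-rescales {G} {G′} i len G≋ r) rs

  tagged : Subset k → ℕ → Λ k
  tagged S = step (act (proj₁ (representative S)))

  -- The numerator of the scale is a product over the first a entries of the word's one-line
  -- notation and depends only on their set, so the chosen representative disappears and S remains.
  tagged≋ : ∀ S {a} → ∣ S ∣ ≡ a → tagged S a ≋ (η a * ∏∈ S (y ∘ toℕ)) ⊙ step F a
  tagged≋ S ≡.refl T = trans
    (Acts-rescales w {F} {act w} (length-tabulate id) (λ a a≤k A → sym (trans (*-congʳ (scale-id a a≤k)) (*-identityˡ _)))
      (acts w) ∣ S ∣ (Subset.∣p∣≤n S) T)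
    (*-congʳ (*-congˡ (trans (∏-image k w ∣ S ∣ (y ∘ toℕ))
      (reflexive (≡.cong (λ P → ∏∈ P (y ∘ toℕ)) (proj₂ (representative S)))))))
    where w = proj₁ (representative S)

  -- The scalars agree: moving x from one tag to the other preserves the joint product of the y
  -- (`∏s`), and the change of the denominators, ȳ (m + h) against ȳ m, is the coefficient `leads`
  -- produced by Nʰ (`ηs`).
  exchange : ∀ m h {A B x} → ∣ A ∣ ≡ suc m → ∣ B ∣ ≡ m ℕ.+ h → m ℕ.+ h < k → x Subset.∈ A → x Subset.∉ B →
             (S R : Subset k) →
             ∑ (allFin k) (λ j → (tagged (A [ x ]≔ outside) m ∙ vec (N^ h (δ j))) S
                               * D (δ j) (tagged (B [ x ]≔ inside) (suc (m ℕ.+ h))) R)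
             ≈ tagged A (suc m) S * tagged B (m ℕ.+ h) R
  exchange m h {A} {B} {x} ∣A∣ ∣B∣ b<k x∈A x∉B S R = begin
    ∑ (allFin k) (λ j → (tagged A′ m ∙ vec (N^ h (δ j))) S * D (δ j) (tagged B′ (suc b)) R)
      ≈⟨ ∑-cong (allFin k) (λ j → trans (*-cong
           (trans (∙-congʳ (tagged≋ A′ (ℕ.suc-injective (≡.trans (≡.sym (∣delete∣ A x∈A)) ∣A∣))) S) (∙-⊙ˡ _ _ _ S))
           (trans (D-cong (λ _ → refl) (tagged≋ B′ (≡.trans (∣insert∣ B x∉B) (≡.cong suc ∣B∣))) R) (D-⊙ _ _ _ R)))
           (*-interchange _ _ _ _)) ⟩
    ∑ (allFin k) (λ j → (p * q) * ((step F m ∙ vec (N^ h (δ j))) S * D (δ j) (step F (suc b)) R))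
      ≈⟨ trans (sym (∑-*ˡ (allFin k) _ _)) (*-congˡ (contraction F stable m h b<k S R)) ⟩
    (p * q) * (leads F stable m h * (step F (suc m) S * step F b R))
      ≈⟨ trans (sym (*-assoc _ _ _)) (*-congʳ scales) ⟩
    (p′ * q′) * (step F (suc m) S * step F b R)
      ≈⟨ *-interchange _ _ _ _ ⟩
    (p′ * step F (suc m) S) * (q′ * step F b R)
      ≈⟨ *-cong (tagged≋ A ∣A∣ S) (tagged≋ B ∣B∣ R) ⟨
    tagged A (suc m) S * tagged B b R ∎
    where
    b = m ℕ.+ h
    A′ = A [ x ]≔ outside
    B′ = B [ x ]≔ inside
    g : Fin k → Carrier
    g = y ∘ toℕ
    p = η m * ∏∈ A′ g
    q = η (suc b) * ∏∈ B′ g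
    p′ = η (suc m) * ∏∈ A g
    q′ = η b * ∏∈ B g
    scales : (p * q) * leads F stable m h ≈ p′ * q′
    scales = begin
      (p * q) * leads F stable m h
        ≈⟨ *-congʳ (*-interchange _ _ _ _) ⟩
      (η m * (η b * ȳ b)) * (∏∈ A′ g * ∏∈ B′ g) * leads F stable m h
        ≈⟨ trans (*-assoc _ _ _) (trans (*-congˡ (*-comm _ _)) (sym (*-assoc _ _ _))) ⟩
      (η m * (η b * ȳ b)) * leads F stable m h * (∏∈ A′ g * ∏∈ B′ g)
        ≈⟨ *-cong ηs ∏s ⟩
      (η m * ȳ m * η b) * (∏∈ A g * ∏∈ B g)
        ≈⟨ *-interchange _ _ _ _ ⟩
      p′ * q′ ∎
      where
      ηs : (η m * (η b * ȳ b)) * leads F stable m h ≈ η m * ȳ m * η b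
      ηs = trans (*-assoc _ _ _) (trans (*-congˡ (trans (*-assoc _ _ _)
        (trans (*-congˡ (ȳ-leads m h b<k)) (*-comm _ _)))) (sym (*-assoc _ _ _)))
      ∏s : ∏∈ A′ g * ∏∈ B′ g ≈ ∏∈ A g * ∏∈ B g
      ∏s = trans (*-congˡ (∏∈-insert B g x∉B)) (trans (x*yz≈y*xz _ _ _) (trans (sym (*-assoc _ _ _))
        (*-congʳ (sym (∏∈-delete A g x∈A)))))

-- Grafting a new vertex onto a diagram.

_∈ᴱ?_ : ∀ {n} (e : Fin n) es → Dec (e ∈ es)
_∈ᴱ?_ = DecMembership._∈?_ Fin._≟_

module _ {k : ℕ} {E E′ : Set} {wt : E → ℕ} {wt′ : E′ → ℕ} (f : E → E′) (wt≡ : ∀ e → wt′ (f e) ≡ wt e) where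

  private
    sums : ∀ es → sum (map wt es) ≡ sum (map wt′ (map f es))
    sums es = ≡.cong sum (≡.trans (map-cong (≡.sym ∘ wt≡) es) (map-∘ es))

  mapVertex : Vertex k wt → Vertex k wt′
  mapVertex (white ins out eq)    = white (map f ins) (f out) (≡.trans (wt≡ out) (≡.trans eq (sums ins)))
  mapVertex (black inn outs eq)   = black (f inn) (map f outs) (≡.trans (wt≡ inn) (≡.trans eq (sums outs)))
  mapVertex (coevaluation out eq) = coevaluation (f out) (≡.trans (wt≡ out) eq)
  mapVertex (evaluation inn eq)   = evaluation (f inn) (≡.trans (wt≡ inn) eq)

  incoming-map : ∀ v → incoming (mapVertex v) ≡ map f (incoming v)
  incoming-map (white _ _ _)      = ≡.refl
  incoming-map (black _ _ _)      = ≡.refl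
  incoming-map (coevaluation _ _) = ≡.refl
  incoming-map (evaluation _ _)   = ≡.refl

  outgoing-map : ∀ v → outgoing (mapVertex v) ≡ map f (outgoing v)
  outgoing-map (white _ _ _)      = ≡.refl
  outgoing-map (black _ _ _)      = ≡.refl
  outgoing-map (coevaluation _ _) = ≡.refl
  outgoing-map (evaluation _ _)   = ≡.refl

module Grafting {k : ℕ} {𝕊 : MarkedSurface} {ℳ : Space} where
  open Surface 𝕊
  open Diagrams k 𝕊 ℳ

  -- Adds an inner vertex with q new legs at p going in, and lets the edges os,
  -- legs at p of the old diagram, go out of it.
  module Graft (T : TensorDiagram) {q : ℕ} (wtₙ : Fin q → ℕ) where
    open TensorDiagram T

    Edge′ : Set
    Edge′ = Fin (q ℕ.+ #edges)

    new : Fin q → Edge′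
    new i = i ↑ˡ #edges

    old : Edge → Edge′
    old e = q ↑ʳ e

    wt′ : Edge′ → ℕ
    wt′ e = [ wtₙ , wt ]′ (splitAt q e)

    wt-old : ∀ e → wt′ (old e) ≡ wt e
    wt-old e = ≡.cong [ wtₙ , wt ]′ (Fin.splitAt-↑ʳ q #edges e)

    record Data : Set where
      field
        p        : Puncture
        1≤wtₙ    : ∀ i → 1 ≤ wtₙ i
        wtₙ≤k    : ∀ i → wtₙ i ≤ k
        pathₙ    : Fin q → Path (at (inj₁ p)) base
        os       : List Edge
        unique   : Unique os
        legs     : ∀ {e} → e ∈ os → source e ≡ inj₁ (inj₁ p)
        pathₒ    : Edge → Path base base
        ν        : Vertex k wt′
        ν-in     : incoming ν ≡ map new (allFin q)
        ν-out    : outgoing ν ≡ map old os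

    module Build (δ : Data) where
      open Data δ

      Node′ : Set
      Node′ = Fin (suc #vertices)

      -- The decision is passed explicitly, here and in the paths, so that a statement about one
      -- edge can be proved by matching on it.
      relocated : ∀ e → Dec (e ∈ os) → MarkedPoint ⊎ Node′
      relocated e (yes _) = inj₂ zero
      relocated e (no _)  = Sum.map₂ suc (source e)

      sourceOf : Fin q ⊎ Edge → MarkedPoint ⊎ Node′
      sourceOf (inj₁ _) = inj₁ (inj₁ p)
      sourceOf (inj₂ e) = relocated e (e ∈ᴱ? os)

      targetOf : Fin q ⊎ Edge → Node′
      targetOf (inj₁ _) = zero
      targetOf (inj₂ e) = suc (target e)

      shift-path : (s : MarkedPoint ⊎ Node) → Path (site s) base → Path (site (Sum.map₂ {D = Node′} suc s)) base
      shift-path (inj₁ _) π = π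
      shift-path (inj₂ _) π = π

      relocated-path : ∀ e (e∈? : Dec (e ∈ os)) → Path (site (relocated e e∈?)) base
      relocated-path e (yes _) = pathₒ e
      relocated-path e (no _)  = shift-path (source e) (path e)

      pathOf : (s : Fin q ⊎ Edge) → Path (site (sourceOf s)) base
      pathOf (inj₁ i) = pathₙ i
      pathOf (inj₂ e) = relocated-path e (e ∈ᴱ? os)

      source′ : Edge′ → MarkedPoint ⊎ Node′
      source′ e = sourceOf (splitAt q e)

      target′ : Edge′ → Node′
      target′ e = targetOf (splitAt q e)

      vertex′ : Node′ → Vertex k wt′
      vertex′ zero    = ν
      vertex′ (suc v) = mapVertex old wt-old (vertex v)

      old-injective : ∀ {e e′} → old e ≡ old e′ → e ≡ e′
      old-injective {e} {e′} = Fin.↑ʳ-injective q e e′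

      new≢old : ∀ {i e} → new i ≢ old e
      new≢old {i} {e} eq
        with () ← ≡.trans (≡.sym (Fin.splitAt-↑ˡ q i #edges)) (≡.trans (≡.cong (splitAt q) eq) (Fin.splitAt-↑ʳ q #edges e))

      new∉old : ∀ {i es} → new i ∉ map old es
      new∉old i∈ with e , _ , eq ← ∈-map⁻ old i∈ = new≢old eq

      old∉new : ∀ {e is} → old e ∉ map new is
      old∉new e∈ with i , _ , eq ← ∈-map⁻ new e∈ = new≢old (≡.sym eq)

      old∈⁻ : ∀ {e es} → old e ∈ map old es → e ∈ es
      old∈⁻ e∈ with e′ , e′∈ , eq ← ∈-map⁻ old e∈ with ≡.refl ← old-injective eq = e′∈

      -- The fields of the new diagram compute on `splitAt q e`, whereas the vertices mention e
      -- itself; hence P sees both.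
      by-cases : (P : Fin q ⊎ Edge → Edge′ → Set) → (∀ i → P (inj₁ i) (new i)) → (∀ e → P (inj₂ e) (old e)) →
                 ∀ e → P (splitAt q e) e
      by-cases P P-new P-old e = ≡.subst (P (splitAt q e)) (Fin.join-splitAt q #edges e) (go (splitAt q e))
        where
        go : ∀ s → P s (join q #edges s)
        go (inj₁ i) = P-new i
        go (inj₂ e) = P-old e

      target-new : ∀ i v → zero ≡ v ⇔ new i ∈ incoming (vertex′ v)
      target-new i zero    = mk⇔ (λ _ → ≡.subst (new i ∈_) (≡.sym ν-in) (∈-map⁺ new (∈-allFin i))) (λ _ → ≡.refl)
      target-new i (suc v) = mk⇔ (λ ()) (λ i∈ → ⊥-elim (new∉old (≡.subst (new i ∈_) (incoming-map old wt-old (vertex v)) i∈)))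

      target-old : ∀ e v → suc (target e) ≡ v ⇔ old e ∈ incoming (vertex′ v)
      target-old e zero    = mk⇔ (λ ()) (λ e∈ → ⊥-elim (old∉new (≡.subst (old e ∈_) ν-in e∈)))
      target-old e (suc v) = mk⇔
        (λ eq → ≡.subst (old e ∈_) (≡.sym (incoming-map old wt-old (vertex v)))
                  (∈-map⁺ old (Equivalence.to (target⇔ e v) (Fin.suc-injective eq))))
        (λ e∈ → ≡.cong suc (Equivalence.from (target⇔ e v)
                  (old∈⁻ (≡.subst (old e ∈_) (incoming-map old wt-old (vertex v)) e∈))))

      outgoing′ : ∀ v → ∃[ es ] outgoing (vertex′ v) ≡ map old es
      outgoing′ zero    = os , ν-out
      outgoing′ (suc v) = outgoing (vertex v) , outgoing-map old wt-old (vertex v)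

      source-new : ∀ i v → sourceOf (inj₁ i) ≡ inj₂ v ⇔ new i ∈ outgoing (vertex′ v)
      source-new i v = mk⇔ (λ ()) (λ i∈ → ⊥-elim (new∉old (≡.subst (new i ∈_) (proj₂ (outgoing′ v)) i∈)))

      map₂-suc : (s : MarkedPoint ⊎ Node) {v : Node} → Sum.map₂ suc s ≡ inj₂ (suc v) → s ≡ inj₂ v
      map₂-suc (inj₂ v) ≡.refl = ≡.refl

      map₂-suc≢zero : (s : MarkedPoint ⊎ Node) → Sum.map₂ {D = Node′} suc s ≢ inj₂ zero
      map₂-suc≢zero (inj₁ _) ()
      map₂-suc≢zero (inj₂ _) ()

      source-old : ∀ e (e∈? : Dec (e ∈ os)) v → relocated e e∈? ≡ inj₂ v ⇔ old e ∈ outgoing (vertex′ v)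
      source-old e (yes e∈) zero    = mk⇔ (λ _ → ≡.subst (old e ∈_) (≡.sym ν-out) (∈-map⁺ old e∈)) (λ _ → ≡.refl)
      source-old e (no e∉)  zero    = mk⇔ (λ eq → ⊥-elim (map₂-suc≢zero (source e) eq))
        (λ e∈ → ⊥-elim (e∉ (old∈⁻ (≡.subst (old e ∈_) ν-out e∈))))
      source-old e (yes e∈) (suc v) = mk⇔ (λ ()) impossible
        where
        -- An edge in `os` starts at a puncture, so no vertex of the given diagram can have it as an
        -- outgoing edge.
        impossible : old e ∈ outgoing (vertex′ (suc v)) → inj₂ zero ≡ inj₂ (suc v)
        impossible o∈ with () ← ≡.trans (≡.sym (legs e∈)) (Equivalence.from (source⇔ e v)
          (old∈⁻ (≡.subst (old e ∈_) (outgoing-map old wt-old (vertex v)) o∈)))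
      source-old e (no e∉)  (suc v) = mk⇔
        (λ eq → ≡.subst (old e ∈_) (≡.sym (outgoing-map old wt-old (vertex v)))
                  (∈-map⁺ old (Equivalence.to (source⇔ e v) (map₂-suc (source e) eq))))
        (λ o∈ → ≡.cong (Sum.map₂ suc) (Equivalence.from (source⇔ e v)
                  (old∈⁻ (≡.subst (old e ∈_) (outgoing-map old wt-old (vertex v)) o∈))))

      unique-in′ : ∀ v → Unique (incoming (vertex′ v))
      unique-in′ zero    = ≡.subst Unique (≡.sym ν-in)
        (Unique.map⁺ (λ {i} {j} → Fin.↑ˡ-injective #edges i j) (Unique.allFin⁺ q))
      unique-in′ (suc v) = ≡.subst Unique (≡.sym (incoming-map old wt-old (vertex v)))
        (Unique.map⁺ old-injective (unique-in v))

      unique-out′ : ∀ v → Unique (outgoing (vertex′ v))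
      unique-out′ zero    = ≡.subst Unique (≡.sym ν-out) (Unique.map⁺ old-injective unique)
      unique-out′ (suc v) = ≡.subst Unique (≡.sym (outgoing-map old wt-old (vertex v)))
        (Unique.map⁺ old-injective (unique-out v))

      _⟶′_ : Node′ → Node′ → Set
      v ⟶′ w = ∃[ e ] source′ e ≡ inj₂ v × target′ e ≡ w

      -- Acyclicity persists because the new vertex is entered by legs only: every arrow between
      -- vertices ends at an old one, so a cycle would already be a cycle of the given diagram.
      step⁻ : ∀ {v w} → v ⟶′ w → ∃[ w₀ ] w ≡ suc w₀ × (∀ v₀ → v ≡ suc v₀ → v₀ ⟶ w₀)
      step⁻ {v} {w} (e , s , t) = go (splitAt q e) s t
        where
        edge : ∀ e (e∈? : Dec (e ∈ os)) → relocated e e∈? ≡ inj₂ v → ∀ v₀ → v ≡ suc v₀ → v₀ ⟶ target e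
        edge e (yes _) ≡.refl _  ()
        edge e (no _)  eq     v₀ ≡.refl = e , map₂-suc (source e) eq , ≡.refl
        go : ∀ s → sourceOf s ≡ inj₂ v → targetOf s ≡ w → ∃[ w₀ ] w ≡ suc w₀ × (∀ v₀ → v ≡ suc v₀ → v₀ ⟶ w₀)
        go (inj₂ e) s t = target e , ≡.sym t , edge e (e ∈ᴱ? os) s

      closure⁻ : ∀ {v w} → TransClosure _⟶′_ v w →
                 ∃[ w₀ ] w ≡ suc w₀ × (∀ v₀ → v ≡ suc v₀ → TransClosure _⟶_ v₀ w₀)
      closure⁻ [ s ] with w₀ , eq , s₀ ← step⁻ s = w₀ , eq , λ v₀ v≡ → [ s₀ v₀ v≡ ]
      closure⁻ (s ∷ ss) with u₀ , u≡ , s₀ ← step⁻ s with w₀ , eq , ss₀ ← closure⁻ ss =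
        w₀ , eq , λ v₀ v≡ → s₀ v₀ v≡ ∷ ss₀ u₀ u≡

      map₂-inj₁ : (s : MarkedPoint ⊎ Node) {m : MarkedPoint} → Sum.map₂ {D = Node′} suc s ≡ inj₁ m → s ≡ inj₁ m
      map₂-inj₁ (inj₁ _) ≡.refl = ≡.refl

      relocated-inj₁ : ∀ e (e∈? : Dec (e ∈ os)) {m} → relocated e e∈? ≡ inj₁ m → e ∉ os × source e ≡ inj₁ m
      relocated-inj₁ e (no e∉) eq = e∉ , map₂-inj₁ (source e) eq

      graft : TensorDiagram
      graft = record
        { #vertices  = suc #vertices
        ; #edges     = q ℕ.+ #edges
        ; source     = source′
        ; target     = target′
        ; wt         = wt′
        ; 1≤wt       = λ e → by-cases (λ s _ → 1 ≤ [ wtₙ , wt ]′ s) 1≤wtₙ 1≤wt e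
        ; wt≤k       = λ e → by-cases (λ s _ → [ wtₙ , wt ]′ s ≤ k) wtₙ≤k wt≤k e
        ; wt-bdry    = λ ℳ≡ e b → by-cases (λ s _ → sourceOf s ≡ inj₁ (inj₂ b) → [ wtₙ , wt ]′ s ≡ 1)
                         (λ _ ()) (λ e eq → wt-bdry ℳ≡ e b (proj₂ (relocated-inj₁ e (e ∈ᴱ? os) eq))) e
        ; vertex     = vertex′
        ; target⇔    = λ e v → by-cases (λ s e → targetOf s ≡ v ⇔ e ∈ incoming (vertex′ v))
                         (λ i → target-new i v) (λ e → target-old e v) e
        ; source⇔    = λ e v → by-cases (λ s e → sourceOf s ≡ inj₂ v ⇔ e ∈ outgoing (vertex′ v))
                         (λ i → source-new i v) (λ e → source-old e (e ∈ᴱ? os) v) e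
        ; unique-in  = unique-in′
        ; unique-out = unique-out′
        ; acyclic    = λ v c → let w₀ , v≡ , c₀ = closure⁻ c in acyclic w₀ (c₀ w₀ v≡)
        ; path       = λ e → pathOf (splitAt q e)
        }

      module G = TensorDiagram graft

      source-kept : ∀ e → e ∉ os → source′ (old e) ≡ Sum.map₂ suc (source e)
      source-kept e e∉ = ≡.trans (≡.cong sourceOf (Fin.splitAt-↑ʳ q #edges e)) (go (e ∈ᴱ? os))
        where
        go : ∀ e∈? → relocated e e∈? ≡ Sum.map₂ suc (source e)
        go (yes e∈) = ⊥-elim (e∉ e∈)
        go (no _)   = ≡.refl

      source-moved : ∀ e → e ∈ os → source′ (old e) ≡ inj₂ zero
      source-moved e e∈ = ≡.trans (≡.cong sourceOf (Fin.splitAt-↑ʳ q #edges e)) (go (e ∈ᴱ? os))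
        where
        go : ∀ e∈? → relocated e e∈? ≡ inj₂ zero
        go (yes _)  = ≡.refl
        go (no e∉) = ⊥-elim (e∉ e∈)

      source-added : ∀ i → source′ (new i) ≡ inj₁ (inj₁ p)
      source-added i = ≡.cong sourceOf (Fin.splitAt-↑ˡ q i #edges)

-- Sums over labellings and products with a few distinguished factors.

infixl 9 _[_≔_]
_[_≔_] : ∀ {a} {A : Set a} {n} → (Fin n → A) → Fin n → A → Fin n → A
σ [ i ≔ x ] = updateAt σ i (const x)

selections-∈ : ∀ {n} {A : Set} (L : Fin n → List A) {σ} → σ ∈ selections L → ∀ i → σ i ∈ L i
selections-∈ {suc n} L σ∈ i with ∈-cartesianProductWith⁻ Vector._∷_ (L zero) (selections (L ∘ suc)) σ∈
selections-∈ {suc n} L σ∈ zero    | x , σ , x∈ , σ′∈ , ≡.refl = x∈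
selections-∈ {suc n} L σ∈ (suc i) | x , σ , x∈ , σ′∈ , ≡.refl = selections-∈ (L ∘ suc) σ′∈ i

module Selections {c ℓ} (R : CommutativeRing c ℓ) where
  open Sums R

  Extensional : ∀ {n} {A : Set} → ((Fin n → A) → Carrier) → Set ℓ
  Extensional {n} {A} f = ∀ {σ σ′ : Fin n → A} → (∀ i → σ i ≡ σ′ i) → f σ ≈ f σ′

  ∑-selections-suc : ∀ {n} {A : Set} (L : Fin (suc n) → List A) (f : (Fin (suc n) → A) → Carrier) →
                     ∑ (selections L) f ≈ ∑ (L zero) (λ x → ∑ (selections (L ∘ suc)) (λ σ → f (x Vector.∷ σ)))
  ∑-selections-suc L f = ∑-product Vector._∷_ (L zero) (selections (L ∘ suc)) f

  -- Summing over the i-th value innermost reduces the comparison to that coordinate. Extensionality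
  -- is required because updating and consing give labellings that agree only pointwise; x₀ fills
  -- the coordinate about to be overwritten.
  ∑-selections-cong-at : ∀ {n} {A : Set} → A → (L : Fin n → List A) (i : Fin n) {f g : (Fin n → A) → Carrier} →
    Extensional f → Extensional g →
    (∀ σ → ∑ (L i) (λ x → f (σ [ i ≔ x ])) ≈ ∑ (L i) (λ x → g (σ [ i ≔ x ]))) →
    ∑ (selections L) f ≈ ∑ (selections L) g
  ∑-selections-cong-at {suc n} x₀ L zero {f} {g} f-ext g-ext eq = begin
    ∑ (selections L) f                                                      ≈⟨ split f ⟩
    ∑ (selections (L ∘ suc)) (λ σ → ∑ (L zero) (λ x → f (x Vector.∷ σ)))
      ≈⟨ ∑-cong (selections (L ∘ suc)) (λ σ → begin
           ∑ (L zero) (λ x → f (x Vector.∷ σ))                 ≈⟨ ∑-cong (L zero) (λ x → f-ext (at x σ)) ⟩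
           ∑ (L zero) (λ x → f ((x₀ Vector.∷ σ) [ zero ≔ x ])) ≈⟨ eq (x₀ Vector.∷ σ) ⟩
           ∑ (L zero) (λ x → g ((x₀ Vector.∷ σ) [ zero ≔ x ])) ≈⟨ ∑-cong (L zero) (λ x → g-ext (at x σ)) ⟨
           ∑ (L zero) (λ x → g (x Vector.∷ σ))                 ∎) ⟩
    ∑ (selections (L ∘ suc)) (λ σ → ∑ (L zero) (λ x → g (x Vector.∷ σ)))    ≈⟨ split g ⟨
    ∑ (selections L) g                                                      ∎
    where
    at : ∀ x σ j → (x Vector.∷ σ) j ≡ ((x₀ Vector.∷ σ) [ zero ≔ x ]) j
    at x σ zero    = ≡.refl
    at x σ (suc j) = ≡.refl
    split : ∀ f → ∑ (selections L) f ≈ ∑ (selections (L ∘ suc)) (λ σ → ∑ (L zero) (λ x → f (x Vector.∷ σ)))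
    split f = trans (∑-selections-suc L f) (∑-swap (L zero) (selections (L ∘ suc)) _)
  ∑-selections-cong-at {suc n} x₀ L (suc i) {f} {g} f-ext g-ext eq = begin
    ∑ (selections L) f                                                      ≈⟨ ∑-selections-suc L f ⟩
    ∑ (L zero) (λ x → ∑ (selections (L ∘ suc)) (λ σ → f (x Vector.∷ σ)))
      ≈⟨ ∑-cong (L zero) (λ x → ∑-selections-cong-at x₀ (L ∘ suc) i (f-ext ∘ cons x) (g-ext ∘ cons x) (λ σ → begin
           ∑ (L (suc i)) (λ y → f (x Vector.∷ σ [ i ≔ y ]))    ≈⟨ ∑-cong (L (suc i)) (λ y → f-ext (at x σ y)) ⟩
           ∑ (L (suc i)) (λ y → f ((x Vector.∷ σ) [ suc i ≔ y ])) ≈⟨ eq (x Vector.∷ σ) ⟩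
           ∑ (L (suc i)) (λ y → g ((x Vector.∷ σ) [ suc i ≔ y ])) ≈⟨ ∑-cong (L (suc i)) (λ y → g-ext (at x σ y)) ⟨
           ∑ (L (suc i)) (λ y → g (x Vector.∷ σ [ i ≔ y ]))    ∎)) ⟩
    ∑ (L zero) (λ x → ∑ (selections (L ∘ suc)) (λ σ → g (x Vector.∷ σ)))    ≈⟨ ∑-selections-suc L g ⟨
    ∑ (selections L) g                                                      ∎
    where
    cons : ∀ x {σ σ′} → (∀ j → σ j ≡ σ′ j) → ∀ j → (x Vector.∷ σ) j ≡ (x Vector.∷ σ′) j
    cons x eq zero    = ≡.refl
    cons x eq (suc j) = eq j
    at : ∀ x σ y j → (x Vector.∷ σ [ i ≔ y ]) j ≡ ((x Vector.∷ σ) [ suc i ≔ y ]) j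
    at x σ y zero    = ≡.refl
    at x σ y (suc j) = ≡.refl

  ∏-factor : ∀ {n} (i : Fin n) (F : Fin n → Carrier) → ∏ (allFin n) F ≈ F i * ∏ (allFin n) (F [ i ≔ 1# ])
  ∏-factor {suc n} zero    F = trans (∏-suc n F)
    (*-congˡ (sym (trans (∏-suc n (F [ zero ≔ 1# ])) (*-identityˡ _))))
  ∏-factor {suc n} (suc i) F = trans (∏-suc n F) (trans (*-congˡ (∏-factor i (F ∘ suc)))
    (trans (x*yz≈y*xz _ _ _) (*-congˡ (sym (∏-suc n (F [ suc i ≔ 1# ]))))))

  ∏-allFin-++ : ∀ q {n} (F : Fin (q ℕ.+ n) → Carrier) →
                ∏ (allFin (q ℕ.+ n)) F ≈ ∏ (allFin q) (λ i → F (i ↑ˡ n)) * ∏ (allFin n) (λ i → F (q ↑ʳ i))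
  ∏-allFin-++ zero    F = sym (*-identityˡ _)
  ∏-allFin-++ (suc q) {n} F = trans (∏-suc (q ℕ.+ n) F) (trans (*-congˡ (∏-allFin-++ q (F ∘ suc)))
    (trans (sym (*-assoc _ _ _)) (*-congʳ (sym (∏-suc q (λ i → F (i ↑ˡ n)))))))

  ∑-selections-++ : ∀ q {n} {A : Set} (L : Fin (q ℕ.+ n) → List A) {f : (Fin (q ℕ.+ n) → A) → Carrier} → Extensional f →
                    ∑ (selections L) f ≈ ∑ (selections (λ i → L (i ↑ˡ n))) (λ ρ →
                                         ∑ (selections (λ i → L (q ↑ʳ i))) (λ σ → f (ρ Vector.++ σ)))
  ∑-selections-++ zero    L f-ext = sym (+-identityʳ _)
  ∑-selections-++ (suc q) {n} L {f} f-ext = begin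
    ∑ (selections L) f
      ≈⟨ ∑-selections-suc L f ⟩
    ∑ (L zero) (λ x → ∑ (selections (L ∘ suc)) (λ σ → f (x Vector.∷ σ)))
      ≈⟨ ∑-cong (L zero) (λ x → trans (∑-selections-++ q (L ∘ suc) (λ eq → f-ext λ { zero → ≡.refl ; (suc i) → eq i }))
           (∑-cong (selections (λ i → L (suc (i ↑ˡ n)))) (λ ρ → ∑-cong (selections (λ i → L (suc q ↑ʳ i)))
             (λ σ → f-ext (cons-++ x ρ σ))))) ⟩
    ∑ (L zero) (λ x → ∑ (selections (λ i → L (suc (i ↑ˡ n)))) (λ ρ →
      ∑ (selections (λ i → L (suc q ↑ʳ i))) (λ σ → f ((x Vector.∷ ρ) Vector.++ σ))))
      ≈⟨ ∑-selections-suc (λ i → L (i ↑ˡ n)) _ ⟨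
    ∑ (selections (λ i → L (i ↑ˡ n))) (λ ρ → ∑ (selections (λ i → L (suc q ↑ʳ i))) (λ σ → f (ρ Vector.++ σ))) ∎
    where
    cons-++ : ∀ {A : Set} x (ρ : Fin q → A) (σ : Fin n → A) i → (x Vector.∷ (ρ Vector.++ σ)) i ≡ ((x Vector.∷ ρ) Vector.++ σ) i
    cons-++ x ρ σ zero    = ≡.refl
    cons-++ x ρ σ (suc i) with splitAt q i
    ... | inj₁ _ = ≡.refl
    ... | inj₂ _ = ≡.refl

  ∏-rest : ∀ {n} (i j : Fin n) (F : Fin n → Carrier) → Carrier
  ∏-rest {n} i j F = ∏ (allFin n) (F [ i ≔ 1# ] [ j ≔ 1# ])

  -- The cofactor is formed from a fixed F₀, so that all members of a family differing only at i and
  -- j share it.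
  ∏-factor₂ : ∀ {n} {i j : Fin n} → i ≢ j → (F F₀ : Fin n → Carrier) → (∀ l → l ≢ i → l ≢ j → F l ≈ F₀ l) →
              ∏ (allFin n) F ≈ F i * (F j * ∏-rest i j F₀)
  ∏-factor₂ {n} {i} {j} i≢j F F₀ eq = trans (∏-factor i F) (*-congˡ (trans (∏-factor j (F [ i ≔ 1# ]))
    (*-cong (reflexive (updateAt-minimal j i F (i≢j ∘ ≡.sym))) (∏-cong (allFin n) agree))))
    where
    agree : ∀ l → (F [ i ≔ 1# ] [ j ≔ 1# ]) l ≈ (F₀ [ i ≔ 1# ] [ j ≔ 1# ]) l
    agree l with l Fin.≟ j
    ... | yes ≡.refl = reflexive (≡.trans (updateAt-updates j (F [ i ≔ 1# ])) (≡.sym (updateAt-updates j (F₀ [ i ≔ 1# ]))))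
    ... | no l≢j = trans (reflexive (updateAt-minimal l j (F [ i ≔ 1# ]) l≢j))
      (trans (without-j (l Fin.≟ i)) (reflexive (≡.sym (updateAt-minimal l j (F₀ [ i ≔ 1# ]) l≢j))))
      where
      without-j : Dec (l ≡ i) → (F [ i ≔ 1# ]) l ≈ (F₀ [ i ≔ 1# ]) l
      without-j (yes ≡.refl) = reflexive (≡.trans (updateAt-updates i F) (≡.sym (updateAt-updates i F₀)))
      without-j (no l≢i) = trans (reflexive (updateAt-minimal l i F l≢i))
        (trans (eq l l≢i l≢j) (reflexive (≡.sym (updateAt-minimal l i F₀ l≢i))))

  ∏-factor₁ : ∀ {n} (i : Fin n) (F F₀ : Fin n → Carrier) → (∀ l → l ≢ i → F l ≈ F₀ l) →
              ∏ (allFin n) F ≈ F i * ∏ (allFin n) (F₀ [ i ≔ 1# ])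
  ∏-factor₁ {n} i F F₀ eq = trans (∏-factor i F) (*-congˡ (∏-cong (allFin n) agree))
    where
    agree : ∀ l → (F [ i ≔ 1# ]) l ≈ (F₀ [ i ≔ 1# ]) l
    agree l with l Fin.≟ i
    ... | yes ≡.refl = reflexive (≡.trans (updateAt-updates i F) (≡.sym (updateAt-updates i F₀)))
    ... | no l≢i = trans (reflexive (updateAt-minimal l i F l≢i))
        (trans (eq l l≢i) (reflexive (≡.sym (updateAt-minimal l i F₀ l≢i))))

-- Tensor networks with arbitrary weights on the edges.

module Contraction {c ℓ₁ ℓ₂} (𝕂 : HeytingField c ℓ₁ ℓ₂) (k : ℕ) (𝕊 : MarkedSurface) (ℳ : Space) where
  open Flags 𝕂 k public
  open Sums ring public hiding (ring)
  open Selections ring public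
  open Surface 𝕊
  open Diagrams k 𝕊 ℳ

  size : ℕ → List (Subset k)
  size = subsetsOfSize k

  size-∈ : ∀ {a S} → S ∈ size a → ∣ S ∣ ≡ a
  size-∈ {a} S∈ = proj₂ (∈-filter⁻ (λ S → ∣ S ∣ ℕ.≟ a) {xs = allSubsets k} S∈)

  entry : ∀ {E : Set} {wt : E → ℕ} → (E → Subset k) → (E → Subset k) → Vertex k wt → Carrier
  entry σ τ (white ins out _)    = E.⋀ (map (E.basis ∘ τ) ins) (σ out)
  entry σ τ (black inn outs _)   = E.⋀ (map (E.basis ∘ σ) outs) (τ inn)
  entry σ τ (coevaluation out _) = E.ξ (σ out)
  entry σ τ (evaluation inn _)   = E.ξ (τ inn)

  entry-cong : ∀ {E : Set} {wt : E → ℕ} {σ σ′ τ τ′ : E → Subset k} (v : Vertex k wt) →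
               (∀ e → e ∈ outgoing v → σ e ≡ σ′ e) → (∀ e → τ e ≡ τ′ e) → entry σ τ v ≡ entry σ′ τ′ v
  entry-cong (white ins out _)    p q = ≡.cong₂ E.⋀ (map-cong (λ e → ≡.cong E.basis (q e)) ins) (p out (here ≡.refl))
  entry-cong (black inn outs _)   p q = ≡.cong₂ E.⋀
    (map-cong-local (All.tabulate (λ {e} e∈ → ≡.cong E.basis (p e e∈)))) (q inn)
  entry-cong (coevaluation out _) p q = ≡.cong E.ξ (p out (here ≡.refl))
  entry-cong (evaluation inn _)   p q = ≡.cong E.ξ (q inn)

  entry-map : ∀ {E E′ : Set} {wt : E → ℕ} {wt′ : E′ → ℕ} (f : E → E′) (wt≡ : ∀ e → wt′ (f e) ≡ wt e)
              (σ τ : E′ → Subset k) v → entry {wt = wt′} σ τ (mapVertex {wt = wt} f wt≡ v) ≡ entry (σ ∘ f) (τ ∘ f) v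
  entry-map f wt≡ σ τ (white ins out _)    = ≡.cong (λ l → E.⋀ l (σ (f out))) (≡.sym (map-∘ ins))
  entry-map f wt≡ σ τ (black inn outs _)   = ≡.cong (λ l → E.⋀ l (τ (f inn))) (≡.sym (map-∘ outs))
  entry-map f wt≡ σ τ (coevaluation _ _)   = ≡.refl
  entry-map f wt≡ σ τ (evaluation _ _)     = ≡.refl

  module _ (T : TensorDiagram) where
    open TensorDiagram T

    -- One number per pair of labels at source and target: transport and source tensor in one. Being
    -- arbitrary, the weights also cover the intermediate networks that are no diagram invariants.
    Weights : Set c
    Weights = Edge → Subset k → Subset k → Carrier

    vertexProduct : (Edge → Subset k) → (Edge → Subset k) → Carrier
    vertexProduct σ τ = ∏ (allFin #vertices) (λ v → entry σ τ (vertex v))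

    labellings : List (Edge → Subset k)
    labellings = selections (λ e → size (wt e))

    ∑∑ : ((Edge → Subset k) → (Edge → Subset k) → Carrier) → Carrier
    ∑∑ P = ∑ labellings (λ σ → ∑ labellings (λ τ → vertexProduct σ τ * P σ τ))

    edgeProduct : Weights → (Edge → Subset k) → (Edge → Subset k) → Carrier
    edgeProduct g σ τ = ∏ (allFin #edges) (λ e → g e (σ e) (τ e))

    network : Weights → Carrier
    network g = ∑∑ (edgeProduct g)

    -- The sizes of the labels at the sources are passed on since at a black vertex the label of an
    -- edge of weight 1 has to be read as a vector.
    ∑∑-cong : {P P′ : (Edge → Subset k) → (Edge → Subset k) → Carrier} →
              (∀ σ τ → (∀ e → ∣ σ e ∣ ≡ wt e) → P σ τ ≈ P′ σ τ) → ∑∑ P ≈ ∑∑ P′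
    ∑∑-cong eq = ∑-cong-∈ labellings (λ σ σ∈ → ∑-cong labellings (λ τ →
      *-congˡ (eq σ τ (λ e → size-∈ (selections-∈ _ σ∈ e)))))

    ∑∑-linear : ∀ {a} {A : Set a} (xs : List A) (s : A → Carrier) (P : A → (Edge → Subset k) → (Edge → Subset k) → Carrier) →
                ∑∑ (λ σ τ → ∑ xs (λ x → s x * P x σ τ)) ≈ ∑ xs (λ x → s x * ∑∑ (P x))
    ∑∑-linear xs s P = begin
      ∑ labellings (λ σ → ∑ labellings (λ τ → vertexProduct σ τ * ∑ xs (λ x → s x * P x σ τ)))
        ≈⟨ ∑-cong labellings (λ σ → ∑-cong labellings (λ τ → trans (∑-*ˡ xs _ _)
             (∑-cong xs (λ x → x*yz≈y*xz _ _ _)))) ⟩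
      ∑ labellings (λ σ → ∑ labellings (λ τ → ∑ xs (λ x → s x * (vertexProduct σ τ * P x σ τ))))
        ≈⟨ ∑-cong labellings (λ σ → trans (∑-swap labellings xs _)
             (∑-cong xs (λ x → sym (∑-*ˡ labellings (s x) _)))) ⟩
      ∑ labellings (λ σ → ∑ xs (λ x → s x * ∑ labellings (λ τ → vertexProduct σ τ * P x σ τ)))
        ≈⟨ trans (∑-swap labellings xs _) (∑-cong xs (λ x → sym (∑-*ˡ labellings (s x) _))) ⟩
      ∑ xs (λ x → s x * ∑∑ (P x)) ∎

    ∑∑-sum : ∀ {a} {A : Set a} (xs : List A) (P : A → (Edge → Subset k) → (Edge → Subset k) → Carrier) →
             ∑∑ (λ σ τ → ∑ xs (λ x → P x σ τ)) ≈ ∑ xs (λ x → ∑∑ (P x))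
    ∑∑-sum xs P = trans (∑∑-cong (λ σ τ _ → ∑-cong xs (λ x → sym (*-identityˡ _))))
      (trans (∑∑-linear xs (λ _ → 1#) P) (∑-cong xs (λ x → *-identityˡ _)))

    edgeProduct-absorb : ∀ e (X : Subset k → Carrier) (g : Weights) σ τ →
                         X (σ e) * edgeProduct g σ τ ≈ edgeProduct (g [ e ≔ (λ s t → X s * g e s t) ]) σ τ
    edgeProduct-absorb e X g σ τ = begin
      X (σ e) * edgeProduct g σ τ
        ≈⟨ trans (*-congˡ (∏-factor e _)) (sym (*-assoc _ _ _)) ⟩
      X (σ e) * g e (σ e) (τ e) * ∏ (allFin #edges) ((λ e′ → g e′ (σ e′) (τ e′)) [ e ≔ 1# ])
        ≈⟨ trans (∏-factor₁ e _ (λ e′ → g e′ (σ e′) (τ e′)) (λ e′ e′≢ →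
             reflexive (≡.cong (λ h → h (σ e′) (τ e′)) (updateAt-minimal e′ e g e′≢))))
             (*-congʳ (reflexive (≡.cong (λ h → h (σ e) (τ e)) (updateAt-updates e g)))) ⟨
      edgeProduct (g [ e ≔ (λ s t → X s * g e s t) ]) σ τ ∎

    -- A network is linear in the weights of each of two distinct edges, so an identity between sums
    -- of products of these two weights carries over to the networks.
    network-bilinear : ∀ {a} {A : Set a} (xs : List A) (s : A → Carrier) (g : A → Weights) (g₀ : Weights) {i j : Edge} → i ≢ j →
      (∀ x e → e ≢ i → e ≢ j → ∀ s t → g x e s t ≈ g₀ e s t) →
      (∀ σᵢ τᵢ σⱼ τⱼ → ∑ xs (λ x → s x * (g x i σᵢ τᵢ * g x j σⱼ τⱼ)) ≈ g₀ i σᵢ τᵢ * g₀ j σⱼ τⱼ) →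
      ∑ xs (λ x → s x * network (g x)) ≈ network g₀
    network-bilinear xs s g g₀ {i} {j} i≢j others eq = trans (sym (∑∑-linear xs s (edgeProduct ∘ g)))
      (∑∑-cong λ σ τ _ → begin
        ∑ xs (λ x → s x * edgeProduct (g x) σ τ)
          ≈⟨ ∑-cong xs (λ x → trans (*-congˡ (trans (∏-factor₂ i≢j (λ e → g x e (σ e) (τ e)) (λ e → g₀ e (σ e) (τ e))
               (λ e e≢i e≢j → others x e e≢i e≢j _ _)) (sym (*-assoc _ _ _)))) (sym (*-assoc _ _ _))) ⟩
        ∑ xs (λ x → s x * (g x i (σ i) (τ i) * g x j (σ j) (τ j)) * ∏-rest i j (λ e → g₀ e (σ e) (τ e)))
          ≈⟨ trans (sym (∑-*ʳ xs _ _)) (*-congʳ (eq _ _ _ _)) ⟩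
        g₀ i (σ i) (τ i) * g₀ j (σ j) (τ j) * ∏-rest i j (λ e → g₀ e (σ e) (τ e))
          ≈⟨ trans (*-assoc _ _ _) (sym (∏-factor₂ i≢j _ _ (λ _ _ _ → refl))) ⟩
        edgeProduct g₀ σ τ ∎)

    -- No vertex entry involves the label at the source of a leg.
    network-leg : ∀ {e m} → source e ≡ inj₁ m → {g g′ : Weights} →
      (∀ e′ → e′ ≢ e → ∀ s t → g e′ s t ≈ g′ e′ s t) →
      (∀ t → ∑ (size (wt e)) (λ s → g e s t) ≈ ∑ (size (wt e)) (λ s → g′ e s t)) →
      network g ≈ network g′
    network-leg {e} {m} leg {g} {g′} others eq = trans (∑-swap labellings labellings _)
      (trans (∑-cong labellings (λ τ → ∑-selections-cong-at ⊥ (λ e → size (wt e)) e (ext τ g) (ext τ g′) (sums τ)))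
      (∑-swap labellings labellings _))
      where
      summand : Weights → (Edge → Subset k) → (Edge → Subset k) → Carrier
      summand g τ σ = vertexProduct σ τ * edgeProduct g σ τ
      ext : ∀ τ g → Extensional (summand g τ)
      ext τ g σ≡ = *-cong
        (∏-cong (allFin #vertices) (λ v → reflexive (entry-cong (vertex v) (λ e _ → σ≡ e) (λ _ → ≡.refl))))
        (∏-cong (allFin #edges) (λ e → reflexive (≡.cong (λ s → g e s (τ e)) (σ≡ e))))
      not-outgoing : ∀ v → e ∉ outgoing (vertex v)
      not-outgoing v e∈ with () ← ≡.trans (≡.sym leg) (Equivalence.from (source⇔ e v) e∈)
      rest : (τ σ : Edge → Subset k) → Carrier
      rest τ σ = ∏ (allFin #edges) ((λ e → g e (σ e) (τ e)) [ e ≔ 1# ])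
      expand : ∀ τ σ (h : Weights) → (∀ e′ → e′ ≢ e → ∀ s t → h e′ s t ≈ g e′ s t) →
               ∑ (size (wt e)) (λ s → summand h τ (σ [ e ≔ s ])) ≈
               vertexProduct σ τ * (∑ (size (wt e)) (λ s → h e s (τ e)) * rest τ σ)
      expand τ σ h h≈ = begin
        ∑ (size (wt e)) (λ s → summand h τ (σ [ e ≔ s ]))
          ≈⟨ ∑-cong (size (wt e)) (λ s → *-cong
               (∏-cong (allFin #vertices) (λ v → reflexive (entry-cong (vertex v)
                 (λ e′ e′∈ → updateAt-minimal e′ e σ (λ { ≡.refl → not-outgoing v e′∈ })) (λ _ → ≡.refl))))
               (trans (∏-factor₁ e _ (λ e′ → g e′ (σ e′) (τ e′)) (λ e′ e′≢ → trans
                   (reflexive (≡.cong (λ s → h e′ s (τ e′)) (updateAt-minimal e′ e σ e′≢))) (h≈ e′ e′≢ _ _)))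
                 (*-congʳ (reflexive (≡.cong (λ s → h e s (τ e)) (updateAt-updates e σ)))))) ⟩
        ∑ (size (wt e)) (λ s → vertexProduct σ τ * (h e s (τ e) * rest τ σ))
          ≈⟨ trans (*-congˡ (∑-*ʳ (size (wt e)) _ _)) (∑-*ˡ (size (wt e)) _ _) ⟨
        vertexProduct σ τ * (∑ (size (wt e)) (λ s → h e s (τ e)) * rest τ σ) ∎
      sums : ∀ τ σ → ∑ (size (wt e)) (λ s → summand g τ (σ [ e ≔ s ])) ≈ ∑ (size (wt e)) (λ s → summand g′ τ (σ [ e ≔ s ]))
      sums τ σ = trans (expand τ σ g (λ _ _ _ _ → refl)) (trans (*-congˡ (*-congʳ (eq (τ e))))
        (sym (expand τ σ g′ (λ e′ e′≢ s t → sym (others e′ e′≢ s t)))))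

selections-cong : ∀ {n} {A : Set} {L L′ : Fin n → List A} → (∀ i → L i ≡ L′ i) → selections L ≡ selections L′
selections-cong {zero}  eq = ≡.refl
selections-cong {suc n} eq = ≡.cong₂ (cartesianProductWith Vector._∷_) (eq zero) (selections-cong (eq ∘ suc))

-- Linear maps on tensors and summation over labels of fixed size.

module LinearMaps {c ℓ₁ ℓ₂} (𝕂 : HeytingField c ℓ₁ ℓ₂) (k : ℕ) where
  open Flags 𝕂 k
  open Sums ring hiding (ring)
  open SubsetAlgebra ring
  open E using (V; Matrix; _$ᵥ_; _·_; scalar)

  Φ-degree : ∀ {a} g {x} → SupportedOn (_≡ a) x → SupportedOn (_≡ a) (Φ (g ᵀ) x)
  Φ-degree {a} g = Φ-support {P = _≡ a} (g ᵀ)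

  ∙-degree : ∀ {a b} {x y : Λ k} → SupportedOn (_≡ a) x → SupportedOn (_≡ b) y → SupportedOn (_≡ a ℕ.+ b) (x ∙ y)
  ∙-degree {a} {b} {x} {y} = ∙-support {P = _≡ a} {_≡ b} {_≡ a ℕ.+ b} {x} {y} (ℕ._≟ a) (λ { .a .b ≡.refl ≡.refl → ≡.refl })

  D-degree : ∀ {a} α {x : Λ k} → SupportedOn (_≡ suc a) x → SupportedOn (_≡ a) (D α x)
  D-degree {a} α {x} = D-support {P = _≡ suc a} {_≡ a} α {x} (λ j → ℕ.suc-injective)

  scalar-δ : ∀ {n} (i j : Fin n) → (if does (i Fin.≟ j) then 1# else 0#) ≈ δ j i
  scalar-δ {suc n} zero zero = sym (indicator-⊥⊥ n)
  scalar-δ zero    (suc j) = refl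
  scalar-δ (suc i) zero    = refl
  scalar-δ (suc i) (suc j) = scalar-δ i j

  scalar-$ᵥ : ∀ s v i → (scalar s $ᵥ v) i ≈ s * v i
  scalar-$ᵥ s v i = go i v
    where
    go : ∀ {n} (i : Fin n) (v : Fin n → Carrier) →
         ∑ (allFin n) (λ j → (if does (i Fin.≟ j) then s else 0#) * v j) ≈ s * v i
    go {suc n} zero    v = trans (∑-suc n _) (trans (+-congˡ (∑-0 (allFin n) (λ j → zeroˡ _))) (+-identityʳ _))
    go {suc n} (suc i) v = trans (∑-suc n _) (trans (+-cong (zeroˡ _) (go i (v ∘ suc))) (+-identityˡ _))

  $ᵥ-· : ∀ g h v i → ((g · h) $ᵥ v) i ≈ (g $ᵥ (h $ᵥ v)) i
  $ᵥ-· g h v i = begin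
    ∑ (allFin k) (λ j → ∑ (allFin k) (λ l → g i l * h l j) * v j)
      ≈⟨ ∑-cong (allFin k) (λ j → trans (∑-*ʳ (allFin k) _ _) (∑-cong (allFin k) (λ l → *-assoc _ _ _))) ⟩
    ∑ (allFin k) (λ j → ∑ (allFin k) (λ l → g i l * (h l j * v j)))
      ≈⟨ trans (∑-swap (allFin k) (allFin k) _) (∑-cong (allFin k) (λ l → sym (∑-*ˡ (allFin k) _ _))) ⟩
    ∑ (allFin k) (λ l → g i l * (h $ᵥ v) l) ∎

  $ᵥ-δ : ∀ g j i → (g $ᵥ δ j) i ≈ g i j
  $ᵥ-δ g j i = trans (∑-cong (allFin k) (λ l → *-comm _ _)) (∑-δ j (g i))

  -- Induction on n: the basis vectors other than the first are those of the smaller space with a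
  -- zero in front, and `Φ` commutes with this padding.
  Φ-δ : ∀ {n} (x : Λ n) → Φ δ x ≋ x
  Φ-δ x []            = *-identityʳ _
  Φ-δ {suc n} x S = trans (+-cong (∙-congˡ (embed-δ (inn x)) S) (embed-δ (out x) S)) (go S)
    where
    pad : ∀ {n} → Λ n → Λ (suc n)
    pad y (inside ∷ S)  = 0#
    pad y (outside ∷ S) = y S
    embed : ∀ {m n} (h : Fin m → Fin n → Carrier) (y : Λ m) → Φ (λ j → 0# Vector.∷ h j) y ≋ pad (Φ h y)
    embed {zero}  h y (inside ∷ S)  = zeroʳ _
    embed {zero}  h y (outside ∷ S) = refl
    embed {suc m} h y (inside ∷ S)  = trans (+-cong (trans (∙-congˡ {x = vec (0# Vector.∷ h zero)} (embed (h ∘ suc) (inn y)) (inside ∷ S))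
      (trans (+-cong (trans (∙-scalarˡ 0# _ S) (zeroˡ _)) (∙-𝟎ʳ _ S)) (+-identityˡ _)))
      (embed (h ∘ suc) (out y) (inside ∷ S))) (+-identityˡ _)
    embed {suc m} h y (outside ∷ S) = +-cong (∙-congˡ {x = vec (0# Vector.∷ h zero)} (embed (h ∘ suc) (inn y)) (outside ∷ S))
      (embed (h ∘ suc) (out y) (outside ∷ S))
    embed-δ : ∀ y → Φ (δ ∘ suc) y ≋ pad (Φ δ y)
    embed-δ y S = trans (Φ-cong {h = δ ∘ suc} {λ j → 0# Vector.∷ δ j} {y} (λ { j zero → refl ; j (suc i) → refl }) (λ _ → refl) S) (embed δ y S)
    go : ∀ S → (vec (δ zero) ∙ pad (Φ δ (inn x))) S + pad (Φ δ (out x)) S ≈ x S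
    go (inside ∷ S)  = trans (+-identityʳ _) (trans (+-cong
      (trans (∙-scalarˡ _ _ S) (trans (*-congʳ (indicator-⊥⊥ n)) (*-identityˡ _))) (∙-𝟎ʳ _ S))
      (trans (+-identityʳ _) (Φ-δ (inn x) S)))
    go (outside ∷ S) = trans (+-cong (trans (∙-congʳ (vec-0 {n}) S) (∙-𝟎ˡ _ S)) (Φ-δ (out x) S)) (+-identityˡ _)

  Φ-scalar : (x : Λ k) → Φ (scalar 1# ᵀ) x ≋ x
  Φ-scalar x S = trans (Φ-cong (λ j i → scalar-δ i j) (λ _ → refl) S) (Φ-δ x S)

  columns-1 : ∀ s t → E.columns (scalar 1#) s t ≈ indicator s t
  columns-1 s t = trans (columns-Φ (scalar 1#) s t) (Φ-scalar (indicator s) t)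

  -- Labels have the size of the edge weight; restricting the sum to them loses nothing, as x lives
  -- in that degree.
  columns-sum : ∀ g {a x} → SupportedOn (_≡ a) x → ∀ t →
                ∑ (subsetsOfSize k a) (λ s → E.columns g s t * x s) ≈ Φ (g ᵀ) x t
  columns-sum g {a} {x} supp t = trans
    (∑-support (λ S → ∣ S ∣ ℕ.≟ a) (allSubsets k) (λ s s≢ → trans (*-congˡ (supp s s≢)) (zeroʳ _)))
    (trans (∑-cong (allSubsets k) (λ s → *-comm _ _)) ($-Φ g x t))

  indicator-sum : ∀ {a x} → SupportedOn (_≡ a) x → ∀ t →
                  ∑ (subsetsOfSize k a) (λ s → indicator s t * x s) ≈ x t
  indicator-sum {a} {x} supp t = trans
    (∑-support (λ S → ∣ S ∣ ℕ.≟ a) (allSubsets k) (λ s s≢ → trans (*-congˡ (supp s s≢)) (zeroʳ _)))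
    (trans (∑-cong (allSubsets k) (λ s → *-congʳ (indicator-sym s t))) (∑-indicator t x))

  vec-coordinates : ∀ w S → vec w S ≈ ∑ (allFin k) (λ i → w i * indicator ⁅ i ⁆ S)
  vec-coordinates w S = sym (ι-vec w S)

  -- Splitting a vector off the transported tensor is the same as splitting first and transporting
  -- both parts. The covector that reads off the label J is pulled back by `D-Φ`.
  split-equivariant : ∀ g y R J →
    ∑ (allFin k) (λ i → indicator ⁅ i ⁆ J * D (δ i) (Φ (g ᵀ) y) R) ≈
    ∑ (allFin k) (λ j → Φ (g ᵀ) (D (δ j) y) R * vec (g $ᵥ δ j) J)
  split-equivariant g y R J = begin
    ∑ (allFin k) (λ i → α i * D (δ i) (Φ (g ᵀ) y) R)    ≈⟨ D-expand α (Φ (g ᵀ) y) R ⟨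
    D α (Φ (g ᵀ) y) R                                   ≈⟨ D-Φ (g ᵀ) α y R ⟩
    Φ (g ᵀ) (D β y) R                                   ≈⟨ $-Φ g (D β y) R ⟨
    (g E.$ D β y) R
      ≈⟨ ∑-cong (allSubsets k) (λ T → trans (*-congʳ (D-expand β y T)) (trans (∑-*ʳ (allFin k) _ _)
           (∑-cong (allFin k) (λ j → *-assoc _ _ _)))) ⟩
    ∑ (allSubsets k) (λ T → ∑ (allFin k) (λ j → β j * (D (δ j) y T * E.columns g T R)))
      ≈⟨ trans (∑-swap (allSubsets k) (allFin k) _) (∑-cong (allFin k) (λ j → sym (∑-*ˡ (allSubsets k) _ _))) ⟩
    ∑ (allFin k) (λ j → β j * (g E.$ D (δ j) y) R)
      ≈⟨ ∑-cong (allFin k) (λ j → trans (*-comm _ _) (*-cong ($-Φ g _ R) (β≈ j))) ⟩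
    ∑ (allFin k) (λ j → Φ (g ᵀ) (D (δ j) y) R * vec (g $ᵥ δ j) J) ∎
    where
    α β : Fin k → Carrier
    α i = indicator ⁅ i ⁆ J
    β j = ⟨ α , (g ᵀ) j ⟩
    β≈ : ∀ j → β j ≈ vec (g $ᵥ δ j) J
    β≈ j = sym (trans (vec-coordinates _ J) (∑-cong (allFin k) (λ i → trans (*-comm _ _) (*-congˡ ($ᵥ-δ g j i)))))

  sign-square : ∀ n → E.sign n * E.sign n ≈ 1#
  sign-square zero    = *-identityˡ _
  sign-square (suc n) = trans (sym (-‿distribˡ-* _ _)) (trans (-‿cong (sym (-‿distribʳ-* _ _)))
    (trans (-‿involutive _) (sign-square n)))

-- Transport along paths and the network of a grafted diagram.

module Surgery {c ℓ₁ ℓ₂} (𝕂 : HeytingField c ℓ₁ ℓ₂) (k : ℕ) (𝕊 : MarkedSurface) (ℳ : Space) where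
  open Contraction 𝕂 k 𝕊 ℳ public
  open LinearMaps 𝕂 k public
  open SubsetAlgebra ring public using (Λ; ≡⇒≋; _≋_; _∙_; ∙-congˡ; ∙-congʳ; ∙-cong; vec; vec-cong; D; D-support; Φ; Φ-cong; Φ-∙; Φ-support;
    SupportedOn; ∙-support; vec-support; unit; ∙-unitʳ; ∙-unitˡ; ∙-∑ˡ; ∙-⊙ˡ; D-cong; ∙-∑ʳ; ∙-⊙ʳ; _⊙_; vec-*; vec-∑)
  open E using (V; Matrix; _$ᵥ_; _·_; scalar)
  open Surface 𝕊
  open Diagrams k 𝕊 ℳ
  open Grafting {k} {𝕊} {ℳ}
  private module M = Moduli 𝕂 k 𝕊 ℳ

  module _ (z : M.Point) where
    open M.Point z using (holonomy; transport; monodromy)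

    backward : ∀ {x y} → Path x y → Matrix
    backward π = proj₂ (M.transports holonomy π)

    -- Both directions are proved at once because `⁻¹` interchanges them. The statement is needed
    -- for the part of a fork that returns to the puncture along its own path.
    transport-inverse : ∀ {x y} (π : Path x y) v →
      (∀ i → (backward π $ᵥ (transport π $ᵥ v)) i ≈ v i) × (∀ i → (transport π $ᵥ (backward π $ᵥ v)) i ≈ v i)
    transport-inverse (gen g) v = inverse from to (E.SL.from·to (holonomy g)) , inverse to from (E.SL.to·from (holonomy g))
      where
      to   = E.SL.to (holonomy g)
      from = E.SL.from (holonomy g)
      inverse : ∀ a b → (a · b) E.≋ₘ scalar 1# → ∀ i → (a $ᵥ (b $ᵥ v)) i ≈ v i
      inverse a b ab≋1 i = trans (sym ($ᵥ-· a b v i)) (trans (∑-cong (allFin k) (λ j → *-congʳ (ab≋1 i j)))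
        (trans (scalar-$ᵥ 1# v i) (*-identityˡ _)))
    transport-inverse ε v = unit² , unit²
      where
      unit² : ∀ i → (scalar 1# $ᵥ (scalar 1# $ᵥ v)) i ≈ v i
      unit² i = trans (scalar-$ᵥ 1# _ i) (trans (*-identityˡ _) (trans (scalar-$ᵥ 1# v i) (*-identityˡ _)))
    transport-inverse fibre v = square , square
      where
      s = E.sign (pred k)
      square : ∀ i → (scalar s $ᵥ (scalar s $ᵥ v)) i ≈ v i
      square i = trans (scalar-$ᵥ s _ i) (trans (*-congˡ (scalar-$ᵥ s v i)) (trans (sym (*-assoc _ _ _))
        (trans (*-congʳ (sign-square (pred k))) (*-identityˡ _))))
    transport-inverse (π ⁻¹) v = swap (transport-inverse π v)
    transport-inverse (π ▷ π′) v =
      cancel (backward π) (backward π′) (transport π′) (transport π)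
        (λ w → proj₁ (transport-inverse π′ w)) (proj₁ (transport-inverse π v)) ,
      cancel (transport π′) (transport π) (backward π) (backward π′)
        (λ w → proj₂ (transport-inverse π w)) (proj₂ (transport-inverse π′ v))
      where
      cancel : ∀ a b c d → (∀ w i → (b $ᵥ (c $ᵥ w)) i ≈ w i) → (∀ i → (a $ᵥ (d $ᵥ v)) i ≈ v i) →
               ∀ i → ((a · b) $ᵥ ((c · d) $ᵥ v)) i ≈ v i
      cancel a b c d bc ad i = begin
        ((a · b) $ᵥ ((c · d) $ᵥ v)) i      ≈⟨ $ᵥ-· a b ((c · d) $ᵥ v) i ⟩
        (a $ᵥ (b $ᵥ ((c · d) $ᵥ v))) i     ≈⟨ $ᵥ-cong a ($ᵥ-cong b ($ᵥ-· c d v)) i ⟩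
        (a $ᵥ (b $ᵥ (c $ᵥ (d $ᵥ v)))) i    ≈⟨ $ᵥ-cong a (bc (d $ᵥ v)) i ⟩
        (a $ᵥ (d $ᵥ v)) i                  ≈⟨ ad i ⟩
        v i                                ∎

    weights : (T : TensorDiagram) → (TensorDiagram.Edge T → Λ k) → Weights T
    weights T src e s t = E.columns (transport (TensorDiagram.path T e)) s t * src e s

    powers : ∀ p → ℕ → V → V
    powers p zero    v = v
    powers p (suc j) v = monodromy p $ᵥ powers p j v

  loops : ∀ p → ℕ → Path (at (inj₁ p)) (at (inj₁ p))
  loops p zero    = ε
  loops p (suc j) = loops p j ▷ gen (loop p)

  transport-loops : ∀ z p j v i → (M.Point.transport z (loops p j) $ᵥ v) i ≈ powers z p j v i
  transport-loops z p zero    v i = trans (scalar-$ᵥ 1# v i) (*-identityˡ _)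
  transport-loops z p (suc j) v i =
    trans ($ᵥ-· (M.Point.monodromy z p) _ v i) ($ᵥ-cong (M.Point.monodromy z p) (transport-loops z p j v) i)

  pathAt : ∀ T {m} e → TensorDiagram.source T e ≡ inj₁ m → Path (at m) base
  pathAt T e eq = ≡.subst (λ s → Path (site s) base) eq (TensorDiagram.path T e)

  transport-pathAt : ∀ z T {m} e (eq : TensorDiagram.source T e ≡ inj₁ m) →
                     M.Point.transport z (pathAt T e eq) ≡ M.Point.transport z (TensorDiagram.path T e)
  transport-pathAt z T e eq = go (TensorDiagram.path T e) eq
    where
    go : ∀ {s s′} (π : Path (site s) base) (eq : s ≡ s′) →
         M.Point.transport z (≡.subst (λ s → Path (site s) base) eq π) ≡ M.Point.transport z π
    go π ≡.refl = ≡.refl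

  module GraftNetwork (T : TensorDiagram) {q} (wtₙ : Fin q → ℕ) (data′ : Graft.Data T wtₙ) where
    open TensorDiagram T using (Edge; #edges; #vertices; vertex; wt; source; path)
    open Graft T wtₙ
    open Graft.Data data′
    open Build data′

    attachment : Weights graft → (Edge → Subset k) → (Edge → Subset k) → Carrier
    attachment g σ τ = ∑ (selections (size ∘ wt′ ∘ new)) λ ρ → ∑ (selections (size ∘ wt′ ∘ new)) λ π →
      entry (ρ Vector.++ σ) (π Vector.++ τ) ν * ∏ (allFin q) (λ i → g (new i) (ρ i) (π i))

    -- The labels of the new legs enter only the new vertex and their own weights. Summing over them
    -- first collects everything new in the factor `attachment` of the old network.
    graft-network : (g : Weights graft) →
      network graft g ≈ ∑∑ T (λ σ τ → attachment g σ τ * edgeProduct T (g ∘ old) σ τ)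
    graft-network g = begin
      network graft g
        ≈⟨ split (λ σ σ≡ → ∑-cong Ls (λ τ → summand-ext σ≡ (λ _ → ≡.refl))) ⟩
      ∑ Ns (λ ρ → ∑ Os (λ σ → ∑ Ls (λ τ → summand (ρ Vector.++ σ) τ)))
        ≈⟨ ∑-cong Ns (λ ρ → ∑-cong Os (λ σ → split (λ τ τ≡ → summand-ext (λ _ → ≡.refl) τ≡))) ⟩
      ∑ Ns (λ ρ → ∑ Os (λ σ → ∑ Ns (λ π → ∑ Os (λ τ → summand (ρ Vector.++ σ) (π Vector.++ τ)))))
        ≈⟨ trans (∑-swap Ns Os _) (∑-cong Os (λ σ → trans (∑-cong Ns (λ ρ → ∑-swap Ns Os _)) (∑-swap Ns Os _))) ⟩
      ∑ Os (λ σ → ∑ Os (λ τ → ∑ Ns (λ ρ → ∑ Ns (λ π → summand (ρ Vector.++ σ) (π Vector.++ τ)))))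
        ≈⟨ ∑-cong Os (λ σ → ∑-cong Os (λ τ → trans
             (∑-cong Ns (λ ρ → trans (∑-cong Ns (λ π → factor ρ σ π τ)) (sym (∑-*ˡ Ns _ _))))
             (trans (sym (∑-*ˡ Ns _ _)) (*-congˡ (trans
               (∑-cong Ns (λ ρ → sym (∑-*ʳ Ns _ _))) (sym (∑-*ʳ Ns _ _))))))) ⟩
      ∑ Os (λ σ → ∑ Os (λ τ → vertexProduct T σ τ * (attachment g σ τ * edgeProduct T (g ∘ old) σ τ)))
        -- Old edges keep their weights only up to a propositional equality, so the list of
        -- labellings has to be replaced.
        ≡⟨ ≡.cong (λ Os → ∑ Os (λ σ → ∑ Os (λ τ → vertexProduct T σ τ * (attachment g σ τ * edgeProduct T (g ∘ old) σ τ))))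
             (selections-cong (λ e → ≡.cong size (wt-old e))) ⟩
      ∑∑ T (λ σ τ → attachment g σ τ * edgeProduct T (g ∘ old) σ τ) ∎
      where
      Ls = labellings graft
      Ns = selections (size ∘ wt′ ∘ new)
      Os = selections (size ∘ wt′ ∘ old)
      summand : (Edge′ → Subset k) → (Edge′ → Subset k) → Carrier
      summand σ τ = vertexProduct graft σ τ * edgeProduct graft g σ τ
      summand-ext : ∀ {σ σ′ τ τ′} → (∀ e → σ e ≡ σ′ e) → (∀ e → τ e ≡ τ′ e) → summand σ τ ≈ summand σ′ τ′
      summand-ext σ≡ τ≡ = *-cong
        (∏-cong (allFin (suc #vertices)) (λ v → reflexive (entry-cong (vertex′ v) (λ e _ → σ≡ e) τ≡)))
        (∏-cong (allFin (q ℕ.+ #edges)) (λ e → reflexive (≡.cong₂ (g e) (σ≡ e) (τ≡ e))))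
      split : ∀ {f : (Edge′ → Subset k) → Carrier} → (∀ σ {σ′} → (∀ e → σ e ≡ σ′ e) → f σ ≈ f σ′) →
              ∑ Ls f ≈ ∑ Ns (λ ρ → ∑ Os (λ σ → f (ρ Vector.++ σ)))
      split f-ext = ∑-selections-++ q (size ∘ wt′) (λ eq → f-ext _ eq)
      restrict : ∀ (ρ : Fin q → Subset k) (σ : Edge → Subset k) e → (ρ Vector.++ σ) (old e) ≡ σ e
      restrict ρ σ e = lookup-++ʳ ρ σ e
      restrict-new : ∀ (ρ : Fin q → Subset k) (σ : Edge → Subset k) i → (ρ Vector.++ σ) (new i) ≡ ρ i
      restrict-new ρ σ i = ≡.cong Sum.[ ρ , σ ] (Fin.splitAt-↑ˡ q i #edges)
      factor : ∀ ρ σ π τ → summand (ρ Vector.++ σ) (π Vector.++ τ) ≈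
        vertexProduct T σ τ * (entry (ρ Vector.++ σ) (π Vector.++ τ) ν * ∏ (allFin q) (λ i → g (new i) (ρ i) (π i))
                              * edgeProduct T (g ∘ old) σ τ)
      factor ρ σ π τ = begin
        summand (ρ Vector.++ σ) (π Vector.++ τ)
          ≈⟨ *-cong
               (trans (∏-suc #vertices _) (*-congˡ (∏-cong (allFin #vertices) (λ v → reflexive (≡.trans
                 (entry-map old wt-old _ _ (vertex v)) (entry-cong (vertex v) (λ e _ → restrict ρ σ e) (restrict π τ)))))))
               (trans (∏-allFin-++ q _) (*-cong
                 (∏-cong (allFin q) (λ i → reflexive (≡.cong₂ (g (new i)) (restrict-new ρ σ i) (restrict-new π τ i))))
                 (∏-cong (allFin #edges) (λ e → reflexive (≡.cong₂ (g (old e)) (restrict ρ σ e) (restrict π τ e)))))) ⟩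
        (entry (ρ Vector.++ σ) (π Vector.++ τ) ν * vertexProduct T σ τ) *
        (∏ (allFin q) (λ i → g (new i) (ρ i) (π i)) * edgeProduct T (g ∘ old) σ τ)
          ≈⟨ trans (*-congʳ (*-comm _ _)) (trans (*-assoc _ _ _) (*-congˡ (sym (*-assoc _ _ _)))) ⟩
        _ ∎

-- The two local moves: merging two legs and splitting one.

module Moves {c ℓ₁ ℓ₂} (𝕂 : HeytingField c ℓ₁ ℓ₂) (k : ℕ) (𝕊 : MarkedSurface) (ℳ : Space) where
  open Surgery 𝕂 k 𝕊 ℳ public
  open E using (V; Matrix; _$ᵥ_; _·_; scalar)
  open Surface 𝕊
  open Diagrams k 𝕊 ℳ
  open Grafting {k} {𝕊} {ℳ}
  private module M = Moduli 𝕂 k 𝕊 ℳ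

  ∑-selections₁ : (L : Fin 1 → List (Subset k)) (f : (Fin 1 → Subset k) → Carrier) →
                  ∑ (selections L) f ≈ ∑ (L zero) (λ a → f (a Vector.∷ λ ()))
  ∑-selections₁ L f = trans (∑-selections-suc L f) (∑-cong (L zero) (λ a → +-identityʳ _))

  ∑-selections₂ : (L : Fin 2 → List (Subset k)) (f : (Fin 2 → Subset k) → Carrier) →
                  ∑ (selections L) f ≈ ∑ (L zero) (λ a → ∑ (L (suc zero)) (λ b → f (a Vector.∷ (b Vector.∷ λ ()))))
  ∑-selections₂ L f = trans (∑-selections-suc L f) (∑-cong (L zero) (λ a → ∑-selections₁ (L ∘ suc) _))

  ∧-pair : ∀ (A B : Subset k) → E.⋀ (E.basis A ∷ E.basis B ∷ []) ≋ indicator A ∙ indicator B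
  ∧-pair A B S = trans (∧-∙ _ _ S) (∙-congˡ (λ T → trans (∧-∙ _ _ T)
    (trans (∙-congˡ indicator-⊥ T) (∙-unitʳ _ T))) S)

  ∙-sum : ∀ {a b X Y} → SupportedOn (_≡ a) X → SupportedOn (_≡ b) Y → ∀ S →
          ∑ (size a) (λ A → ∑ (size b) (λ B → (indicator A ∙ indicator B) S * (X A * Y B))) ≈ (X ∙ Y) S
  ∙-sum {a} {b} {X} {Y} X-supp Y-supp S = sym (begin
    (X ∙ Y) S
      ≈⟨ ∙-cong (λ T → sym (indicator-sum X-supp T)) (λ T → sym (indicator-sum Y-supp T)) S ⟩
    ((λ T → ∑ (size a) (λ A → indicator A T * X A)) ∙ (λ T → ∑ (size b) (λ B → indicator B T * Y B))) S
      ≈⟨ ∙-∑ˡ (size a) (λ A T → indicator A T * X A) _ S ⟩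
    ∑ (size a) (λ A → ((λ T → indicator A T * X A) ∙ (λ T → ∑ (size b) (λ B → indicator B T * Y B))) S)
      ≈⟨ ∑-cong (size a) (λ A → ∙-∑ʳ (size b) _ (λ B T → indicator B T * Y B) S) ⟩
    ∑ (size a) (λ A → ∑ (size b) (λ B → ((λ T → indicator A T * X A) ∙ (λ T → indicator B T * Y B)) S))
      ≈⟨ ∑-cong (size a) (λ A → ∑-cong (size b) (λ B → begin
           ((λ T → indicator A T * X A) ∙ (λ T → indicator B T * Y B)) S
             ≈⟨ ∙-cong {x′ = X A ⊙ indicator A} {y′ = Y B ⊙ indicator B} (λ T → *-comm _ _) (λ T → *-comm _ _) S ⟩
           ((X A ⊙ indicator A) ∙ (Y B ⊙ indicator B)) S
             ≈⟨ trans (∙-⊙ˡ _ _ _ S) (*-congˡ (∙-⊙ʳ _ _ _ S)) ⟩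
           X A * (Y B * (indicator A ∙ indicator B) S)
             ≈⟨ trans (sym (*-assoc _ _ _)) (*-comm _ _) ⟩
           (indicator A ∙ indicator B) S * (X A * Y B) ∎)) ⟩
    ∑ (size a) (λ A → ∑ (size b) (λ B → (indicator A ∙ indicator B) S * (X A * Y B))) ∎)

  module _ (T : TensorDiagram) {q} (wtₙ : Fin q → ℕ) (data′ : Graft.Data T wtₙ) (z : M.Point) where
    open TensorDiagram T
    open Graft T wtₙ
    open Graft.Data data′
    open Build data′
    open M.Point z using (transport)

    transport-moved : ∀ e → e ∈ os → transport (relocated-path e (e ∈ᴱ? os)) ≡ transport (pathₒ e)
    transport-moved e e∈ = go (e ∈ᴱ? os)
      where
      go : ∀ d → transport (relocated-path e d) ≡ transport (pathₒ e)
      go (yes _)  = ≡.refl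
      go (no e∉) = ⊥-elim (e∉ e∈)

    transport-kept : ∀ e → e ∉ os → transport (relocated-path e (e ∈ᴱ? os)) ≡ transport (path e)
    transport-kept e e∉ = go (e ∈ᴱ? os)
      where
      shift : ∀ s (π : Path (site s) base) → transport (shift-path s π) ≡ transport π
      shift (inj₁ _) π = ≡.refl
      shift (inj₂ _) π = ≡.refl
      go : ∀ d → transport (relocated-path e d) ≡ transport (path e)
      go (yes e∈) = ⊥-elim (e∉ e∈)
      go (no _)   = shift (source e) (path e)

  -- Replaces a leg e of weight m + 1 by the product of two legs, of weights m and 1.
  module Merge (T : TensorDiagram) {p} (e : TensorDiagram.Edge T) (leg : TensorDiagram.source T e ≡ inj₁ (inj₁ p))
               {m} (1≤m : 1 ≤ m) (wt-e : TensorDiagram.wt T e ≡ suc m) where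
    open TensorDiagram T using (Edge; wt; path; wt≤k)

    wtₙ : Fin 2 → ℕ
    wtₙ zero       = m
    wtₙ (suc zero) = 1

    m<k : suc m ≤ k
    m<k = ≡.subst (_≤ k) wt-e (wt≤k e)

    data′ : Graft.Data T wtₙ
    data′ = record
      { p      = p
      ; 1≤wtₙ  = λ { zero → 1≤m ; (suc zero) → s≤s z≤n }
      ; wtₙ≤k  = λ { zero → ℕ.<⇒≤ m<k ; (suc zero) → ℕ.≤-trans (s≤s z≤n) m<k }
      ; pathₙ  = λ _ → pathAt T e leg
      ; os     = e ∷ []
      ; unique = [] AllPairs.∷ AllPairs.[]
      ; legs   = λ { (here ≡.refl) → leg }
      ; pathₒ  = λ _ → ε
      ; ν      = white (zero ∷ suc zero ∷ []) (suc (suc e)) (≡.trans wt-e (ℕ.+-comm 1 m))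
      ; ν-in   = ≡.refl
      ; ν-out  = ≡.refl
      }

    open Graft T wtₙ public using (Edge′; old; new; wt′)
    open Graft.Build T wtₙ data′ public using (graft; source-kept; source-moved; source-added; source′; relocated-inj₁)

    -- Transport is multiplicative: the new legs run along the path of e and then meet, which yields
    -- the same tensor as multiplying x and v at the puncture and transporting the product.
    network-merge : (z : M.Point) {x : Λ k} {v : V} (src′ : Edge′ → Λ k) (src : Edge → Λ k) →
      SupportedOn (_≡ m) x → src′ zero ≋ x → src′ (suc zero) ≋ vec v → src′ (old e) ≋ (λ _ → 1#) →
      (∀ e₁ → e₁ ≢ e → src′ (old e₁) ≋ src e₁) → src e ≋ x ∙ vec v →
      network graft (weights z graft src′) ≈ network T (weights z T src)
    network-merge z {x} {v} src′ src x-supp src₀ src₁ srcₑ others srcₜ = begin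
      network graft g′
        ≈⟨ GraftNetwork.graft-network T wtₙ data′ g′ ⟩
      ∑∑ T (λ σ τ → attachment σ τ * edgeProduct T (g′ ∘ old) σ τ)
        ≈⟨ ∑∑-cong T (λ σ τ _ → trans (*-congʳ (attached σ τ)) (edgeProduct-absorb T e X (g′ ∘ old) σ τ)) ⟩
      network T ((g′ ∘ old) [ e ≔ (λ s t → X s * g′ (old e) s t) ])
        -- The edge e now leaves the new vertex with the constant path, so its matrix is the
        -- identity and the sum over its source label returns X. In T the leg e gives X as well, by
        -- transporting the product.
        ≈⟨ network-leg T leg (λ e₁ e₁≢e s t → trans
             (reflexive (≡.cong (λ h → h s t) (updateAt-minimal e₁ e (g′ ∘ old) e₁≢e)))
             (*-cong (reflexive (≡.cong (λ g → E.columns g s t) (transport-kept T wtₙ data′ z e₁ (λ { (here eq) → e₁≢e eq }))))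
                     (others e₁ e₁≢e s)))
             (λ t → trans (∑-cong (size (wt e)) (λ s → trans
                 (reflexive (≡.cong (λ h → h s t) (updateAt-updates e (g′ ∘ old)))) (trans (*-comm _ _) (*-congʳ (trans
                   (*-cong (trans (reflexive (≡.cong (λ g → E.columns g s t) (transport-moved T wtₙ data′ z e (here ≡.refl))))
                     (columns-1 s t)) (srcₑ s)) (*-identityʳ _))))))
               (trans (indicator-sum X-supp t)
                 (sym (trans (∑-cong (size (wt e)) (λ s → *-congˡ (srcₜ s))) (columns-sum _ product-supp t))))) ⟩
      network T (weights z T src) ∎
      where
      open M.Point z using (transport)
      g′ = weights z graft src′
      attachment = GraftNetwork.attachment T wtₙ data′ g′
      u = transport (path e)
      product-supp : SupportedOn (_≡ wt e) (x ∙ vec v)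
      product-supp = ≡.subst (λ a → SupportedOn (_≡ a) (x ∙ vec v)) (≡.trans (ℕ.+-comm m 1) (≡.sym wt-e))
        (∙-degree x-supp (vec-support v))
      X : Λ k
      X = Φ (u ᵀ) (x ∙ vec v)
      X-supp : SupportedOn (_≡ wt e) X
      X-supp = Φ-degree u product-supp
      A B : Subset k → Subset k → Carrier
      A s t = g′ zero s t
      B s t = g′ (suc zero) s t
      ∑A : ∀ t → ∑ (size m) (λ s → A s t) ≈ Φ (u ᵀ) x t
      ∑A t = trans (∑-cong (size m) (λ s → *-cong
        (reflexive (≡.cong (λ g → E.columns g s t) (transport-pathAt z T e leg))) (src₀ s))) (columns-sum u x-supp t)
      ∑B : ∀ t → ∑ (size 1) (λ s → B s t) ≈ Φ (u ᵀ) (vec v) t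
      ∑B t = trans (∑-cong (size 1) (λ s → *-cong
        (reflexive (≡.cong (λ g → E.columns g s t) (transport-pathAt z T e leg))) (src₁ s))) (columns-sum u (vec-support v) t)
      attached : ∀ σ τ → attachment σ τ ≈ X (σ e)
      attached σ τ = begin
        attachment σ τ
          ≈⟨ trans (∑-selections₂ (size ∘ wtₙ′) _) (∑-cong (size m) (λ a → ∑-cong (size 1) (λ b → ∑-selections₂ (size ∘ wtₙ′) _))) ⟩
        ∑ (size m) (λ a → ∑ (size 1) (λ b → ∑ (size m) (λ c → ∑ (size 1) (λ d →
          E.⋀ (E.basis c ∷ E.basis d ∷ []) (σ e) * (A a c * (B b d * 1#))))))
          ≈⟨ ∑-cong (size m) (λ a → trans (∑-swap (size 1) (size m) _) (∑-cong (size m) (λ c → ∑-swap (size 1) (size 1) _))) ⟩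
        ∑ (size m) (λ a → ∑ (size m) (λ c → ∑ (size 1) (λ d → ∑ (size 1) (λ b →
          E.⋀ (E.basis c ∷ E.basis d ∷ []) (σ e) * (A a c * (B b d * 1#))))))
          ≈⟨ trans (∑-swap (size m) (size m) _) (∑-cong (size m) (λ c → ∑-swap (size m) (size 1) _)) ⟩
        ∑ (size m) (λ c → ∑ (size 1) (λ d → ∑ (size m) (λ a → ∑ (size 1) (λ b →
          E.⋀ (E.basis c ∷ E.basis d ∷ []) (σ e) * (A a c * (B b d * 1#))))))
          ≈⟨ ∑-cong (size m) (λ c → ∑-cong (size 1) (λ d → begin
               ∑ (size m) (λ a → ∑ (size 1) (λ b → E.⋀ (E.basis c ∷ E.basis d ∷ []) (σ e) * (A a c * (B b d * 1#))))
                 ≈⟨ ∑-cong (size m) (λ a → trans (∑-cong (size 1) (λ b → *-cong (∧-pair c d (σ e)) (*-congˡ (*-identityʳ _))))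
                      (sym (trans (*-congˡ (∑-*ˡ (size 1) _ _)) (∑-*ˡ (size 1) _ _)))) ⟩
               ∑ (size m) (λ a → (indicator c ∙ indicator d) (σ e) * (A a c * ∑ (size 1) (λ b → B b d)))
                 ≈⟨ trans (*-congˡ (∑-*ʳ (size m) _ _)) (∑-*ˡ (size m) _ _) ⟨
               (indicator c ∙ indicator d) (σ e) * (∑ (size m) (λ a → A a c) * ∑ (size 1) (λ b → B b d))
                 ≈⟨ *-congˡ (*-cong (∑A c) (∑B d)) ⟩
               (indicator c ∙ indicator d) (σ e) * (Φ (u ᵀ) x c * Φ (u ᵀ) (vec v) d) ∎)) ⟩
        ∑ (size m) (λ c → ∑ (size 1) (λ d → (indicator c ∙ indicator d) (σ e) * (Φ (u ᵀ) x c * Φ (u ᵀ) (vec v) d)))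
          ≈⟨ ∙-sum (Φ-degree u x-supp) (Φ-degree u (vec-support v)) (σ e) ⟩
        (Φ (u ᵀ) x ∙ Φ (u ᵀ) (vec v)) (σ e)
          ≈⟨ Φ-∙ (u ᵀ) x (vec v) (σ e) ⟨
        X (σ e) ∎
        where
        wtₙ′ : Fin 2 → ℕ
        wtₙ′ i = wt′ (new i)

  -- Replaces legs e and g, of weights b and 1, by the two parts of one leg of
  -- weight b + 1, the part of weight 1 being carried j times around the puncture.
  module Split (T : TensorDiagram) {p} (e g : TensorDiagram.Edge T) (e≢g : e ≢ g)
               (leg-e : TensorDiagram.source T e ≡ inj₁ (inj₁ p)) (leg-g : TensorDiagram.source T g ≡ inj₁ (inj₁ p))
               {b} (b<k : b < k) (wt-e : TensorDiagram.wt T e ≡ b) (wt-g : TensorDiagram.wt T g ≡ 1) (j : ℕ) where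
    open TensorDiagram T using (Edge; wt; path)

    wtₙ : Fin 1 → ℕ
    wtₙ _ = suc b

    -- The fork lies at the far end of the path of e. The light part goes back to the puncture, j
    -- times around it and out along the path of g; the heavy part is already where e leads.
    around : ∀ e₁ → Dec (e₁ ≡ e) → Path base base
    around _ (yes _) = ε
    around _ (no _)  = pathAt T e leg-e ⁻¹ ▷ loops p j ▷ pathAt T g leg-g

    data′ : Graft.Data T wtₙ
    data′ = record
      { p      = p
      ; 1≤wtₙ  = λ _ → s≤s z≤n
      ; wtₙ≤k  = λ _ → b<k
      ; pathₙ  = λ _ → pathAt T e leg-e
      ; os     = e ∷ g ∷ []
      ; unique = (e≢g ∷ []) AllPairs.∷ [] AllPairs.∷ AllPairs.[]
      ; legs   = λ { (here ≡.refl) → leg-e ; (there (here ≡.refl)) → leg-g }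
      ; pathₒ  = λ e₁ → around e₁ (e₁ Fin.≟ e)
      ; ν      = black zero (suc e ∷ suc g ∷ []) (≡.trans (ℕ.+-comm 1 b)
                   (≡.cong₂ ℕ._+_ (≡.sym wt-e) (≡.cong (ℕ._+ 0) (≡.sym wt-g))))
      ; ν-in   = ≡.refl
      ; ν-out  = ≡.refl
      }

    open Graft T wtₙ public using (Edge′; old; new; wt′)
    open Graft.Build T wtₙ data′ public using (graft; source-kept; source-moved; source-added; source′; relocated-inj₁)

    -- A black vertex with a branch of weight 1 sends y to the sum over i of D (δ i) y ⊗ δ i. Each
    -- term is the network of T with one part on each of the legs e and g.
    network-split : (z : M.Point) {y : Λ k} (src′ : Edge′ → Λ k) (src : Fin k → Edge → Λ k) →
      SupportedOn (_≡ suc b) y → src′ zero ≋ y → src′ (old e) ≋ (λ _ → 1#) → src′ (old g) ≋ (λ _ → 1#) →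
      (∀ i e₁ → e₁ ≢ e → e₁ ≢ g → src′ (old e₁) ≋ src i e₁) →
      (∀ i → src i e ≋ D (δ i) y) → (∀ i → src i g ≋ vec (powers z p j (δ i))) →
      network graft (weights z graft src′) ≈ ∑ (allFin k) (λ i → network T (weights z T (src i)))
    network-split z {y} src′ src y-supp src₀ src′ₑ src′-g others srcₑ src-g = begin
      network graft g′
        ≈⟨ GraftNetwork.graft-network T wtₙ data′ g′ ⟩
      ∑∑ T (λ σ τ → attachment σ τ * edgeProduct T (g′ ∘ old) σ τ)
        ≈⟨ ∑∑-cong T (λ σ τ σ-size → trans (*-congʳ (attached σ τ (≡.trans (σ-size g) wt-g))) (trans (∑-*ʳ (allFin k) _ _)
             (∑-cong (allFin k) (λ i → trans (*-assoc _ _ _) (trans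
               (*-congˡ (edgeProduct-absorb T g (Y i) (g′ ∘ old) σ τ)) (edgeProduct-absorb T e (X i) (at-g i) σ τ)))))) ⟩
      ∑∑ T (λ σ τ → ∑ (allFin k) (λ i → edgeProduct T (at-e i) σ τ))
        ≈⟨ ∑∑-sum T (allFin k) (λ i → edgeProduct T (at-e i)) ⟩
      ∑ (allFin k) (λ i → network T (at-e i))
        ≈⟨ ∑-cong (allFin k) (λ i → trans (at-e≈ i) (at-g≈ i)) ⟩
      ∑ (allFin k) (λ i → network T (weights z T (src i))) ∎
      where
      open M.Point z using (transport)
      g′ = weights z graft src′
      attachment = GraftNetwork.attachment T wtₙ data′ g′
      u u-g M : Matrix
      u  = transport (path e)
      u-g = transport (path g)
      M = transport (around g (no (e≢g ∘ ≡.sym)))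
      X Y : Fin k → Λ k
      X i = Φ (u ᵀ) (D (δ i) y)
      Y i = vec (u $ᵥ δ i)
      -- The i-th term with its two parts absorbed into the edges, still with the transports of the
      -- graft. `at-e≈` and `at-g≈` restore the legs of T one at a time, as `network-leg` handles a
      -- single leg.
      at-g at-e : Fin k → Weights T
      at-g i = (g′ ∘ old) [ g ≔ (λ s t → Y i s * g′ (old g) s t) ]
      at-e i = at-g i [ e ≔ (λ s t → X i s * at-g i e s t) ]

      transport-around : ∀ e₁ (d : Dec (e₁ ≡ e)) → e₁ ≢ e → transport (around e₁ d) ≡ M
      transport-around e₁ (yes eq) e₁≢e = ⊥-elim (e₁≢e eq)
      transport-around e₁ (no _)   e₁≢e = ≡.refl
      around-e : ∀ (d : Dec (e ≡ e)) → transport (around e d) ≡ scalar 1#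
      around-e (yes _) = ≡.refl
      around-e (no ¬p) = ⊥-elim (¬p ≡.refl)

      weight-e : ∀ i s t → at-g i e s t ≈ indicator s t
      weight-e i s t = trans (reflexive (≡.cong (λ h → h s t) (updateAt-minimal e g (g′ ∘ old) e≢g)))
        (trans (*-cong (trans (reflexive (≡.cong (λ m → E.columns m s t) (≡.trans
          (transport-moved T wtₙ data′ z e (here ≡.refl)) (around-e (e Fin.≟ e))))) (columns-1 s t)) (src′ₑ s)) (*-identityʳ _))
      weight-g : ∀ s t → g′ (old g) s t ≈ E.columns M s t
      weight-g s t = trans (*-cong (reflexive (≡.cong (λ m → E.columns m s t) (≡.trans
        (transport-moved T wtₙ data′ z g (there (here ≡.refl))) (transport-around g (g Fin.≟ e) (e≢g ∘ ≡.sym))))) (src′-g s)) (*-identityʳ _)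

      Dy-degree : ∀ i → SupportedOn (_≡ wt e) (D (δ i) y)
      Dy-degree i = ≡.subst (λ a → SupportedOn (_≡ a) (D (δ i) y)) (≡.sym wt-e) (D-degree (δ i) y-supp)

      at-e≈ : ∀ i → network T (at-e i) ≈ network T (at-g i [ e ≔ weights z T (src i) e ])
      at-e≈ i = network-leg T leg-e
        (λ e₁ e₁≢e s t → reflexive (≡.cong (λ h → h s t) (≡.trans (updateAt-minimal e₁ e (at-g i) e₁≢e)
          (≡.sym (updateAt-minimal e₁ e (at-g i) e₁≢e)))))
        (λ t → trans (∑-cong (size (wt e)) (λ s → trans (reflexive (≡.cong (λ h → h s t) (updateAt-updates e (at-g i))))
            (trans (*-congˡ (weight-e i s t)) (*-comm _ _))))
          (trans (indicator-sum (Φ-degree u (Dy-degree i)) t) (sym (trans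
            (∑-cong (size (wt e)) (λ s → trans (reflexive (≡.cong (λ h → h s t) (updateAt-updates e (at-g i)))) (*-congˡ (srcₑ i s))))
            (columns-sum u (Dy-degree i) t)))))

      vec-degree : ∀ w → SupportedOn (_≡ wt g) (vec w)
      vec-degree w = ≡.subst (λ a → SupportedOn (_≡ a) (vec w)) (≡.sym wt-g) (vec-support w)

      -- The way back along the path of e undoes the transport u that preceded the fork; the loops
      -- act as powers of the monodromy before the path of g.
      carried : ∀ v l → (M $ᵥ (u $ᵥ v)) l ≈ (u-g $ᵥ powers z p j v) l
      carried v l = begin
        (M $ᵥ (u $ᵥ v)) l
          ≈⟨ trans ($ᵥ-· (transport πg · transport (loops p j)) back (u $ᵥ v) l) ($ᵥ-· (transport πg) (transport (loops p j)) (back $ᵥ (u $ᵥ v)) l) ⟩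
        (transport πg $ᵥ (transport (loops p j) $ᵥ (back $ᵥ (u $ᵥ v)))) l
          ≈⟨ $ᵥ-cong (transport πg) ($ᵥ-cong (transport (loops p j)) inverse) l ⟩
        (transport πg $ᵥ (transport (loops p j) $ᵥ v)) l
          ≈⟨ $ᵥ-cong (transport πg) (transport-loops z p j v) l ⟩
        (transport πg $ᵥ powers z p j v) l
          ≡⟨ ≡.cong (λ m → (m $ᵥ powers z p j v) l) (transport-pathAt z T g leg-g) ⟩
        (u-g $ᵥ powers z p j v) l ∎
        where
        πg = pathAt T g leg-g
        back = backward z (pathAt T e leg-e)
        inverse : ∀ l → (back $ᵥ (u $ᵥ v)) l ≈ v l
        inverse l = trans (reflexive (≡.cong (λ m → (back $ᵥ (m $ᵥ v)) l) (≡.sym (transport-pathAt z T e leg-e))))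
          (proj₁ (transport-inverse z (pathAt T e leg-e) v) l)

      at-g≈ : ∀ i → network T (at-g i [ e ≔ weights z T (src i) e ]) ≈ network T (weights z T (src i))
      at-g≈ i = network-leg T leg-g elsewhere (λ t → trans
          (∑-cong (size (wt g)) (λ s → trans (reflexive (≡.cong (λ h → h s t) (≡.trans
              (updateAt-minimal g e (at-g i) (e≢g ∘ ≡.sym)) (updateAt-updates g (g′ ∘ old)))))
            (trans (*-congˡ (weight-g s t)) (*-comm _ _))))
          (trans (columns-sum M (vec-degree (u $ᵥ δ i)) t) (trans (Φ-vec-$ᵥ M _ t) (trans (vec-cong (carried (δ i)) t)
            (sym (trans (∑-cong (size (wt g)) (λ s → *-congˡ (src-g i s)))
              (trans (columns-sum u-g (vec-degree (powers z p j (δ i))) t) (Φ-vec-$ᵥ u-g _ t))))))))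
        where
        elsewhere : ∀ e₁ → e₁ ≢ g → ∀ s t → (at-g i [ e ≔ weights z T (src i) e ]) e₁ s t ≈ weights z T (src i) e₁ s t
        elsewhere e₁ e₁≢g s t with e₁ Fin.≟ e
        ... | yes ≡.refl = reflexive (≡.cong (λ h → h s t) (updateAt-updates e (at-g i)))
        ... | no e₁≢e = trans (reflexive (≡.cong (λ h → h s t) (≡.trans (updateAt-minimal e₁ e (at-g i) e₁≢e)
                                  (updateAt-minimal e₁ g (g′ ∘ old) e₁≢g))))
          (*-cong (reflexive (≡.cong (λ m → E.columns m s t) (transport-kept T wtₙ data′ z e₁
                    (λ { (here eq) → e₁≢e eq ; (there (here eq)) → e₁≢g eq })))) (others i e₁ e₁≢e e₁≢g s))

      A : Subset k → Subset k → Carrier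
      A s t = g′ zero s t
      ∑A : ∀ t → ∑ (size (suc b)) (λ s → A s t) ≈ Φ (u ᵀ) y t
      ∑A t = trans (∑-cong (size (suc b)) (λ s → *-cong
        (reflexive (≡.cong (λ m → E.columns m s t) (transport-pathAt z T e leg-e))) (src₀ s))) (columns-sum u y-supp t)

      attached : ∀ σ τ → ∣ σ g ∣ ≡ 1 → attachment σ τ ≈ ∑ (allFin k) (λ i → X i (σ e) * Y i (σ g))
      attached σ τ size-g = begin
        attachment σ τ
          ≈⟨ trans (∑-selections₁ (size ∘ wtₙ′) _) (∑-cong (size (suc b)) (λ a → ∑-selections₁ (size ∘ wtₙ′) _)) ⟩
        ∑ (size (suc b)) (λ a → ∑ (size (suc b)) (λ c → E.⋀ (E.basis (σ e) ∷ E.basis (σ g) ∷ []) c * (A a c * 1#)))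
          ≈⟨ trans (∑-swap (size (suc b)) (size (suc b)) _) (∑-cong (size (suc b)) (λ c → trans
               (∑-cong (size (suc b)) (λ a → *-cong (∧-pair (σ e) (σ g) c) (*-identityʳ _)))
               (trans (sym (∑-*ˡ (size (suc b)) _ _)) (trans (*-congˡ (∑A c)) (*-comm _ _))))) ⟩
        ∑ (size (suc b)) (λ c → Φ (u ᵀ) y c * (indicator (σ e) ∙ indicator (σ g)) c)
          ≈⟨ ∑-support (λ S → ∣ S ∣ ℕ.≟ suc b) (allSubsets k) (λ c c≢ → trans (*-congʳ (Φ-degree u y-supp c c≢)) (zeroˡ _)) ⟩
        ∑ (allSubsets k) (λ c → Φ (u ᵀ) y c * (indicator (σ e) ∙ indicator (σ g)) c)
          -- The label of g has one element, so its basis tensor is a vector and multiplication by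
          -- it is adjoint to a contraction.
          ≈⟨ ∑-cong (allSubsets k) (λ c → *-congˡ (∙-congˡ (indicator-vec (σ g) size-g) c)) ⟩
        ∑ (allSubsets k) (λ c → Φ (u ᵀ) y c * (indicator (σ e) ∙ vec (λ i → indicator ⁅ i ⁆ (σ g))) c)
          ≈⟨ trans (D-adjoint _ (Φ (u ᵀ) y) (σ e)) (D-expand _ (Φ (u ᵀ) y) (σ e)) ⟩
        ∑ (allFin k) (λ i → indicator ⁅ i ⁆ (σ g) * D (δ i) (Φ (u ᵀ) y) (σ e))
          ≈⟨ split-equivariant u y (σ e) (σ g) ⟩
        ∑ (allFin k) (λ i → X i (σ e) * Y i (σ g)) ∎
        where
        wtₙ′ : Fin 1 → ℕ
        wtₙ′ i = wt′ (new i)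

-- Bookkeeping for the termination measure.

total : ∀ n → (Fin n → ℕ) → ℕ
total zero    f = 0
total (suc n) f = f zero ℕ.+ total n (f ∘ suc)

total-cong : ∀ {n} {f g : Fin n → ℕ} → (∀ i → f i ≡ g i) → total n f ≡ total n g
total-cong {zero}  eq = ≡.refl
total-cong {suc n} eq = ≡.cong₂ ℕ._+_ (eq zero) (total-cong (eq ∘ suc))

total-at : ∀ {n} (i : Fin n) f → total n f ≡ f i ℕ.+ total n (f [ i ≔ 0 ])
total-at zero    f = ≡.refl
total-at {suc n} (suc i) f = ≡.trans (≡.cong (f zero ℕ.+_) (total-at i (f ∘ suc)))
  (x∙yz≈y∙xz (f zero) (f (suc i)) (total n ((f ∘ suc) [ i ≔ 0 ])))

⊈⇒∃ : ∀ {n} {A B : Subset n} → ¬ A ⊆ B → ∃[ x ] x Subset.∈ A × x Subset.∉ B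
⊈⇒∃ {n} {A} {B} A⊈B
  with x , ¬impl ← Fin.¬∀⟶∃¬ n (λ x → x Subset.∈ A → x Subset.∈ B)
         (λ x → (x Subset.∈? A) →-dec (x Subset.∈? B)) (λ all → A⊈B (λ {x} → all x))
  with x Subset.∈? A
... | yes x∈A = x , x∈A , λ x∈B → ¬impl (λ _ → x∈B)
... | no  x∉A = ⊥-elim (¬impl (λ x∈A → ⊥-elim (x∉A x∈A)))

module CostArithmetic where
  open import Data.Nat.Base using (_+_; _*_; _∸_)
  open ℕ.≤-Reasoning
  open +-*-Solver

  -- a ↦ k² - a² is strictly concave.
  square-cost : ∀ k {m b} → m < b → b < k →
                (k * k ∸ suc b * suc b) + (k * k ∸ m * m) <
                (k * k ∸ suc m * suc m) + (k * k ∸ b * b)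
  square-cost k {m} {b} m<b b<k = ℕ.+-cancelʳ-< (suc b * suc b + m * m) _ _ (begin-strict
    (c (suc b) + c m) + (suc b * suc b + m * m)  ≡⟨ balance b<k m≤k ⟩
    k * k + k * k                                    ≡⟨ balance m<k (ℕ.<⇒≤ b<k) ⟨
    (c (suc m) + c b) + (suc m * suc m + b * b)  <⟨ ℕ.+-monoʳ-< (c (suc m) + c b) squares ⟩
    (c (suc m) + c b) + (suc b * suc b + m * m)  ∎)
    where
    c : ℕ → ℕ
    c a = k * k ∸ a * a
    m<k : m < k
    m<k = ℕ.<-trans m<b b<k
    m≤k : m ≤ k
    m≤k = ℕ.<⇒≤ m<k
    restore : ∀ {a} → a ≤ k → c a + a * a ≡ k * k
    restore a≤k = ℕ.m∸n+n≡m (ℕ.*-mono-≤ a≤k a≤k)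
    balance : ∀ {a b} → a ≤ k → b ≤ k → (c a + c b) + (a * a + b * b) ≡ k * k + k * k
    balance {a} {b} a≤k b≤k = ≡.trans
      (solve 4 (λ x y s t → (x :+ y) :+ (s :+ t) := (x :+ s) :+ (y :+ t)) ≡.refl (c a) (c b) (a * a) (b * b))
      (≡.cong₂ _+_ (restore a≤k) (restore b≤k))
    squares : suc m * suc m + b * b < suc b * suc b + m * m
    squares = begin-strict
      suc m * suc m + b * b
        ≡⟨ solve 2 (λ m b → (con 1 :+ m) :* (con 1 :+ m) :+ b :* b := (m :+ m) :+ (con 1 :+ m :* m :+ b :* b)) ≡.refl m b ⟩
      (m + m) + (1 + m * m + b * b)
        <⟨ ℕ.+-monoˡ-< (1 + m * m + b * b) (ℕ.+-mono-< m<b m<b) ⟩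
      (b + b) + (1 + m * m + b * b)
        ≡⟨ solve 2 (λ m b → (b :+ b) :+ (con 1 :+ m :* m :+ b :* b) := (con 1 :+ b) :* (con 1 :+ b) :+ m :* m) ≡.refl m b ⟩
      suc b * suc b + m * m ∎

  exchange-two : ∀ s r x y → (s + r) + (x + y) ≡ (x + (y + r)) + s
  exchange-two = solve 4 (λ s r x y → (s :+ r) :+ (x :+ y) := (x :+ (y :+ r)) :+ s) ≡.refl

  -- For a leg A of weight 1: s, x, y are the costs of weights b + 1, b and 1, while t is the cost
  -- of weight 0. Concavity speaks of s + t, and as no leg of weight 0 is created, the bound is only
  -- better.
  split-decreases : ∀ {μ ν s t x y} → μ + (x + y) ≡ ν + s → s + t < y + x → μ < ν
  split-decreases {μ} {ν} {s} {t} {x} {y} eq s+t<y+x = ℕ.+-cancelʳ-< (x + y) μ ν (begin-strict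
    μ + (x + y)   ≡⟨ eq ⟩
    ν + s           ≤⟨ ℕ.+-monoʳ-≤ ν (ℕ.m≤m+n s t) ⟩
    ν + (s + t)   <⟨ ℕ.+-monoʳ-< ν s+t<y+x ⟩
    ν + (y + x)   ≡⟨ ≡.cong (ν +_) (ℕ.+-comm y x) ⟩
    ν + (x + y)   ∎)

  -- The cost r of the leg of weight 1 cancels: the merge creates that leg and the split consumes
  -- it. What remains is the comparison of the weights m, b + 1 with m + 1, b.
  merge-split-decreases : ∀ {μ μ₁ ν s t x y r} → μ + (x + r) ≡ μ₁ + s → μ₁ + y ≡ ν + (t + r) →
                          s + t < y + x → μ < ν
  merge-split-decreases {μ} {μ₁} {ν} {s} {t} {x} {y} {r} eq eq₁ s+t<y+x =
    ℕ.+-cancelʳ-< (y + x) μ ν (ℕ.+-cancelʳ-< r (μ + (y + x)) (ν + (y + x)) (begin-strict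
      (μ + (y + x)) + r
        ≡⟨ solve 4 (λ u y x r → (u :+ (y :+ x)) :+ r := (u :+ (x :+ r)) :+ y) ≡.refl μ y x r ⟩
      (μ + (x + r)) + y     ≡⟨ ≡.cong (_+ y) eq ⟩
      (μ₁ + s) + y            ≡⟨ solve 3 (λ u s y → (u :+ s) :+ y := (u :+ y) :+ s) ≡.refl μ₁ s y ⟩
      (μ₁ + y) + s            ≡⟨ ≡.cong (_+ s) eq₁ ⟩
      (ν + (t + r)) + s     ≡⟨ solve 4 (λ u t r s → (u :+ (t :+ r)) :+ s := (u :+ (s :+ t)) :+ r) ≡.refl ν t r s ⟩
      (ν + (s + t)) + r     <⟨ ℕ.+-monoˡ-< r (ℕ.+-monoʳ-< ν s+t<y+x) ⟩
      (ν + (y + x)) + r     ∎))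

open CostArithmetic

-- Straightening incomparable tags.

module Straightening {c ℓ₁ ℓ₂} (𝕂 : HeytingField c ℓ₁ ℓ₂) (k : ℕ) (𝕊 : MarkedSurface) (ℳ : Space) where
  open Moves 𝕂 k 𝕊 ℳ renaming (D to D′)
  open E using (V; Matrix; _$ᵥ_)
  open Surface 𝕊
  open Diagrams k 𝕊 ℳ
  private module M = Moduli 𝕂 k 𝕊 ℳ
  open M using (RegularPoint; ⟦_⟧at_)

  -- Taking the source as an argument lets an equation between sources be substituted. An inner edge
  -- gets the constant function 1, the neutral factor in the network.
  legValue : ∀ {X : Set} → RegularPoint → MarkedPoint ⊎ X → ℕ → Subset k → Λ k
  legValue z (inj₁ (inj₁ p)) a S = E.step (RegularPoint.act z p (proj₁ (representative S))) a
  legValue z (inj₁ (inj₂ b)) a S = M.boundaryTensor ℳ (RegularPoint.boundary-decoration z b) a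
  legValue z (inj₂ _)        a S = λ _ → 1#

  legValue-map : ∀ {X Y : Set} {f : X → Y} z (s : MarkedPoint ⊎ X) a S → legValue z (Sum.map₂ f s) a S ≡ legValue z s a S
  legValue-map z (inj₁ (inj₁ p)) a S = ≡.refl
  legValue-map z (inj₁ (inj₂ b)) a S = ≡.refl
  legValue-map z (inj₂ _)        a S = ≡.refl

  sourceTensor : (D : PseudotaggedDiagram) → RegularPoint → PseudotaggedDiagram.Edge D → Λ k
  sourceTensor D z e = legValue z (source e) (wt e) (φ e)
    where open PseudotaggedDiagram D

  evaluation-network : ∀ D z → let T = PseudotaggedDiagram.diagram D in
    ⟦ D ⟧at z ≈ network T (weights (RegularPoint.point z) T (sourceTensor D z))
  evaluation-network D z = ∑-cong labels (λ σ → ∑-cong labels (λ τ → *-cong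
    (∏-cong (allFin #vertices) (λ v → reflexive (vertices σ τ (vertex v))))
    (∏-cong (allFin #edges) (λ e → *-congˡ (reflexive (sources σ e))))))
    where
    open PseudotaggedDiagram D
    labels = M.labellings D z
    vertices : ∀ σ τ v → M.vertexEntry D z σ τ v ≡ entry σ τ v
    vertices σ τ (white _ _ _)      = ≡.refl
    vertices σ τ (black _ _ _)      = ≡.refl
    vertices σ τ (coevaluation _ _) = ≡.refl
    vertices σ τ (evaluation _ _)   = ≡.refl
    sources : ∀ σ e → M.sourceEntry D z σ e ≡ sourceTensor D z e (σ e)
    sources σ e with source e
    ... | inj₁ (inj₁ p) = ≡.refl
    ... | inj₁ (inj₂ b) = ≡.refl
    ... | inj₂ _        = ≡.refl

  -- (u - 1)ʰ as a combination of powers of u.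
  binomial : ℕ → List (Carrier × ℕ)
  binomial zero    = (1# , 0) ∷ []
  binomial (suc h) = map (Product.map₂ suc) (binomial h) ++ map (Product.map₁ (λ s → - s)) (binomial h)

  N^-binomial : ∀ z p h v i → Nilpotent.N^ (M.Point.monodromy z p) h v i ≈
                              ∑ (binomial h) (λ (s , j) → s * powers z p j v i)
  N^-binomial z p zero    v i = sym (trans (+-identityʳ _) (*-identityˡ _))
  N^-binomial z p (suc h) v i = begin
    N (N^ h v) i
      ≈⟨ N-cong (N^-binomial z p h v) i ⟩
    N (λ l → ∑ (binomial h) (λ (s , j) → s * powers z p j v l)) i
      ≈⟨ N^-∑ 1 (binomial h) proj₁ (λ (s , j) → powers z p j v) i ⟩
    ∑ (binomial h) (λ (s , j) → s * (powers z p (suc j) v i + - powers z p j v i))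
      ≈⟨ ∑-cong (binomial h) (λ (s , j) → trans (distribˡ _ _ _) (+-congˡ (trans (sym (-‿distribʳ-* _ _)) (-‿distribˡ-* _ _)))) ⟩
    ∑ (binomial h) (λ (s , j) → s * powers z p (suc j) v i + - s * powers z p j v i)
      ≈⟨ ∑-+ (binomial h) _ _ ⟩
    ∑ (binomial h) (λ (s , j) → s * powers z p (suc j) v i) + ∑ (binomial h) (λ (s , j) → - s * powers z p j v i)
      ≈⟨ trans (∑-++ (map (Product.map₂ suc) (binomial h)) _ _)
           (+-cong (∑-map (Product.map₂ suc) (binomial h) _) (∑-map (Product.map₁ (λ s → - s)) (binomial h) _)) ⟨
    ∑ (binomial (suc h)) (λ (s , j) → s * powers z p j v i) ∎
    where open Nilpotent (M.Point.monodromy z p)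

  edgeCost : ∀ {X : Set} → MarkedPoint ⊎ X → ℕ → ℕ
  edgeCost (inj₁ (inj₁ _)) a = k ℕ.* k ℕ.∸ a ℕ.* a
  edgeCost (inj₁ (inj₂ _)) a = 0
  edgeCost (inj₂ _)        a = 0

  edgeCost-map : ∀ {X Y : Set} {f : X → Y} (s : MarkedPoint ⊎ X) a → edgeCost (Sum.map₂ f s) a ≡ edgeCost s a
  edgeCost-map (inj₁ (inj₁ _)) a = ≡.refl
  edgeCost-map (inj₁ (inj₂ _)) a = ≡.refl
  edgeCost-map (inj₂ _)        a = ≡.refl

  cost : (T : TensorDiagram) → TensorDiagram.Edge T → ℕ
  cost T e = edgeCost (source e) (wt e)
    where open TensorDiagram T

  legCost : ℕ → ℕ
  legCost a = k ℕ.* k ℕ.∸ a ℕ.* a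

  measure : TensorDiagram → ℕ
  measure T = total #edges (cost T)
    where open TensorDiagram T

  cost-leg : ∀ T {p e a} → TensorDiagram.IsLegAt T p e → TensorDiagram.wt T e ≡ a → cost T e ≡ legCost a
  cost-leg T leg wt≡ = ≡.cong₂ edgeCost leg wt≡

  module SplitTagged (D : PseudotaggedDiagram) {p} {e g : PseudotaggedDiagram.Edge D} (e≢g : e ≢ g)
                     (leg-e : PseudotaggedDiagram.IsLegAt D p e) (leg-g : PseudotaggedDiagram.IsLegAt D p g)
                     {b} (b<k : b < k) (wt-e : PseudotaggedDiagram.wt D e ≡ b) (wt-g : PseudotaggedDiagram.wt D g ≡ 1)
                     (S : Subset k) (∣S∣ : ∣ S ∣ ≡ suc b) (j : ℕ) where
    open PseudotaggedDiagram D renaming (diagram to T)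
    open Split T e g e≢g leg-e leg-g b<k wt-e wt-g j

    split : PseudotaggedDiagram
    split = record
      { diagram = graft
      -- The edges e and g keep their old tags; now that they start at a vertex, these values carry
      -- no meaning.
      ; φ       = S Vector.∷ φ
      ; ∣φ∣     = λ { p₁ zero _ → ∣S∣ ; p₁ (suc e₁) leg → ∣φ∣ p₁ e₁ (proj₂ (relocated-inj₁ e₁ (e₁ ∈ᴱ? (e ∷ g ∷ [])) leg)) }
      }

    ∉-moved : ∀ {e₁} → e₁ ≢ e → e₁ ≢ g → e₁ ∉ e ∷ g ∷ []
    ∉-moved e₁≢e e₁≢g (here eq)         = e₁≢e eq
    ∉-moved e₁≢e e₁≢g (there (here eq)) = e₁≢g eq

    moved : ∀ {e₁} z → e₁ ∈ e ∷ g ∷ [] → sourceTensor split z (suc e₁) ≡ (λ _ → 1#)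
    moved {e₁} z e₁∈ = ≡.cong (λ s → legValue z s (wt e₁) (φ e₁)) (source-moved e₁ e₁∈)

    split-evaluation : ∀ z (src : Fin k → Edge → Λ k) →
      (∀ i e₁ → e₁ ≢ e → e₁ ≢ g → sourceTensor D z e₁ ≋ src i e₁) →
      (∀ i → src i e ≋ D′ (δ i) (E.step (RegularPoint.act z p (proj₁ (representative S))) (suc b))) →
      (∀ i → src i g ≋ vec (powers (RegularPoint.point z) p j (δ i))) →
      ⟦ split ⟧at z ≈ ∑ (allFin k) (λ i → network T (weights (RegularPoint.point z) T (src i)))
    split-evaluation z src others srcₑ src-g = trans (evaluation-network split z)
      (network-split (RegularPoint.point z) (sourceTensor split z) src
        (E.degree (RegularPoint.act z p (proj₁ (representative S))) (suc b) b<k) (λ _ → refl)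
        (≡⇒≋ (moved z (here ≡.refl)))
        (≡⇒≋ (moved z (there (here ≡.refl))))
        (λ i e₁ e₁≢e e₁≢g Q → trans (≡⇒≋ (kept e₁ e₁≢e e₁≢g) Q) (others i e₁ e₁≢e e₁≢g Q))
        srcₑ src-g)
      where
      kept : ∀ e₁ → e₁ ≢ e → e₁ ≢ g → sourceTensor split z (suc e₁) ≡ sourceTensor D z e₁
      kept e₁ e₁≢e e₁≢g = ≡.trans (≡.cong (λ s → legValue z s (wt e₁) (φ e₁)) (source-kept e₁ (∉-moved e₁≢e e₁≢g)))
        (legValue-map z (source e₁) (wt e₁) (φ e₁))

    -- Two legs turn into inner edges and one of weight b + 1 appears. The costs are balanced
    -- additively, since subtraction of natural numbers truncates.
    split-measure : measure graft ℕ.+ (legCost b ℕ.+ legCost 1) ≡ measure T ℕ.+ legCost (suc b)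
    split-measure = ≡.trans (≡.cong (λ r → (legCost (suc b) ℕ.+ r) ℕ.+ (legCost b ℕ.+ legCost 1)) (total-cong kept))
      (≡.trans (exchange-two (legCost (suc b)) rest (legCost b) (legCost 1))
        (≡.cong (ℕ._+ legCost (suc b)) (≡.sym (≡.trans (total-at e (cost T)) (≡.cong₂ ℕ._+_ (cost-leg T leg-e wt-e)
          (≡.trans (total-at g (cost T [ e ≔ 0 ])) (≡.cong (ℕ._+ rest)
            (≡.trans (updateAt-minimal g e (cost T) (e≢g ∘ ≡.sym)) (cost-leg T leg-g wt-g)))))))))
      where
      rest : ℕ
      rest = total #edges (cost T [ e ≔ 0 ] [ g ≔ 0 ])
      kept : ∀ e₁ → cost graft (suc e₁) ≡ (cost T [ e ≔ 0 ] [ g ≔ 0 ]) e₁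
      kept e₁ = go (e₁ Fin.≟ g) (e₁ Fin.≟ e)
        where
        go : Dec (e₁ ≡ g) → Dec (e₁ ≡ e) → cost graft (suc e₁) ≡ (cost T [ e ≔ 0 ] [ g ≔ 0 ]) e₁
        go (yes ≡.refl) _ = ≡.trans (≡.cong (λ s → edgeCost s (wt e₁)) (source-moved g (there (here ≡.refl))))
            (≡.sym (updateAt-updates g (cost T [ e ≔ 0 ])))
        go (no e₁≢g) (yes ≡.refl) = ≡.trans (≡.cong (λ s → edgeCost s (wt e₁)) (source-moved e (here ≡.refl)))
            (≡.sym (≡.trans (updateAt-minimal e₁ g (cost T [ e ≔ 0 ]) e₁≢g) (updateAt-updates e (cost T))))
        go (no e₁≢g) (no e₁≢e) = ≡.trans (≡.trans (≡.cong (λ s → edgeCost s (wt e₁)) (source-kept e₁ (∉-moved e₁≢e e₁≢g)))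
          (edgeCost-map (source e₁) (wt e₁)))
            (≡.sym (≡.trans (updateAt-minimal e₁ g (cost T [ e ≔ 0 ]) e₁≢g) (updateAt-minimal e₁ e (cost T) e₁≢e)))

  module MergeTagged (D : PseudotaggedDiagram) {p} {e : PseudotaggedDiagram.Edge D}
                     (leg : PseudotaggedDiagram.IsLegAt D p e)
                     {m} (1≤m : 1 ≤ m) (wt-e : PseudotaggedDiagram.wt D e ≡ suc m)
                     (S : Subset k) (∣S∣ : ∣ S ∣ ≡ m) (x : Fin k) where
    open PseudotaggedDiagram D renaming (diagram to T)
    open Merge T e leg 1≤m wt-e

    merge : PseudotaggedDiagram
    merge = record
      { diagram = graft
      -- The tag of the leg of weight 1 is a placeholder of the right size: the split that follows
      -- makes this leg an inner edge.
      ; φ       = S Vector.∷ (⁅ x ⁆ Vector.∷ φ)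
      ; ∣φ∣     = λ { p₁ zero _ → ∣S∣ ; p₁ (suc zero) _ → Subset.∣⁅x⁆∣≡1 x
                    ; p₁ (suc (suc e₁)) leg → ∣φ∣ p₁ e₁ (proj₂ (relocated-inj₁ e₁ (e₁ ∈ᴱ? (e ∷ [])) leg)) }
      }

    ∉-moved : ∀ {e₁} → e₁ ≢ e → e₁ ∉ e ∷ []
    ∉-moved e₁≢e (here eq) = e₁≢e eq

    merge-moved : ∀ z → sourceTensor merge z (old e) ≡ (λ _ → 1#)
    merge-moved z = ≡.cong (λ s → legValue z s (wt e) (φ e)) (source-moved e (here ≡.refl))

    merge-kept : ∀ z e₁ → e₁ ≢ e → sourceTensor merge z (old e₁) ≡ sourceTensor D z e₁
    merge-kept z e₁ e₁≢e = ≡.trans (≡.cong (λ s → legValue z s (wt e₁) (φ e₁)) (source-kept e₁ (∉-moved e₁≢e)))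
      (legValue-map z (source e₁) (wt e₁) (φ e₁))

    merge-measure : measure graft ℕ.+ legCost (suc m) ≡ measure T ℕ.+ (legCost m ℕ.+ legCost 1)
    merge-measure = ≡.trans (≡.cong (λ r → (legCost m ℕ.+ (legCost 1 ℕ.+ r)) ℕ.+ legCost (suc m)) (total-cong kept))
      (≡.trans (≡.sym (exchange-two (legCost (suc m)) rest (legCost m) (legCost 1)))
        (≡.cong (ℕ._+ (legCost m ℕ.+ legCost 1)) (≡.sym (≡.trans (total-at e (cost T)) (≡.cong (ℕ._+ rest) (cost-leg T leg wt-e))))))
      where
      rest : ℕ
      rest = total #edges (cost T [ e ≔ 0 ])
      kept : ∀ e₁ → cost graft (old e₁) ≡ (cost T [ e ≔ 0 ]) e₁
      kept e₁ = go (e₁ Fin.≟ e)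
        where
        go : Dec (e₁ ≡ e) → cost graft (old e₁) ≡ (cost T [ e ≔ 0 ]) e₁
        go (yes ≡.refl) = ≡.trans (≡.cong (λ s → edgeCost s (wt e₁)) (source-moved e (here ≡.refl))) (≡.sym (updateAt-updates e (cost T)))
        go (no e₁≢e) = ≡.trans (≡.trans (≡.cong (λ s → edgeCost s (wt e₁)) (source-kept e₁ (∉-moved e₁≢e)))
          (edgeCost-map (source e₁) (wt e₁))) (≡.sym (updateAt-minimal e₁ e (cost T) e₁≢e))

  module Pair (D : PseudotaggedDiagram) {p} {e e′ : PseudotaggedDiagram.Edge D}
              (leg-e : PseudotaggedDiagram.IsLegAt D p e) (leg-e′ : PseudotaggedDiagram.IsLegAt D p e′)
              {m h} (wt-e : PseudotaggedDiagram.wt D e ≡ suc m) (wt-e′ : PseudotaggedDiagram.wt D e′ ≡ m ℕ.+ suc h)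
              {x} (x∈ : x Subset.∈ PseudotaggedDiagram.φ D e) (x∉ : x Subset.∉ PseudotaggedDiagram.φ D e′) where
    open PseudotaggedDiagram D renaming (diagram to T)

    A B A⁻ B⁺ : Subset k
    A  = φ e
    B  = φ e′
    A⁻ = A [ x ]≔ outside
    B⁺ = B [ x ]≔ inside

    -- The weight of B. As A has weight m + 1, the exponent b + 1 - ∣ A ∣ of N is `suc h`, which is
    -- 1 for tags of equal size; thus m < b always holds.
    b : ℕ
    b = m ℕ.+ suc h

    e≢e′ : e ≢ e′
    e≢e′ ≡.refl = x∉ x∈

    ∣A∣ : ∣ A ∣ ≡ suc m
    ∣A∣ = ≡.trans (∣φ∣ p e leg-e) wt-e

    ∣B∣ : ∣ B ∣ ≡ b
    ∣B∣ = ≡.trans (∣φ∣ p e′ leg-e′) wt-e′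

    ∣A⁻∣ : ∣ A⁻ ∣ ≡ m
    ∣A⁻∣ = ℕ.suc-injective (≡.trans (≡.sym (∣delete∣ A x∈)) ∣A∣)

    ∣B⁺∣ : ∣ B⁺ ∣ ≡ suc b
    ∣B⁺∣ = ≡.trans (∣insert∣ B x∉) (≡.cong suc ∣B∣)

    b<k : b < k
    b<k = ≡.subst (_≤ k) ∣B⁺∣ (Subset.∣p∣≤n B⁺)

    m<b : m < b
    m<b = ≡.subst (suc m ≤_) (≡.sym (ℕ.+-suc m h)) (s≤s (ℕ.m≤m+n m h))

    module _ (z : RegularPoint) where
      open RegularPoint z using (point; monodromy; flag; stable; act; act-acts)
      private module W = Weyl 𝕂 k (monodromy p) (flag p) (stable p) (act p) (act-acts p)
      open W using (tagged; N^)

      tagged-degree : ∀ S {a} → a ≤ k → SupportedOn (_≡ a) (tagged S a)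
      tagged-degree S {a} a≤k = E.degree (act p (proj₁ (representative S))) a a≤k

      -- The tensors of one term of the exchange identity, placed on the two legs of the original T.
      -- They belong to no tags, so this describes only a network: the meeting point of D and the
      -- grafted diagrams.
      partTensor : ℕ → Fin k → Edge → Λ k
      partTensor j i = sourceTensor D z [ e ≔ tagged A⁻ m ∙ vec (powers point p j (δ i)) ]
                                        [ e′ ≔ D′ (δ i) (tagged B⁺ (suc b)) ]

      part-e : ∀ j i → partTensor j i e ≡ tagged A⁻ m ∙ vec (powers point p j (δ i))
      part-e j i = ≡.trans (updateAt-minimal e e′ (sourceTensor D z [ e ≔ _ ]) e≢e′) (updateAt-updates e (sourceTensor D z))

      part-e′ : ∀ j i → partTensor j i e′ ≡ D′ (δ i) (tagged B⁺ (suc b))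
      part-e′ j i = updateAt-updates e′ (sourceTensor D z [ e ≔ _ ])

      part-other : ∀ j i e₁ → e₁ ≢ e → e₁ ≢ e′ → partTensor j i e₁ ≡ sourceTensor D z e₁
      part-other j i e₁ e₁≢e e₁≢e′ = ≡.trans (updateAt-minimal e₁ e′ (sourceTensor D z [ e ≔ _ ]) e₁≢e′)
        (updateAt-minimal e₁ e (sourceTensor D z) e₁≢e)

      source-e : sourceTensor D z e ≡ tagged A (suc m)
      source-e = ≡.cong₂ (λ s a → legValue z s a A) leg-e wt-e

      source-e′ : sourceTensor D z e′ ≡ tagged B b
      source-e′ = ≡.cong₂ (λ s a → legValue z s a B) leg-e′ wt-e′

      recombined : ∀ S R → ∑ (cartesianProduct (binomial (suc h)) (allFin k)) (λ ((s , j) , i) →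
                     s * ((tagged A⁻ m ∙ vec (powers point p j (δ i))) S * D′ (δ i) (tagged B⁺ (suc b)) R))
                   ≈ tagged A (suc m) S * tagged B b R
      recombined S R = begin
        ∑ (cartesianProduct bs (allFin k)) (λ ((s , j) , i) → s * ((X ∙ vec (u j i)) S * Y i))
          ≈⟨ trans (∑-product _,_ bs (allFin k) _) (∑-swap bs (allFin k) _) ⟩
        ∑ (allFin k) (λ i → ∑ bs (λ (s , j) → s * ((X ∙ vec (u j i)) S * Y i)))
          ≈⟨ ∑-cong (allFin k) (λ i → trans (∑-cong bs (λ (s , j) → sym (*-assoc _ _ _))) (trans (sym (∑-*ʳ bs _ _))
               (*-congʳ (collect i)))) ⟩
        ∑ (allFin k) (λ i → (X ∙ vec (N^ (suc h) (δ i))) S * Y i)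
          ≈⟨ W.exchange m (suc h) ∣A∣ ∣B∣ b<k x∈ x∉ S R ⟩
        tagged A (suc m) S * tagged B b R ∎
        where
        bs = binomial (suc h)
        X = tagged A⁻ m
        Y : Fin k → Carrier
        Y i = D′ (δ i) (tagged B⁺ (suc b)) R
        u : ℕ → Fin k → V
        u j i = powers point p j (δ i)
        collect : ∀ i → ∑ bs (λ (s , j) → s * (X ∙ vec (u j i)) S) ≈ (X ∙ vec (N^ (suc h) (δ i))) S
        collect i = sym (begin
          (X ∙ vec (N^ (suc h) (δ i))) S
            ≈⟨ ∙-congˡ (λ Q → trans (vec-cong (N^-binomial point p (suc h) (δ i)) Q)
                 (vec-∑ bs (λ (s , j) l → s * u j i l) Q)) S ⟩
          (X ∙ (λ Q → ∑ bs (λ (s , j) → vec (λ l → s * u j i l) Q))) S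
            ≈⟨ ∙-∑ʳ bs X (λ (s , j) → vec (λ l → s * u j i l)) S ⟩
          ∑ bs (λ (s , j) → (X ∙ vec (λ l → s * u j i l)) S)
            ≈⟨ ∑-cong bs (λ (s , j) → trans (∙-congˡ (vec-* s (u j i)) S) (∙-⊙ʳ s X (vec (u j i)) S)) ⟩
          ∑ bs (λ (s , j) → s * (X ∙ vec (u j i)) S) ∎)

      -- The transports of the two legs factor out, and `exchange` with Nʰ expanded in powers of the
      -- monodromy is the bilinear identity that remains.
      recombine : ∑ (binomial (suc h)) (λ (s , j) → s * ∑ (allFin k) (λ i → network T (weights point T (partTensor j i))))
                  ≈ network T (weights point T (sourceTensor D z))
      recombine = trans
        (trans (∑-cong (binomial (suc h)) (λ (s , j) → ∑-*ˡ (allFin k) s _)) (sym (∑-product _,_ (binomial (suc h)) (allFin k) _)))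
        (network-bilinear T pairs (λ ((s , _) , _) → s)
          (λ ((_ , j) , i) → weights point T (partTensor j i)) (weights point T (sourceTensor D z)) e≢e′
          (λ ((_ , j) , i) e₁ e₁≢e e₁≢e′ s t → *-congˡ (≡⇒≋ (part-other j i e₁ e₁≢e e₁≢e′) s))
          λ S S′ R R′ → let u = transportColumns S S′ e ; v = transportColumns R R′ e′ in begin
            ∑ pairs (λ ((s , j) , i) → s * ((u * partTensor j i e S) * (v * partTensor j i e′ R)))
              ≈⟨ ∑-cong pairs (λ ((s , j) , i) → trans (*-congˡ (trans (*-interchange _ _ _ _) (*-congˡ (*-cong
                   (≡⇒≋ (part-e j i) S) (≡⇒≋ (part-e′ j i) R)))))
                   (x*yz≈y*xz _ _ _)) ⟩
            ∑ pairs (λ ((s , j) , i) → (u * v) * (s * ((tagged A⁻ m ∙ vec (powers point p j (δ i))) S * D′ (δ i) (tagged B⁺ (suc b)) R)))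
              ≈⟨ trans (sym (∑-*ˡ pairs _ _)) (*-congˡ (recombined S R)) ⟩
            (u * v) * (tagged A (suc m) S * tagged B b R)
              ≈⟨ trans (*-congˡ (*-cong (≡⇒≋ (≡.sym source-e) S) (≡⇒≋ (≡.sym source-e′) R)))
                   (*-interchange _ _ _ _) ⟩
            (u * sourceTensor D z e S) * (v * sourceTensor D z e′ R) ∎)
        where
        pairs : List ((Carrier × ℕ) × Fin k)
        pairs = cartesianProduct (binomial (suc h)) (allFin k)
        transportColumns : Subset k → Subset k → Edge → Carrier
        transportColumns s t e₁ = E.columns (RegularPoint.transport z (path e₁)) s t

    Replaced : Set _
    Replaced = Σ[ family ∈ (ℕ → PseudotaggedDiagram) ] (∀ j → measure (PseudotaggedDiagram.diagram (family j)) < measure T) ×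
      (∀ (j : ℕ) z → ⟦ family j ⟧at z ≈ ∑ (allFin k) (λ i → network T (weights (RegularPoint.point z) T (partTensor z j i))))

    -- The split has e′ as heavy and e as light edge: with m = 0 the leg e has weight 1 already, and
    -- the factor contributed by the empty set A⁻ is the unit.
    short : m ≡ 0 → Replaced
    short m≡0 = split , smaller , λ j z → split-evaluation j z (partTensor z j)
      (λ i e₁ e₁≢e′ e₁≢e Q → ≡⇒≋ (≡.sym (part-other z j i e₁ e₁≢e e₁≢e′)) Q)
      (λ i → ≡⇒≋ (part-e′ z j i))
      (λ i Q → trans (≡⇒≋ (part-e z j i) Q) (trans (∙-congʳ (trivial z) Q) (∙-unitˡ _ Q)))
      where
      open SplitTagged D (e≢e′ ∘ ≡.sym) leg-e′ leg-e b<k wt-e′ (≡.trans wt-e (≡.cong suc m≡0)) B⁺ ∣B⁺∣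
      trivial : ∀ z → E.step (RegularPoint.act z p (proj₁ (representative A⁻))) m ≋ unit
      trivial z Q = trans (reflexive (≡.cong (λ a → E.step (RegularPoint.act z p (proj₁ (representative A⁻))) a Q) m≡0))
        (trans (E.step-0 (RegularPoint.act z p (proj₁ (representative A⁻))) Q) (indicator-⊥ Q))
      smaller : ∀ j → measure (PseudotaggedDiagram.diagram (split j)) < measure T
      smaller j = split-decreases {t = legCost m} {legCost b} (split-measure j)
        (≡.subst (λ a → legCost (suc b) ℕ.+ legCost m < legCost (suc a) ℕ.+ legCost b) m≡0 (square-cost k m<b b<k))

    -- The merge first provides an edge of weight 1 ending at the former start of e; the split then
    -- feeds it from the leg of B⁺. Evaluation undoes the moves in the opposite order.
    long : 1 ≤ m → Replaced
    long 1≤m = split , smaller , λ j z → trans (split-evaluation j z (merged z j)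
        (λ { i zero _ _ Q → refl ; i (suc zero) _ g≢g Q → ⊥-elim (g≢g ≡.refl)
           ; i (suc (suc e₁)) e₁≢e′ _ Q → kept z j i e₁ (e₁≢e′ ∘ ≡.cong (λ e₂ → suc (suc e₂))) Q })
        (λ i Q → ≡⇒≋ (updateAt-updates e′ (sourceTensor D z [ e ≔ (λ _ → 1#) ])) Q)
        (λ i Q → refl))
      (∑-cong (allFin k) (λ i → network-merge (RegularPoint.point z) (merged z j i) (partTensor z j i)
        (tagged-degree z A⁻ (ℕ.<⇒≤ (ℕ.<-trans m<b b<k))) (λ _ → refl) (λ _ → refl)
        (λ Q → ≡⇒≋ (≡.trans (updateAt-minimal e e′ (sourceTensor D z [ e ≔ (λ _ → 1#) ]) e≢e′)
          (updateAt-updates e (sourceTensor D z))) Q)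
        (λ e₁ e₁≢e Q → ≡⇒≋ (agree z j i e₁ e₁≢e) Q)
        (≡⇒≋ (part-e z j i))))
      where
      open Merge T e leg-e 1≤m wt-e using (old; source-kept; network-merge)
      open MergeTagged D leg-e 1≤m wt-e A⁻ ∣A⁻∣ x
      leg-old : PseudotaggedDiagram.IsLegAt merge p (old e′)
      leg-old = ≡.trans (source-kept e′ (∉-moved (e≢e′ ∘ ≡.sym))) (≡.cong (Sum.map₂ suc) leg-e′)
      open SplitTagged merge {e = old e′} {suc zero} (λ ()) leg-old ≡.refl b<k wt-e′ ≡.refl B⁺ ∣B⁺∣
        using (split; split-evaluation; split-measure)
      -- The tensors between the two moves: A⁻ and the carried basis vector on the new legs, the
      -- contraction of B⁺ on e′, and the neutral 1 on e, which is an inner edge here.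
      merged : ∀ z → ℕ → Fin k → PseudotaggedDiagram.Edge merge → Λ k
      merged z j i = E.step (RegularPoint.act z p (proj₁ (representative A⁻))) m Vector.∷
        (vec (powers (RegularPoint.point z) p j (δ i)) Vector.∷
        (sourceTensor D z [ e ≔ (λ _ → 1#) ] [ e′ ≔ D′ (δ i) (E.step (RegularPoint.act z p (proj₁ (representative B⁺))) (suc b)) ]))
      kept : ∀ z j i e₁ → e₁ ≢ e′ → sourceTensor merge z (old e₁) ≋ merged z j i (old e₁)
      kept z j i e₁ e₁≢e′ Q = trans (go (e₁ Fin.≟ e)) (reflexive (≡.cong (λ x → x Q)
        (≡.sym (updateAt-minimal e₁ e′ (sourceTensor D z [ e ≔ (λ _ → 1#) ]) e₁≢e′))))
        where
        go : Dec (e₁ ≡ e) → sourceTensor merge z (old e₁) Q ≈ (sourceTensor D z [ e ≔ (λ _ → 1#) ]) e₁ Q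
        go (yes ≡.refl) = ≡⇒≋ (≡.trans (merge-moved z) (≡.sym (updateAt-updates e (sourceTensor D z)))) Q
        go (no e₁≢e) = ≡⇒≋ (≡.trans (merge-kept z e₁ e₁≢e) (≡.sym (updateAt-minimal e₁ e (sourceTensor D z) e₁≢e))) Q
      agree : ∀ z j i e₁ → e₁ ≢ e → merged z j i (old e₁) ≡ partTensor z j i e₁
      agree z j i e₁ e₁≢e with e₁ Fin.≟ e′
      ... | yes ≡.refl = ≡.trans (updateAt-updates e′ (sourceTensor D z [ e ≔ (λ _ → 1#) ])) (≡.sym (part-e′ z j i))
      ... | no e₁≢e′ = ≡.trans (updateAt-minimal e₁ e′ (sourceTensor D z [ e ≔ (λ _ → 1#) ]) e₁≢e′)
        (≡.trans (updateAt-minimal e₁ e (sourceTensor D z) e₁≢e) (≡.sym (part-other z j i e₁ e₁≢e e₁≢e′)))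
      smaller : ∀ j → measure (PseudotaggedDiagram.diagram (split j)) < measure T
      smaller j = merge-split-decreases {x = legCost b} {r = legCost 1} (split-measure j) merge-measure (square-cost k m<b b<k)

    replaced : Replaced
    replaced with m ℕ.≟ 0
    ... | yes m≡0 = short m≡0
    ... | no m≢0  = long (ℕ.n≢0⇒n>0 m≢0)

    Expansion : Set _
    Expansion = Σ[ family ∈ (ℕ → PseudotaggedDiagram) ] (∀ j → measure (PseudotaggedDiagram.diagram (family j)) < measure T) ×
      (∀ z → ⟦ D ⟧at z ≈ ∑ (binomial (suc h)) (λ (s , j) → s * ⟦ family j ⟧at z))

    expansion : Expansion
    expansion with family , smaller , sums ← replaced = family , smaller , λ z → trans (evaluation-network D z)
      (trans (sym (recombine z)) (∑-cong (binomial (suc h)) (λ (s , j) → *-congˡ (sym (sums j z)))))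

  isLegAt? : ∀ {X : Set} p (s : MarkedPoint ⊎ X) → Dec (s ≡ inj₁ (inj₁ p))
  isLegAt? p (inj₁ (inj₁ q)) = map′ (≡.cong (inj₁ ∘ inj₁)) (λ { ≡.refl → ≡.refl }) (q Fin.≟ p)
  isLegAt? p (inj₁ (inj₂ _)) = no λ ()
  isLegAt? p (inj₂ _)        = no λ ()

  module _ (D : PseudotaggedDiagram) where
    open PseudotaggedDiagram D

    Incomparable : Set
    Incomparable = ∃[ p ] ∃[ e ] ∃[ e′ ] IsLegAt p e × IsLegAt p e′ × ¬ φ e ⊆ φ e′ × ¬ φ e′ ⊆ φ e

    incomparable? : Dec Incomparable
    incomparable? = Fin.any? λ p → Fin.any? λ e → Fin.any? λ e′ → isLegAt? p (source e) ×-dec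
      (isLegAt? p (source e′) ×-dec (¬? (φ e Subset.⊆? φ e′) ×-dec ¬? (φ e′ Subset.⊆? φ e)))

    comparable⇒tagged : ¬ Incomparable → IsTagged D
    comparable⇒tagged none p e e′ leg-e leg-e′ with φ e Subset.⊆? φ e′ | φ e′ Subset.⊆? φ e
    ... | yes ⊆ | _     = inj₁ ⊆
    ... | no _  | yes ⊇ = inj₂ ⊇
    ... | no ⊈  | no ⊉  = ⊥-elim (none (p , e , e′ , leg-e , leg-e′ , ⊈ , ⊉))

  Reduction : PseudotaggedDiagram → Set (c ⊔ ℓ₁)
  Reduction D = Σ[ xs ∈ List (Carrier × ℕ) ] Σ[ family ∈ (ℕ → PseudotaggedDiagram) ]
    (∀ j → measure (PseudotaggedDiagram.diagram (family j)) < measure (PseudotaggedDiagram.diagram D)) ×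
    (∀ z → ⟦ D ⟧at z ≈ ∑ xs (λ (s , j) → s * ⟦ family j ⟧at z))

  reduction-ordered : ∀ D {p e e′} → let open PseudotaggedDiagram D in
                      IsLegAt p e → IsLegAt p e′ → wt e ≤ wt e′ → ¬ φ e ⊆ φ e′ → Reduction D
  reduction-ordered D {p} {e} {e′} leg-e leg-e′ le ⊈ with x , x∈ , x∉ ← ⊈⇒∃ ⊈ = result
    where
    open PseudotaggedDiagram D
    m h : ℕ
    m = pred (wt e)
    -- One less than the exponent of N, because m is one less than the weight of e. Putting the
    -- lighter leg in the role of A keeps this difference from being truncated.
    h = wt e′ ℕ.∸ wt e
    wt-e : wt e ≡ suc m
    wt-e = ≡.sym (ℕ.suc-pred (wt e) ⦃ ℕ.>-nonZero (1≤wt e) ⦄)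
    wt-e′ : wt e′ ≡ m ℕ.+ suc h
    wt-e′ = ≡.trans (≡.sym (ℕ.m+[n∸m]≡n le)) (≡.trans (≡.cong (ℕ._+ h) wt-e) (≡.sym (ℕ.+-suc m h)))
    result : Reduction D
    result with family , smaller , sums ← Pair.expansion D leg-e leg-e′ wt-e wt-e′ x∈ x∉ =
      binomial (suc h) , family , smaller , sums

  reduction : ∀ D → Incomparable D → Reduction D
  reduction D (p , e , e′ , leg-e , leg-e′ , ⊈ , ⊉) with ℕ.≤-total (PseudotaggedDiagram.wt D e) (PseudotaggedDiagram.wt D e′)
  ... | inj₁ le = reduction-ordered D leg-e leg-e′ le ⊈
  ... | inj₂ ge = reduction-ordered D leg-e′ leg-e ge ⊉

  -- The coefficients and diagrams of a reduction do not involve the point z, so the expansions of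
  -- all members of the family can be substituted before anything is evaluated.
  straighten : ∀ D → Acc _<_ (measure (PseudotaggedDiagram.diagram D)) → M.IsLinearCombinationOfTagged D
  straighten D (acc rec) with incomparable? D
  ... | no none = (1# , D , comparable⇒tagged D none) ∷ [] , λ z → sym (trans (+-identityʳ _) (*-identityˡ _))
  ... | yes pair with xs , family , smaller , sums ← reduction D pair = concatMap terms xs , λ z →
      trans (sums z) (sym (collect z xs))
    where
    tagged : ∀ j → M.IsLinearCombinationOfTagged (family j)
    tagged j = straighten (family j) (rec (smaller j))
    terms : Carrier × ℕ → List (Carrier × TaggedDiagram)
    terms (s , j) = map (Product.map₁ (s *_)) (proj₁ (tagged j))
    value : RegularPoint → Carrier × TaggedDiagram → Carrier
    value z (a , T , _) = a * ⟦ T ⟧at z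
    scaled : ∀ z s j → ∑ (terms (s , j)) (value z) ≈ s * ⟦ family j ⟧at z
    scaled z s j = trans (∑-map (Product.map₁ (s *_)) (proj₁ (tagged j)) (value z)) (trans
      (∑-cong (proj₁ (tagged j)) (λ _ → *-assoc _ _ _)) (trans (sym (∑-*ˡ (proj₁ (tagged j)) s (value z)))
      (*-congˡ (sym (proj₂ (tagged j) z)))))
    collect : ∀ z xs → ∑ (concatMap terms xs) (value z) ≈ ∑ xs (λ (s , j) → s * ⟦ family j ⟧at z)
    collect z []             = refl
    collect z ((s , j) ∷ xs) = trans (∑-++ (terms (s , j)) (concatMap terms xs) (value z)) (+-cong (scaled z s j) (collect z xs))

theorem9p1 : {c ℓ₁ ℓ₂ : Level} (𝕂 : HeytingField c ℓ₁ ℓ₂) → CharacteristicZero 𝕂 →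
    (k : ℕ) → 2 ≤ k →
    (𝕊 : MarkedSurface) (ℳ : Space) →
    let open Moduli 𝕂 k 𝕊 ℳ in
    (D : PseudotaggedDiagram) → IsLinearCombinationOfTagged D
theorem9p1 𝕂 _ k _ 𝕊 ℳ D = Straightening.straighten 𝕂 k 𝕊 ℳ D (<-wellFounded _)
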